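{- There are absolute constants $k_0\in\mathbb N$ and $\alpha,\varepsilon>0$ such that for all integers $d\ge k\ge k_0$ and every $n\ge\alpha d^8k^6$ there is a pair of $k$-ary relational structures $\mathfrak A$ and $\mathfrak B$ with $|V(\mathfrak A)|=|V(\mathfrak B)|=n$ such that some sentence of $\mathsf{FO}^k$ is true in $\mathfrak A$ and false in $\mathfrak B$, but for every sentence $\psi$ of $\mathsf{FO}^d$ or of $\mathsf C^d$ of quantifier rank at most $n^{\varepsilon k}$ we have $\mathfrak A\models\psi$ iff $\mathfrak B\models\psi$.
   Context: $\mathsf{FO}$ is first-order logic over relational vocabularies (atomic formulas $x=y$, $R(x_1,\dots,x_r)$; $\wedge$, $\neg$, $\exists$). $\mathsf C$ extends it by counting quantifiers $\exists^{\ge j}x\,\varphi$. $\mathsf{FO}^k$ and $\mathsf C^k$ are the fragments using at most $k$ distinct variables (variables may be reused). Quantifier rank is the maximal nesting depth of quantifiers (counting quantifiers count as quantifiers). A $k$-ary structure has a finite universe and relations of arity at most $k$. -}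

module Defs where

open import Data.Nat using (ℕ; zero; suc; _+_; _⊔_; _≤_; _≤ᵇ_)
open import Data.Fin using (Fin; zero; suc; _≟_)
open import Data.Bool using (Bool; true; false; T; _∧_; _∨_; not; if_then_else_)
open import Data.Product using (_×_)
open import Data.Unit using (⊤)
open import Relation.Nullary.Decidable using (⌊_⌋)

record Vocab : Set where
  field
    nsym  : ℕ
    arity : Fin nsym → ℕ
open Vocab public

KAry : ℕ → Vocab → Set
KAry k σ = (R : Fin (nsym σ)) → arity σ R ≤ k

Structure : Vocab → ℕ → Set
Structure σ n = (R : Fin (nsym σ)) → (Fin (arity σ R) → Fin n) → Bool

-- Formulas of C (counting logic) over σ with variables x_0,…,x_{v-1}
-- (variables may be reused): this is exactly C^v.
data Formula (σ : Vocab) (v : ℕ) : Set where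
  eq   : Fin v → Fin v → Formula σ v
  rel  : (R : Fin (nsym σ)) → (Fin (arity σ R) → Fin v) → Formula σ v
  neg  : Formula σ v → Formula σ v
  and  : Formula σ v → Formula σ v → Formula σ v
  ex   : Fin v → Formula σ v → Formula σ v
  exGe : ℕ → Fin v → Formula σ v → Formula σ v

IsFO : ∀ {σ v} → Formula σ v → Set
IsFO (eq x y)     = ⊤
IsFO (rel R xs)   = ⊤
IsFO (neg φ)      = IsFO φ
IsFO (and φ ψ)    = IsFO φ × IsFO ψ
IsFO (ex x φ)     = IsFO φ
IsFO (exGe j x φ) = Data.Empty.⊥
  where import Data.Empty

qr : ∀ {σ v} → Formula σ v → ℕ
qr (eq x y)     = 0
qr (rel R xs)   = 0
qr (neg φ)      = qr φ
qr (and φ ψ)    = qr φ ⊔ qr ψ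
qr (ex x φ)     = suc (qr φ)
qr (exGe j x φ) = suc (qr φ)

upd : ∀ {v} {A : Set} → (Fin v → A) → Fin v → A → Fin v → A
upd s x a y = if ⌊ y ≟ x ⌋ then a else s y

ClosedUnder : ∀ {σ v} → (Fin v → Bool) → Formula σ v → Set
ClosedUnder B (eq x y)     = T (B x) × T (B y)
ClosedUnder B (rel R xs)   = ∀ i → T (B (xs i))
ClosedUnder B (neg φ)      = ClosedUnder B φ
ClosedUnder B (and φ ψ)    = ClosedUnder B φ × ClosedUnder B ψ
ClosedUnder B (ex x φ)     = ClosedUnder (upd B x true) φ
ClosedUnder B (exGe j x φ) = ClosedUnder (upd B x true) φ

Sentence : ∀ {σ v} → Formula σ v → Set
Sentence φ = ClosedUnder (λ _ → false) φ

anyFin : ∀ n → (Fin n → Bool) → Bool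
anyFin zero    f = false
anyFin (suc n) f = f zero ∨ anyFin n (λ i → f (suc i))

countFin : ∀ n → (Fin n → Bool) → ℕ
countFin zero    f = 0
countFin (suc n) f = (if f zero then 1 else 0) + countFin n (λ i → f (suc i))

allFinB : ∀ n → (Fin n → Bool) → Bool
allFinB zero    f = true
allFinB (suc n) f = f zero ∧ allFinB n (λ i → f (suc i))

eval : ∀ {σ v n} → Structure σ n → (Fin v → Fin n) → Formula σ v → Bool
eval {n = n} A s (eq x y)     = ⌊ s x ≟ s y ⌋
eval {n = n} A s (rel R xs)   = A R (λ i → s (xs i))
eval {n = n} A s (neg φ)      = not (eval A s φ)
eval {n = n} A s (and φ ψ)    = eval A s φ ∧ eval A s ψ
eval {n = n} A s (ex x φ)     = anyFin n (λ a → eval A (upd s x a) φ)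
eval {n = n} A s (exGe j x φ) = j ≤ᵇ countFin n (λ a → eval A (upd s x a) φ)

-- A ⊨ φ : φ holds under every assignment (for sentences the assignment is irrelevant).
_⊨_ : ∀ {σ v n} → Structure σ n → Formula σ v → Set
A ⊨ φ = ∀ s → T (eval A s φ)

{-# OPTIONS --safe #-}
module Submission where

-- The structures encode an XOR system: an element is a variable together with a truth value, and
-- Duplicator's bijections flip the values of some variables.
--
-- The system simulates a recurrence Y_{i+2} = Y_i + A_i Y_{i+1} of vectors over 𝔽₂ with random
-- matrices A_i, computed by chains of three-term sums; in 𝔄 it starts and ends at 0, in 𝔅 it starts
-- at 0 but must end at 1.  With three of its intermediate results ("nodes") at a time Spoiler
-- follows the recurrence step by step.  However, the spans of few nodes before and of few nodes
-- after a gap of two blocks meet only in 0, so Duplicator can pretend that all nodes before a gap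
-- are 0 and that all later ones are consistent with the end value 1.  Each round moves the gap
-- back by a number of blocks polynomial in d.
--
-- The recurrence has n^Ω(k) steps but there are only n/2 variables: every node is replaced by the
-- XOR of Δ = Θ(k) random variables (hardness condensation).  Any s ≤ 2D nodes have at least s
-- variables occurring an odd number of times, so the sets of at most D nodes whose joint value is
-- fixed by D given variables form a vector space, and Duplicator only has to keep track of these.
-- Both random objects exist by a union bound.

open import Defs
open import Data.Nat using (ℕ; zero; suc; _+_; _*_; _^_; _∸_; _≤_; _<_; _<ᵇ_; _≤ᵇ_; z≤n; s≤s; NonZero; >-nonZero; _/_; ⌊_/2⌋; ⌈_/2⌉)
import Data.Nat as ℕ
open import Data.Nat.Properties hiding (_≟_)
open import Algebra.Properties.CommutativeSemigroup +-commutativeSemigroup using () renaming (interchange to +-interchange)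
open import Data.Nat.DivMod using (m/n*n≤m; m≡m%n+[m/n]*n; m%n<n)
open import Data.Nat.Solver using (module +-*-Solver)
open +-*-Solver using (solve; _:+_; _:*_; _:=_; con)
open import Data.Fin using (Fin; zero; suc; _↑ˡ_; _↑ʳ_; combine; remQuot; splitAt; toℕ; inject₁; inject≤; fromℕ)
import Data.Fin as Fin
import Data.Fin.Properties as Fin
open import Data.Bool using (Bool; true; false; T; _∧_; not; if_then_else_; _xor_)
import Data.Bool as Bool
open import Data.Bool.Properties using (xor-assoc; xor-comm; xor-same; xor-identityʳ; true-xor; ∧-identityʳ; ∧-zeroʳ; ∧-distribˡ-xor; ∧-distribʳ-xor; T-≡; T-∧)
open import Data.Maybe using (Maybe; just; nothing)
open import Data.Product using (Σ; ∃; _×_; _,_; proj₁; proj₂)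
open import Data.Product.Properties using () renaming (≡-dec to ×-≡-dec)
open import Data.Sum using (_⊎_; inj₁; inj₂)
open import Data.Unit using (tt)
open import Data.Vec using (Vec; []; _∷_; lookup; zipWith; replicate)
import Data.Vec.Properties as Vec
open import Data.List using (List; []; _∷_; length; _++_; map; allFin; tabulate; upTo; mapMaybe; cartesianProductWith)
import Data.List as List
open import Data.List.Properties using (length-map; length-++; length-tabulate; length-upTo; length-mapMaybe)
open import Data.List.Membership.Propositional using (_∈_; _∉_)
open import Data.List.Membership.Propositional.Properties using (∈-map⁺; ∈-map⁻; ∈-++⁺ˡ; ∈-++⁺ʳ; ∈-++⁻; ∈-upTo⁺; ∈-upTo⁻; ∈-allFin; ∈-cartesianProduct⁺; ∈-cartesianProduct⁻)
open import Data.List.Relation.Unary.Any using (here; there; any?; index)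
open import Data.List.Relation.Unary.Any.Properties using (lookup-index)
open import Relation.Nullary using (Dec; yes; no; ¬_; contradiction)
open import Relation.Nullary.Decidable using (⌊_⌋; map′; _×-dec_; _⊎-dec_; _→-dec_; ¬?)
open import Relation.Binary.Definitions using (tri<; tri≈; tri>)
open import Relation.Binary.PropositionalEquality using (_≡_; _≢_; _≗_; refl; sym; trans; cong; cong₂; subst; module ≡-Reasoning)
open import Function using (_∘_; Equivalence; mk⇔)
open import Function.Bundles using (_⇔_)

-- Only the difference `p` between the assignments in the two structures matters: the rules are
-- homogeneous and shared, and the target constraint differs by 1. So Duplicator wants a `p` that
-- satisfies every rule and is 1 at the target; none exists globally, and it is only maintained on
-- the pebbled variables. Counting quantifiers demand a bijection in every round; flips provide it,
-- since the answer to an element depends on its variable alone.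
--
-- A gap has two blocks for two reasons. A three-term sum reaches back at most two blocks, so no
-- rule whose nodes avoid the gap can straddle it. And one matrix need not randomise a linear form
-- (it maps (μ , 0) to (0 , μ)), whereas after two of them a nonzero form takes any given value with
-- probability at most 2^-H.
--
-- Spoiler holds three nodes, that is 3Δ variables, so Δ can be about k / 3; expansion then survives
-- for n^Ω(Δ) nodes, and this exponent becomes the rank. H may be as large as n^2: it beats the
-- union bound over all small sets of nodes but adds only a constant to the exponent of the number
-- of nodes.

^-distribʳ-* : ∀ e a b → (a * b) ^ e ≡ a ^ e * b ^ e
^-distribʳ-* zero a b = refl
^-distribʳ-* (suc e) a b = trans (cong (a * b *_) (^-distribʳ-* e a b))
  (solve 4 (λ a b c d → a :* b :* (c :* d) := a :* c :* (b :* d)) refl a b (a ^ e) (b ^ e))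

-- Vector spaces over 𝔽₂ and sums indexed by subsets

record F₂Module : Set₁ where
  infixl 6 _⊕_
  field
    Carrier   : Set
    _⊕_       : Carrier → Carrier → Carrier
    𝟘         : Carrier
    ⊕-assoc   : ∀ x y z → (x ⊕ y) ⊕ z ≡ x ⊕ (y ⊕ z)
    ⊕-comm    : ∀ x y → x ⊕ y ≡ y ⊕ x
    𝟘-⊕       : ∀ x → 𝟘 ⊕ x ≡ x
    ⊕-self    : ∀ x → x ⊕ x ≡ 𝟘

  ⊕-𝟘 : ∀ x → x ⊕ 𝟘 ≡ x
  ⊕-𝟘 x = trans (⊕-comm x 𝟘) (𝟘-⊕ x)

  ⊕-cancelˡ : ∀ x y → x ⊕ (x ⊕ y) ≡ y
  ⊕-cancelˡ x y = trans (sym (⊕-assoc x x y)) (trans (cong (_⊕ y) (⊕-self x)) (𝟘-⊕ y))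

  ⊕-move : ∀ {x y z} → x ⊕ y ≡ z → y ≡ x ⊕ z
  ⊕-move {x} {y} e = trans (sym (⊕-cancelˡ x y)) (cong (x ⊕_) e)

  ⊕≡𝟘 : ∀ {x y} → x ⊕ y ≡ 𝟘 → x ≡ y
  ⊕≡𝟘 {x} {y} e = trans (sym (⊕-𝟘 x)) (trans (cong (x ⊕_) (sym e)) (⊕-cancelˡ x y))

  ⊕-interchange : ∀ a b c d → (a ⊕ b) ⊕ (c ⊕ d) ≡ (a ⊕ c) ⊕ (b ⊕ d)
  ⊕-interchange a b c d = begin
    (a ⊕ b) ⊕ (c ⊕ d)  ≡⟨ ⊕-assoc a b (c ⊕ d) ⟩
    a ⊕ (b ⊕ (c ⊕ d))  ≡⟨ cong (a ⊕_) (sym (⊕-assoc b c d)) ⟩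
    a ⊕ ((b ⊕ c) ⊕ d)  ≡⟨ cong (λ z → a ⊕ (z ⊕ d)) (⊕-comm b c) ⟩
    a ⊕ ((c ⊕ b) ⊕ d)  ≡⟨ cong (a ⊕_) (⊕-assoc c b d) ⟩
    a ⊕ (c ⊕ (b ⊕ d))  ≡⟨ sym (⊕-assoc a c (b ⊕ d)) ⟩
    (a ⊕ c) ⊕ (b ⊕ d)  ∎
    where open ≡-Reasoning

  infixr 7 _·_
  _·_ : Bool → Carrier → Carrier
  b · x = if b then x else 𝟘

  ·-xor : ∀ a b x → (a xor b) · x ≡ (a · x) ⊕ (b · x)
  ·-xor false b x = sym (𝟘-⊕ (b · x))
  ·-xor true false x = sym (⊕-𝟘 x)
  ·-xor true true x = sym (⊕-self x)

  ·-⊕ : ∀ b x y → b · (x ⊕ y) ≡ (b · x) ⊕ (b · y)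
  ·-⊕ true x y = refl
  ·-⊕ false x y = sym (𝟘-⊕ 𝟘)

  ·-𝟘 : ∀ b → b · 𝟘 ≡ 𝟘
  ·-𝟘 true = refl
  ·-𝟘 false = refl

  ⨁ : ∀ {m} → (Fin m → Bool) → (Fin m → Carrier) → Carrier
  ⨁ {zero} S f = 𝟘
  ⨁ {suc m} S f = (S zero · f zero) ⊕ ⨁ (S ∘ suc) (f ∘ suc)

  ⨁-cong : ∀ {m} {S S′ : Fin m → Bool} {f g : Fin m → Carrier} → S ≗ S′ → f ≗ g → ⨁ S f ≡ ⨁ S′ g
  ⨁-cong {zero} p q = refl
  ⨁-cong {suc m} p q = cong₂ _⊕_ (cong₂ _·_ (p zero) (q zero)) (⨁-cong (p ∘ suc) (q ∘ suc))

  ⨁-△ : ∀ {m} (S S′ : Fin m → Bool) f → ⨁ (λ t → S t xor S′ t) f ≡ ⨁ S f ⊕ ⨁ S′ f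
  ⨁-△ {zero} S S′ f = sym (𝟘-⊕ 𝟘)
  ⨁-△ {suc m} S S′ f =
    trans (cong₂ _⊕_ (·-xor (S zero) (S′ zero) (f zero)) (⨁-△ (S ∘ suc) (S′ ∘ suc) (f ∘ suc)))
          (⊕-interchange _ _ _ _)

  ⨁-⊕ : ∀ {m} (S : Fin m → Bool) f g → ⨁ S (λ t → f t ⊕ g t) ≡ ⨁ S f ⊕ ⨁ S g
  ⨁-⊕ {zero} S f g = sym (𝟘-⊕ 𝟘)
  ⨁-⊕ {suc m} S f g =
    trans (cong₂ _⊕_ (·-⊕ (S zero) _ _) (⨁-⊕ (S ∘ suc) (f ∘ suc) (g ∘ suc)))
          (⊕-interchange _ _ _ _)

  ⨁-vanishes : ∀ {m} (S : Fin m → Bool) f → (∀ t → S t ≡ true → f t ≡ 𝟘) → ⨁ S f ≡ 𝟘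
  ⨁-vanishes {zero} S f p = refl
  ⨁-vanishes {suc m} S f p =
    trans (cong₂ _⊕_ (head (S zero) refl) (⨁-vanishes (S ∘ suc) (f ∘ suc) (p ∘ suc))) (𝟘-⊕ 𝟘)
    where
    head : ∀ b → S zero ≡ b → b · f zero ≡ 𝟘
    head true e = p zero e
    head false e = refl

  ⨁-∅ : ∀ {m} (S : Fin m → Bool) f → (∀ t → S t ≡ false) → ⨁ S f ≡ 𝟘
  ⨁-∅ S f p = ⨁-vanishes S f (λ t e → contradiction (trans (sym e) (p t)) λ ())

  ⨁-split : ∀ a b (S : Fin (a + b) → Bool) f →
            ⨁ S f ≡ ⨁ (S ∘ (_↑ˡ b)) (f ∘ (_↑ˡ b)) ⊕ ⨁ (S ∘ (a ↑ʳ_)) (f ∘ (a ↑ʳ_))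
  ⨁-split zero b S f = sym (𝟘-⊕ _)
  ⨁-split (suc a) b S f = trans (cong ((S zero · f zero) ⊕_) (⨁-split a b (S ∘ suc) (f ∘ suc))) (sym (⊕-assoc _ _ _))

open F₂Module public using (Carrier)

record Additive (M M′ : F₂Module) (φ : Carrier M → Carrier M′) : Set where
  private
    module M = F₂Module M
    module M′ = F₂Module M′
  field
    additive : ∀ x y → φ (x M.⊕ y) ≡ φ x M′.⊕ φ y

  additive-𝟘 : φ M.𝟘 ≡ M′.𝟘
  additive-𝟘 = trans (cong φ (sym (M.⊕-self M.𝟘))) (trans (additive M.𝟘 M.𝟘) (M′.⊕-self _))

  additive-· : ∀ b x → φ (b M.· x) ≡ b M′.· φ x
  additive-· true x = refl
  additive-· false x = additive-𝟘

  additive-⨁ : ∀ {m} (S : Fin m → Bool) f → φ (M.⨁ S f) ≡ M′.⨁ S (φ ∘ f)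
  additive-⨁ {zero} S f = additive-𝟘
  additive-⨁ {suc m} S f =
    trans (additive _ _) (cong₂ M′._⊕_ (additive-· (S zero) (f zero)) (additive-⨁ (S ∘ suc) (f ∘ suc)))

F₂ : F₂Module
F₂ = record
  { Carrier = Bool ; _⊕_ = _xor_ ; 𝟘 = false ; ⊕-assoc = xor-assoc ; ⊕-comm = xor-comm
  ; 𝟘-⊕ = λ _ → refl ; ⊕-self = xor-same }

module _ where
  private
    infixl 6 _+ᵥ_
    _+ᵥ_ : ∀ {n} → Vec Bool n → Vec Bool n → Vec Bool n
    _+ᵥ_ = zipWith _xor_

    assocᵥ : ∀ {n} (x y z : Vec Bool n) → (x +ᵥ y) +ᵥ z ≡ x +ᵥ (y +ᵥ z)
    assocᵥ [] [] [] = refl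
    assocᵥ (a ∷ x) (b ∷ y) (c ∷ z) = cong₂ _∷_ (xor-assoc a b c) (assocᵥ x y z)

    commᵥ : ∀ {n} (x y : Vec Bool n) → x +ᵥ y ≡ y +ᵥ x
    commᵥ [] [] = refl
    commᵥ (a ∷ x) (b ∷ y) = cong₂ _∷_ (xor-comm a b) (commᵥ x y)

    idᵥ : ∀ {n} (x : Vec Bool n) → replicate n false +ᵥ x ≡ x
    idᵥ [] = refl
    idᵥ (a ∷ x) = cong (a ∷_) (idᵥ x)

    selfᵥ : ∀ {n} (x : Vec Bool n) → x +ᵥ x ≡ replicate n false
    selfᵥ [] = refl
    selfᵥ (a ∷ x) = cong₂ _∷_ (xor-same a) (selfᵥ x)

  F₂^ : ℕ → F₂Module
  F₂^ n = record
    { Carrier = Vec Bool n ; _⊕_ = _+ᵥ_ ; 𝟘 = replicate n false ; ⊕-assoc = assocᵥ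
    ; ⊕-comm = commᵥ ; 𝟘-⊕ = idᵥ ; ⊕-self = selfᵥ }

infixr 5 _⊞_
_⊞_ : F₂Module → F₂Module → F₂Module
M ⊞ M′ = record
  { Carrier = Carrier M × Carrier M′
  ; _⊕_ = λ x y → (proj₁ x M.⊕ proj₁ y) , (proj₂ x M′.⊕ proj₂ y)
  ; 𝟘 = M.𝟘 , M′.𝟘
  ; ⊕-assoc = λ x y z → cong₂ _,_ (M.⊕-assoc _ _ _) (M′.⊕-assoc _ _ _)
  ; ⊕-comm = λ x y → cong₂ _,_ (M.⊕-comm _ _) (M′.⊕-comm _ _)
  ; 𝟘-⊕ = λ x → cong₂ _,_ (M.𝟘-⊕ _) (M′.𝟘-⊕ _)
  ; ⊕-self = λ x → cong₂ _,_ (M.⊕-self _) (M′.⊕-self _) }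
  where
  module M = F₂Module M
  module M′ = F₂Module M′

-- Finite subsets as Boolean functions

false≢true : false ≢ true
false≢true ()

bit : Bool → ℕ
bit b = if b then 1 else 0

⁅_⁆ : ∀ {m} → Fin m → Fin m → Bool
⁅ t ⁆ u = ⌊ u Fin.≟ t ⌋

infixl 6 _△_
_△_ : ∀ {A : Set} → (A → Bool) → (A → Bool) → A → Bool
(S △ S′) t = S t xor S′ t

⁅⁆-refl : ∀ {m} (t : Fin m) → ⁅ t ⁆ t ≡ true
⁅⁆-refl t with t Fin.≟ t
... | yes _ = refl
... | no ≢ = contradiction refl ≢

⁅⁆-≡ : ∀ {m} (t u : Fin m) → ⁅ t ⁆ u ≡ true → u ≡ t
⁅⁆-≡ t u e with u Fin.≟ t
... | yes p = p
... | no _ = contradiction e λ ()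

⁅⁆-≢ : ∀ {m} (t u : Fin m) → u ≢ t → ⁅ t ⁆ u ≡ false
⁅⁆-≢ t u u≢t with u Fin.≟ t
... | yes p = contradiction p u≢t
... | no _ = refl

⁅⁆-suc : ∀ {m} (t u : Fin m) → ⁅ suc t ⁆ (suc u) ≡ ⁅ t ⁆ u
⁅⁆-suc t u with u Fin.≟ t
... | yes _ = refl
... | no _ = refl

module _ (M : F₂Module) where
  open F₂Module M

  ⨁-⁅⁆ : ∀ {m} (t : Fin m) (f : Fin m → Carrier M) → ⨁ ⁅ t ⁆ f ≡ f t
  ⨁-⁅⁆ {suc m} zero f = trans (cong (f zero ⊕_) (⨁-∅ {m} (λ _ → false) (f ∘ suc) (λ _ → refl))) (⊕-𝟘 _)
  ⨁-⁅⁆ (suc t) f = trans (𝟘-⊕ _) (trans (⨁-cong (⁅⁆-suc t) (λ _ → refl)) (⨁-⁅⁆ t (f ∘ suc)))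

∣_∣ : ∀ {m} → (Fin m → Bool) → ℕ
∣_∣ {m} S = countFin m S

∣∣-cong : ∀ {m} {S S′ : Fin m → Bool} → S ≗ S′ → ∣ S ∣ ≡ ∣ S′ ∣
∣∣-cong {zero} e = refl
∣∣-cong {suc m} e = cong₂ _+_ (cong bit (e zero)) (∣∣-cong (e ∘ suc))

∣∣-mono : ∀ {m} {S S′ : Fin m → Bool} → (∀ t → S t ≡ true → S′ t ≡ true) → ∣ S ∣ ≤ ∣ S′ ∣
∣∣-mono {zero} p = z≤n
∣∣-mono {suc m} {S} {S′} p = +-mono-≤ (head (S zero) (S′ zero) (p zero)) (∣∣-mono (p ∘ suc))
  where
  head : ∀ a b → (a ≡ true → b ≡ true) → bit a ≤ bit b
  head false b q = z≤n
  head true b q rewrite q refl = ≤-refl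

∣∣-△ : ∀ {m} (S S′ : Fin m → Bool) → ∣ S △ S′ ∣ ≤ ∣ S ∣ + ∣ S′ ∣
∣∣-△ {zero} S S′ = z≤n
∣∣-△ {suc m} S S′ = ≤-trans (+-mono-≤ (head (S zero) (S′ zero)) (∣∣-△ (S ∘ suc) (S′ ∘ suc)))
  (≤-reflexive (+-interchange (bit (S zero)) (bit (S′ zero)) ∣ S ∘ suc ∣ ∣ S′ ∘ suc ∣))
  where
  head : ∀ a b → bit (a xor b) ≤ bit a + bit b
  head false b = ≤-refl
  head true false = ≤-refl
  head true true = z≤n

∣∣-∅ : ∀ {m} (S : Fin m → Bool) → (∀ t → S t ≡ false) → ∣ S ∣ ≡ 0
∣∣-∅ {zero} S e = refl
∣∣-∅ {suc m} S e rewrite e zero = ∣∣-∅ (S ∘ suc) (e ∘ suc)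

∣∣≡0 : ∀ {m} (S : Fin m → Bool) → ∣ S ∣ ≡ 0 → ∀ t → S t ≡ false
∣∣≡0 S e zero with S zero
... | false = refl
∣∣≡0 S e (suc t) = ∣∣≡0 (S ∘ suc) (m+n≡0⇒n≡0 (bit (S zero)) e) t

∣⁅⁆∣ : ∀ {m} (t : Fin m) → ∣ ⁅ t ⁆ ∣ ≡ 1
∣⁅⁆∣ {suc m} zero = cong suc (∣∣-∅ {m} (λ _ → false) (λ _ → refl))
∣⁅⁆∣ (suc t) = trans (∣∣-cong (⁅⁆-suc t)) (∣⁅⁆∣ t)

∣∣-≤-length : ∀ {m} (S : Fin m → Bool) (xs : List (Fin m)) →
              (∀ t → S t ≡ true → t ∈ xs) → ∣ S ∣ ≤ length xs
∣∣-≤-length S [] p = ≤-reflexive (∣∣-∅ S empty)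
  where
  empty : ∀ t → S t ≡ false
  empty t with S t in e
  ... | false = refl
  ... | true with () ← p t e
∣∣-≤-length S (x ∷ xs) p = ≤-trans (≤-trans (∣∣-mono cover) (∣∣-△ ⁅ x ⁆ S∖x))
  (+-mono-≤ (≤-reflexive (∣⁅⁆∣ x)) (∣∣-≤-length S∖x xs p′))
  where
  S∖x : _ → Bool
  S∖x t = S t ∧ not (⁅ x ⁆ t)
  cover : ∀ t → S t ≡ true → (⁅ x ⁆ △ S∖x) t ≡ true
  cover t e rewrite e with ⁅ x ⁆ t
  ... | true = refl
  ... | false = refl
  p′ : ∀ t → S∖x t ≡ true → t ∈ xs
  p′ t e with S t in st | t Fin.≟ x
  ... | true | no t≢x with p t st
  ...   | here t≡x = contradiction t≡x t≢x
  ...   | there q = q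

elements : ∀ {m} (S : Fin m → Bool) → Σ (List (Fin m)) λ xs → length xs ≡ ∣ S ∣ × (∀ t → S t ≡ true → t ∈ xs)
elements {zero} S = [] , refl , λ ()
elements {suc m} S with S zero in s0 | elements (S ∘ suc)
... | b | xs , len , mem = go b s0
  where
  go : ∀ b → S zero ≡ b → Σ (List (Fin (suc m))) λ ys → length ys ≡ bit b + ∣ S ∘ suc ∣ × (∀ t → S t ≡ true → t ∈ ys)
  go true e = zero ∷ map suc xs , cong suc (trans (length-map suc xs) len) ,
    λ { zero _ → here refl ; (suc t) st → there (∈-map⁺ suc (mem t st)) }
  go false e = map suc xs , trans (length-map suc xs) len ,
    λ { zero st → contradiction (trans (sym e) st) λ () ; (suc t) st → ∈-map⁺ suc (mem t st) }

-- Exhaustive search makes Duplicator's choices constructive. Subsets are functions without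
-- extensionality, so the property has to respect pointwise equality.
anySubset? : ∀ {m} {P : (Fin m → Bool) → Set} → (∀ {S S′} → S ≗ S′ → P S → P S′) →
             (∀ S → Dec (P S)) → Dec (∃ P)
anySubset? {zero} resp P? = map′ (_ ,_) (λ (S , p) → resp (λ ()) p) (P? (λ ()))
anySubset? {suc m} {P} resp P? =
  map′ join split (anySubset? (resp-cons true) (P? ∘ cons true) ⊎-dec anySubset? (resp-cons false) (P? ∘ cons false))
  where
  cons : Bool → (Fin m → Bool) → Fin (suc m) → Bool
  cons b S zero = b
  cons b S (suc t) = S t
  resp-cons : ∀ b {S S′} → S ≗ S′ → P (cons b S) → P (cons b S′)
  resp-cons b e = resp λ { zero → refl ; (suc t) → e t }
  join : (∃ λ S → P (cons true S)) ⊎ (∃ λ S → P (cons false S)) → ∃ P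
  join (inj₁ (S , p)) = cons true S , p
  join (inj₂ (S , p)) = cons false S , p
  split : ∃ P → (∃ λ S → P (cons true S)) ⊎ (∃ λ S → P (cons false S))
  split (S , p) with S zero in e
  ... | true = inj₁ (S ∘ suc , resp (λ { zero → e ; (suc t) → refl }) p)
  ... | false = inj₂ (S ∘ suc , resp (λ { zero → e ; (suc t) → refl }) p)

-- Sums over lists and the union bound

∑ : ∀ {A : Set} → List A → (A → ℕ) → ℕ
∑ [] f = 0
∑ (x ∷ xs) f = f x + ∑ xs f

∑-mono-∈ : ∀ {A : Set} (xs : List A) {f g : A → ℕ} → (∀ {x} → x ∈ xs → f x ≤ g x) → ∑ xs f ≤ ∑ xs g
∑-mono-∈ [] p = z≤n
∑-mono-∈ (x ∷ xs) p = +-mono-≤ (p (here refl)) (∑-mono-∈ xs (p ∘ there))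

∑-mono : ∀ {A : Set} (xs : List A) {f g : A → ℕ} → (∀ x → f x ≤ g x) → ∑ xs f ≤ ∑ xs g
∑-mono xs p = ∑-mono-∈ xs (λ {x} _ → p x)

∑-cong : ∀ {A : Set} (xs : List A) {f g : A → ℕ} → f ≗ g → ∑ xs f ≡ ∑ xs g
∑-cong [] p = refl
∑-cong (x ∷ xs) p = cong₂ _+_ (p x) (∑-cong xs p)

∑-const : ∀ {A : Set} (xs : List A) c → ∑ xs (λ _ → c) ≡ length xs * c
∑-const [] c = refl
∑-const (x ∷ xs) c = cong (c +_) (∑-const xs c)

∑-+ : ∀ {A : Set} (xs : List A) (f g : A → ℕ) → ∑ xs (λ x → f x + g x) ≡ ∑ xs f + ∑ xs g
∑-+ [] f g = refl
∑-+ (x ∷ xs) f g rewrite ∑-+ xs f g = +-interchange (f x) (g x) (∑ xs f) (∑ xs g)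

∑-* : ∀ {A : Set} (xs : List A) c (f : A → ℕ) → ∑ xs (λ x → c * f x) ≡ c * ∑ xs f
∑-* [] c f = sym (*-zeroʳ c)
∑-* (x ∷ xs) c f rewrite ∑-* xs c f = sym (*-distribˡ-+ c (f x) _)

∑-swap : ∀ {A B : Set} (xs : List A) (ys : List B) (f : A → B → ℕ) →
         ∑ xs (λ x → ∑ ys (f x)) ≡ ∑ ys (λ y → ∑ xs (λ x → f x y))
∑-swap [] ys f = sym (trans (∑-const ys 0) (*-zeroʳ (length ys)))
∑-swap (x ∷ xs) ys f rewrite ∑-swap xs ys f = sym (∑-+ ys (f x) _)

∑-++ : ∀ {A : Set} (xs ys : List A) (f : A → ℕ) → ∑ (xs ++ ys) f ≡ ∑ xs f + ∑ ys f
∑-++ [] ys f = refl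
∑-++ (x ∷ xs) ys f rewrite ∑-++ xs ys f = sym (+-assoc (f x) _ _)

∑-map : ∀ {A B : Set} (g : A → B) (xs : List A) (f : B → ℕ) → ∑ (map g xs) f ≡ ∑ xs (f ∘ g)
∑-map g [] f = refl
∑-map g (x ∷ xs) f = cong (f (g x) +_) (∑-map g xs f)

∑-product : ∀ {A B C : Set} (g : A → B → C) (xs : List A) (ys : List B) (f : C → ℕ) →
            ∑ (cartesianProductWith g xs ys) f ≡ ∑ xs (λ x → ∑ ys (λ y → f (g x y)))
∑-product g [] ys f = refl
∑-product g (x ∷ xs) ys f = trans (∑-++ (map (g x) ys) _ f) (cong₂ _+_ (∑-map (g x) ys f) (∑-product g xs ys f))

length≡∑ : ∀ {A : Set} (xs : List A) → length xs ≡ ∑ xs (λ _ → 1)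
length≡∑ xs = sym (trans (∑-const xs 1) (*-identityʳ _))

length-product : ∀ {A B C : Set} (g : A → B → C) (xs : List A) (ys : List B) →
                 length (cartesianProductWith g xs ys) ≡ length xs * length ys
length-product g xs ys = begin
  length (cartesianProductWith g xs ys)        ≡⟨ length≡∑ (cartesianProductWith g xs ys) ⟩
  ∑ (cartesianProductWith g xs ys) (λ _ → 1)   ≡⟨ ∑-product g xs ys (λ _ → 1) ⟩
  ∑ xs (λ _ → ∑ ys (λ _ → 1))                  ≡⟨ ∑-cong xs (λ _ → sym (length≡∑ ys)) ⟩
  ∑ xs (λ _ → length ys)                       ≡⟨ ∑-const xs (length ys) ⟩
  length xs * length ys                        ∎
  where open ≡-Reasoning

∑≡0 : ∀ {A : Set} (xs : List A) (f : A → ℕ) → ∑ xs f ≡ 0 → ∀ {x} → x ∈ xs → f x ≡ 0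
∑≡0 (x ∷ xs) f e (here refl) = m+n≡0⇒m≡0 (f x) e
∑≡0 (x ∷ xs) f e (there p) = ∑≡0 xs f (m+n≡0⇒n≡0 (f x) e) p

∑<length : ∀ {A : Set} (xs : List A) (f : A → ℕ) → ∑ xs f < length xs → ∃ λ x → f x ≡ 0
∑<length (x ∷ xs) f p with f x in e
... | zero = x , e
... | suc a = ∑<length xs f (≤-trans (s≤s (m≤n+m _ a)) (≤-pred p))

vecs : ∀ {A : Set} → List A → (n : ℕ) → List (Vec A n)
vecs xs zero = [] ∷ []
vecs xs (suc n) = cartesianProductWith _∷_ xs (vecs xs n)

∑-vecs : ∀ {A : Set} (xs : List A) n (f : Vec A (suc n) → ℕ) →
         ∑ (vecs xs (suc n)) f ≡ ∑ xs (λ x → ∑ (vecs xs n) (λ v → f (x ∷ v)))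
∑-vecs xs n f = ∑-product _∷_ xs (vecs xs n) f

length-vecs : ∀ {A : Set} (xs : List A) n → length (vecs xs n) ≡ length xs ^ n
length-vecs xs zero = refl
length-vecs xs (suc n) = trans (length-product _∷_ xs (vecs xs n)) (cong (length xs *_) (length-vecs xs n))

bit≡0 : ∀ b → bit b ≡ 0 → b ≡ false
bit≡0 false e = refl

module _ {A E U : Set} (Ω : List A) (es : List E) (us : E → List U) (bad : E → U → A → Bool)
         (c K L : E → ℕ) (w : ℕ) where

  private
    f : E → A → ℕ
    f e ω = ∑ (us e) (λ u → bit (bad e u ω))

  -- Probabilities are counts over the list `Ω`: each event of class e has probability at most L e /
  -- K e. The at most c e events of a class then have total probability at most 1 / w, and there are
  -- fewer than w classes, so the expected number of bad events is below 1.
  union-bound :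
    (∀ {e} → e ∈ es → length (us e) ≤ c e) →
    (∀ {e u} → e ∈ es → u ∈ us e → K e * ∑ Ω (bit ∘ bad e u) ≤ L e * length Ω) →
    (∀ {e} → e ∈ es → w * (c e * L e) ≤ K e) →
    (∀ {e} → e ∈ es → 1 ≤ K e) →
    length es < w → 1 ≤ length Ω →
    ∃ λ ω → ∀ {e u} → e ∈ es → u ∈ us e → bad e u ω ≡ false
  union-bound few rare small K≥1 es<w Ω≥1 = ω , good
    where
    open ≤-Reasoning
    per : ∀ {e} → e ∈ es → w * ∑ Ω (f e) ≤ length Ω
    per {e} e∈ = *-cancelˡ-≤ (K e) {{>-nonZero (K≥1 e∈)}} (begin
      K e * (w * ∑ Ω (f e))                              ≡⟨ *-assoc-swap (K e) w _ ⟩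
      w * (K e * ∑ Ω (f e))                              ≡⟨ cong (λ z → w * (K e * z)) (∑-swap Ω (us e) _) ⟩
      w * (K e * ∑ (us e) (λ u → ∑ Ω (bit ∘ bad e u)))   ≡⟨ cong (w *_) (sym (∑-* (us e) (K e) _)) ⟩
      w * ∑ (us e) (λ u → K e * ∑ Ω (bit ∘ bad e u))     ≤⟨ *-monoʳ-≤ w (∑-mono-∈ (us e) (rare e∈)) ⟩
      w * ∑ (us e) (λ u → L e * length Ω)                ≡⟨ cong (w *_) (∑-const (us e) _) ⟩
      w * (length (us e) * (L e * length Ω))             ≤⟨ *-monoʳ-≤ w (*-monoˡ-≤ _ (few e∈)) ⟩
      w * (c e * (L e * length Ω))                       ≡⟨ cong (w *_) (sym (*-assoc (c e) _ _)) ⟩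
      w * (c e * L e * length Ω)                         ≡⟨ sym (*-assoc w _ _) ⟩
      w * (c e * L e) * length Ω                         ≤⟨ *-monoˡ-≤ _ (small e∈) ⟩
      K e * length Ω                                     ∎)
      where
      *-assoc-swap : ∀ a b c → a * (b * c) ≡ b * (a * c)
      *-assoc-swap a b c = trans (sym (*-assoc a b c)) (trans (cong (_* c) (*-comm a b)) (*-assoc b a c))
    total : w * ∑ Ω (λ ω → ∑ es (λ e → f e ω)) < w * length Ω
    total = begin-strict
      w * ∑ Ω (λ ω → ∑ es (λ e → f e ω))   ≡⟨ cong (w *_) (∑-swap Ω es _) ⟩
      w * ∑ es (λ e → ∑ Ω (f e))           ≡⟨ sym (∑-* es w _) ⟩
      ∑ es (λ e → w * ∑ Ω (f e))           ≤⟨ ∑-mono-∈ es per ⟩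
      ∑ es (λ _ → length Ω)                ≡⟨ ∑-const es _ ⟩
      length es * length Ω                 <⟨ *-monoˡ-< (length Ω) {{>-nonZero Ω≥1}} es<w ⟩
      w * length Ω                         ∎
    found : ∃ λ ω → ∑ es (λ e → f e ω) ≡ 0
    found = ∑<length Ω _ (*-cancelˡ-< w _ _ total)
    ω = proj₁ found
    good : ∀ {e u} → e ∈ es → u ∈ us e → bad e u ω ≡ false
    good {e} e∈ u∈ = bit≡0 _ (∑≡0 (us e) _ (∑≡0 es (λ e → f e ω) (proj₂ found) e∈) u∈)

-- Enumeration of the subsets of a given size

private
  cons : ∀ {m} → Bool → (Fin m → Bool) → Fin (suc m) → Bool
  cons b S zero = b
  cons b S (suc t) = S t

subsets : (m s : ℕ) → List (Fin m → Bool)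
subsets zero zero = (λ ()) ∷ []
subsets zero (suc s) = []
subsets (suc m) zero = map (cons false) (subsets m zero)
subsets (suc m) (suc s) = map (cons true) (subsets m s) ++ map (cons false) (subsets m (suc s))

-- The crude bound m^s stands in for the binomial coefficient; both union bounds have room for it.
length-subsets : ∀ m s → length (subsets m s) ≤ m ^ s
length-subsets zero zero = ≤-refl
length-subsets zero (suc s) = z≤n
length-subsets (suc m) zero = ≤-trans (≤-reflexive (length-map (cons false) (subsets m zero))) (length-subsets m zero)
length-subsets (suc m) (suc s) = begin
  length (map (cons true) (subsets m s) ++ map (cons false) (subsets m (suc s)))
    ≡⟨ length-++ (map (cons true) (subsets m s)) ⟩
  length (map (cons true) (subsets m s)) + length (map (cons false) (subsets m (suc s)))
    ≡⟨ cong₂ _+_ (length-map (cons true) (subsets m s)) (length-map (cons false) (subsets m (suc s))) ⟩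
  length (subsets m s) + length (subsets m (suc s))
    ≤⟨ +-mono-≤ (length-subsets m s) (length-subsets m (suc s)) ⟩
  suc m * m ^ s
    ≤⟨ *-monoʳ-≤ (suc m) (^-monoˡ-≤ s (n≤1+n m)) ⟩
  suc m ^ suc s ∎
  where open ≤-Reasoning

subsets-size : ∀ m s {S} → S ∈ subsets m s → ∣ S ∣ ≡ s
subsets-size zero zero p = refl
subsets-size (suc m) zero p with ∈-map⁻ (cons false) p
... | S , q , refl = subsets-size m zero q
subsets-size (suc m) (suc s) p with ∈-++⁻ (map (cons true) (subsets m s)) p
... | inj₁ q with ∈-map⁻ (cons true) q
...   | S , r , refl = cong suc (subsets-size m s r)
subsets-size (suc m) (suc s) p | inj₂ q with ∈-map⁻ (cons false) q
...   | S , r , refl = subsets-size m (suc s) r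

subsets-complete : ∀ {m} (S : Fin m → Bool) → Σ (Fin m → Bool) λ S′ → S′ ∈ subsets m ∣ S ∣ × S′ ≗ S
subsets-complete {zero} S = (λ ()) , here refl , λ ()
subsets-complete {suc m} S with subsets-complete (S ∘ suc) | S zero in e
... | S′ , p , q | true = cons true S′ , ∈-++⁺ˡ (∈-map⁺ (cons true) p) , λ { zero → sym e ; (suc t) → q t }
... | S′ , p , q | false = cons false S′ , mem ∣ S ∘ suc ∣ p , λ { zero → sym e ; (suc t) → q t }
  where
  mem : ∀ s → S′ ∈ subsets m s → cons false S′ ∈ subsets (suc m) s
  mem zero p = ∈-map⁺ (cons false) p
  mem (suc s) p = ∈-++⁺ʳ (map (cons true) (subsets m s)) (∈-map⁺ (cons false) p)

-- Sparse random linear forms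

module F₂ = F₂Module F₂

nodeSum : ∀ {Δ N m} → (Fin m → Fin Δ → Fin N) → (Fin N → Bool) → Fin m → Bool
nodeSum h p t = F₂.⨁ (λ _ → true) (λ i → p (h t i))

val : ∀ {Δ N m} → (Fin m → Fin Δ → Fin N) → (Fin N → Bool) → (Fin m → Bool) → Bool
val h p S = F₂.⨁ S (nodeSum h p)

-- par h S v says that v occurs an odd number of times in the nodes of S.
par : ∀ {Δ N m} → (Fin m → Fin Δ → Fin N) → (Fin m → Bool) → Fin N → Bool
par h S v = val h ⁅ v ⁆ S

⁅⁆-sym : ∀ {m} (t u : Fin m) → ⁅ t ⁆ u ≡ ⁅ u ⁆ t
⁅⁆-sym t u with u Fin.≟ t | t Fin.≟ u
... | yes _ | yes _ = refl
... | no _ | no _ = refl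
... | yes p | no q = contradiction (sym p) q
... | no p | yes q = contradiction (sym q) p

toggle : ∀ {N} → Fin N → (Fin N → Bool) → Fin N → Bool
toggle v χ u = χ u xor ⁅ v ⁆ u

∣toggle∣ : ∀ {N} (v : Fin N) (χ : Fin N → Bool) → ∣ toggle v χ ∣ + 2 * bit (χ v) ≡ suc ∣ χ ∣
∣toggle∣ {suc N} zero χ = trans (cong (λ z → bit (χ zero xor true) + z + 2 * bit (χ zero))
    (∣∣-cong {S = λ u → χ (suc u) xor false} (λ u → xor-identityʳ (χ (suc u)))))
  (go (χ zero) ∣ χ ∘ suc ∣)
  where
  go : ∀ b c → bit (b xor true) + c + 2 * bit b ≡ suc (bit b + c)
  go true c = +-comm c 2
  go false c = cong suc (+-identityʳ c)
∣toggle∣ {suc N} (suc v) χ = begin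
  bit (χ zero xor false) + ∣ toggle (suc v) χ ∘ suc ∣ + 2 * bit (χ (suc v))
    ≡⟨ cong₂ (λ y z → bit y + z + 2 * bit (χ (suc v))) (xor-identityʳ (χ zero))
         (∣∣-cong (λ u → cong (χ (suc u) xor_) (⁅⁆-suc v u))) ⟩
  bit (χ zero) + ∣ toggle v (χ ∘ suc) ∣ + 2 * bit (χ (suc v))
    ≡⟨ +-assoc (bit (χ zero)) _ _ ⟩
  bit (χ zero) + (∣ toggle v (χ ∘ suc) ∣ + 2 * bit (χ (suc v)))
    ≡⟨ cong (bit (χ zero) +_) (∣toggle∣ v (χ ∘ suc)) ⟩
  bit (χ zero) + suc ∣ χ ∘ suc ∣
    ≡⟨ +-suc (bit (χ zero)) _ ⟩
  suc (bit (χ zero) + ∣ χ ∘ suc ∣) ∎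
  where open ≡-Reasoning

∣toggle∣≤ : ∀ {N} (v : Fin N) (χ : Fin N → Bool) → ∣ toggle v χ ∣ ≤ suc ∣ χ ∣
∣toggle∣≤ v χ = ≤-trans (m≤m+n _ _) (≤-reflexive (∣toggle∣ v χ))

-- Scanning the variables of the chosen nodes one by one, `hits` counts how often the
-- scanned variable cancels against the current odd set.
hitsRow : ∀ {N l} → Vec (Fin N) l → (Fin N → Bool) → ℕ
hitsRow [] χ = 0
hitsRow (v ∷ g) χ = bit (χ v) + hitsRow g (toggle v χ)

oddRow : ∀ {N l} → Vec (Fin N) l → (Fin N → Bool) → Fin N → Bool
oddRow [] χ = χ
oddRow (v ∷ g) χ = oddRow g (toggle v χ)

hits : ∀ {N l m} → (Fin m → Bool) → Vec (Vec (Fin N) l) m → (Fin N → Bool) → ℕ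
hits S [] χ = 0
hits S (g ∷ ω) χ = if S zero then hitsRow g χ + hits (S ∘ suc) ω (oddRow g χ) else hits (S ∘ suc) ω χ

odd : ∀ {N l m} → (Fin m → Bool) → Vec (Vec (Fin N) l) m → (Fin N → Bool) → Fin N → Bool
odd S [] χ = χ
odd S (g ∷ ω) χ = if S zero then odd (S ∘ suc) ω (oddRow g χ) else odd (S ∘ suc) ω χ

-- A scanned variable enlarges the odd set by one on a miss and shrinks it by one on a hit, so each
-- hit leaves a deficit of two.
∣oddRow∣ : ∀ {N l} (g : Vec (Fin N) l) χ → ∣ oddRow g χ ∣ + 2 * hitsRow g χ ≡ ∣ χ ∣ + l
∣oddRow∣ [] χ = refl
∣oddRow∣ {l = suc l} (v ∷ g) χ = begin
  o + 2 * (bit (χ v) + r)          ≡⟨ solve 3 (λ o b r → o :+ con 2 :* (b :+ r) := (o :+ con 2 :* r) :+ con 2 :* b) refl o (bit (χ v)) r ⟩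
  (o + 2 * r) + 2 * bit (χ v)      ≡⟨ cong (_+ 2 * bit (χ v)) (∣oddRow∣ g (toggle v χ)) ⟩
  (∣ toggle v χ ∣ + l) + 2 * bit (χ v)   ≡⟨ solve 3 (λ a l b → (a :+ l) :+ b := (a :+ b) :+ l) refl ∣ toggle v χ ∣ l (2 * bit (χ v)) ⟩
  (∣ toggle v χ ∣ + 2 * bit (χ v)) + l   ≡⟨ cong (_+ l) (∣toggle∣ v χ) ⟩
  suc ∣ χ ∣ + l                    ≡⟨ sym (+-suc ∣ χ ∣ l) ⟩
  ∣ χ ∣ + suc l                    ∎
  where
  open ≡-Reasoning
  o = ∣ oddRow g (toggle v χ) ∣
  r = hitsRow g (toggle v χ)

∣odd∣ : ∀ {N l m} (S : Fin m → Bool) (ω : Vec (Vec (Fin N) l) m) χ →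
        ∣ odd S ω χ ∣ + 2 * hits S ω χ ≡ ∣ χ ∣ + ∣ S ∣ * l
∣odd∣ S [] χ = refl
∣odd∣ {l = l} S (g ∷ ω) χ with S zero
... | false = ∣odd∣ (S ∘ suc) ω χ
... | true = begin
  o + 2 * (a + r)                     ≡⟨ solve 3 (λ o a r → o :+ con 2 :* (a :+ r) := (o :+ con 2 :* r) :+ con 2 :* a) refl o a r ⟩
  (o + 2 * r) + 2 * a                 ≡⟨ cong (_+ 2 * a) (∣odd∣ (S ∘ suc) ω (oddRow g χ)) ⟩
  (∣ oddRow g χ ∣ + s * l) + 2 * a    ≡⟨ solve 3 (λ x y z → (x :+ y) :+ z := (x :+ z) :+ y) refl ∣ oddRow g χ ∣ (s * l) (2 * a) ⟩
  (∣ oddRow g χ ∣ + 2 * a) + s * l    ≡⟨ cong (_+ s * l) (∣oddRow∣ g χ) ⟩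
  (∣ χ ∣ + l) + s * l                 ≡⟨ +-assoc ∣ χ ∣ l _ ⟩
  ∣ χ ∣ + suc s * l                   ∎
  where
  open ≡-Reasoning
  o = ∣ odd (S ∘ suc) ω (oddRow g χ) ∣
  r = hits (S ∘ suc) ω (oddRow g χ)
  a = hitsRow g χ
  s = ∣ S ∘ suc ∣

oddRow-par : ∀ {N l} (g : Vec (Fin N) l) χ u →
             oddRow g χ u ≡ χ u xor F₂.⨁ (λ _ → true) (λ i → ⁅ u ⁆ (lookup g i))
oddRow-par [] χ u = sym (xor-identityʳ (χ u))
oddRow-par (v ∷ g) χ u = trans (oddRow-par g (toggle v χ) u)
  (trans (xor-assoc (χ u) _ _) (cong (λ z → χ u xor (z xor _)) (⁅⁆-sym v u)))

odd-par : ∀ {N l m} (S : Fin m → Bool) (ω : Vec (Vec (Fin N) l) m) χ u →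
          odd S ω χ u ≡ χ u xor par (λ t → lookup (lookup ω t)) S u
odd-par S [] χ u = sym (xor-identityʳ (χ u))
odd-par S (g ∷ ω) χ u with S zero
... | false = odd-par (S ∘ suc) ω χ u
... | true = trans (odd-par (S ∘ suc) ω (oddRow g χ) u)
  (trans (cong (_xor _) (oddRow-par g χ u)) (xor-assoc (χ u) _ _))

∑-tabulate : ∀ {N M} (f : Fin N → Fin M) (χ : Fin M → Bool) → ∑ (tabulate f) (bit ∘ χ) ≡ ∣ χ ∘ f ∣
∑-tabulate {zero} f χ = refl
∑-tabulate {suc N} f χ = cong (bit (χ (f zero)) +_) (∑-tabulate (f ∘ suc) χ)

length-allFin : ∀ N → length (allFin N) ≡ N
length-allFin N = length-tabulate (λ (i : Fin N) → i)

module _ (N B : ℕ) where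

  -- A hit has probability at most 1 / B, so the mean of B^hit is at most 1 + B / B = 2.
  ∑-hit : (χ : Fin N → Bool) → ∣ χ ∣ * B ≤ N → ∑ (allFin N) (λ v → B ^ bit (χ v)) ≤ 2 * N
  ∑-hit χ small = begin
    ∑ (allFin N) (λ v → B ^ bit (χ v))                       ≤⟨ ∑-mono (allFin N) (λ v → one (χ v)) ⟩
    ∑ (allFin N) (λ v → 1 + B * bit (χ v))                   ≡⟨ ∑-+ (allFin N) (λ _ → 1) (λ v → B * bit (χ v)) ⟩
    ∑ (allFin N) (λ _ → 1) + ∑ (allFin N) (λ v → B * bit (χ v))
      ≡⟨ cong₂ _+_ (trans (sym (length≡∑ (allFin N))) (length-allFin N))
           (trans (∑-* (allFin N) B (bit ∘ χ)) (cong (B *_) (∑-tabulate (λ i → i) χ))) ⟩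
    N + B * ∣ χ ∣                                            ≤⟨ +-monoʳ-≤ N (≤-trans (≤-reflexive (*-comm B _)) small) ⟩
    N + N                                                    ≡⟨ cong (N +_) (sym (+-identityʳ N)) ⟩
    2 * N                                                    ∎
    where
    open ≤-Reasoning
    one : ∀ b → B ^ bit b ≤ 1 + B * bit b
    one true = ≤-trans (≤-reflexive (trans (*-identityʳ B) (sym (*-identityʳ B)))) (n≤1+n _)
    one false = s≤s z≤n

  -- `F` stands for the contribution of all later rows. It depends on the odd set reached, hence the
  -- bound uniform over all sets reachable in l steps. Whatever happened before, each scanned
  -- variable contributes a factor of at most 2 by `∑-hit`.
  ∑-hitsRow : ∀ l (χ : Fin N → Bool) (F : (Fin N → Bool) → ℕ) c →
    (∀ χ′ → ∣ χ′ ∣ ≤ ∣ χ ∣ + l → F χ′ ≤ c) → (∣ χ ∣ + l) * B ≤ N →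
    ∑ (vecs (allFin N) l) (λ g → B ^ hitsRow g χ * F (oddRow g χ)) ≤ (2 * N) ^ l * c
  ∑-hitsRow zero χ F c bound small = ≤-trans (≤-reflexive (+-identityʳ _))
    (+-monoˡ-≤ 0 (bound χ (≤-reflexive (sym (+-identityʳ _)))))
  ∑-hitsRow (suc l) χ F c bound small = begin
    ∑ (vecs (allFin N) (suc l)) (λ g → B ^ hitsRow g χ * F (oddRow g χ))
      ≡⟨ ∑-vecs (allFin N) l (λ g → B ^ hitsRow g χ * F (oddRow g χ)) ⟩
    ∑ (allFin N) (λ v → ∑ (vecs (allFin N) l) (λ g → B ^ (bit (χ v) + hitsRow g (toggle v χ)) * F (oddRow g (toggle v χ))))
      ≡⟨ ∑-cong (allFin N) (λ v → ∑-cong (vecs (allFin N) l) (λ g → factor v g)) ⟩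
    ∑ (allFin N) (λ v → ∑ (vecs (allFin N) l) (λ g → B ^ bit (χ v) * (B ^ hitsRow g (toggle v χ) * F (oddRow g (toggle v χ)))))
      ≡⟨ ∑-cong (allFin N) (λ v → ∑-* (vecs (allFin N) l) (B ^ bit (χ v)) _) ⟩
    ∑ (allFin N) (λ v → B ^ bit (χ v) * ∑ (vecs (allFin N) l) (λ g → B ^ hitsRow g (toggle v χ) * F (oddRow g (toggle v χ))))
      ≤⟨ ∑-mono (allFin N) (λ v → *-monoʳ-≤ (B ^ bit (χ v)) (∑-hitsRow l (toggle v χ) F c (bound′ v) (small′ v))) ⟩
    ∑ (allFin N) (λ v → B ^ bit (χ v) * Z)
      ≡⟨ trans (∑-cong (allFin N) (λ v → *-comm (B ^ bit (χ v)) Z)) (∑-* (allFin N) Z _) ⟩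
    Z * ∑ (allFin N) (λ v → B ^ bit (χ v))
      ≤⟨ *-monoʳ-≤ Z (∑-hit χ (≤-trans (*-monoˡ-≤ B (m≤m+n ∣ χ ∣ (suc l))) small)) ⟩
    Z * (2 * N)
      ≡⟨ trans (*-comm Z (2 * N)) (sym (*-assoc (2 * N) _ c)) ⟩
    (2 * N) ^ suc l * c ∎
    where
    open ≤-Reasoning
    Z = (2 * N) ^ l * c
    factor : ∀ v (g : Vec (Fin N) l) → B ^ (bit (χ v) + hitsRow g (toggle v χ)) * F (oddRow g (toggle v χ)) ≡ B ^ bit (χ v) * (B ^ hitsRow g (toggle v χ) * F (oddRow g (toggle v χ)))
    factor v g = trans (cong (_* F (oddRow g (toggle v χ))) (^-distribˡ-+-* B (bit (χ v)) _)) (*-assoc (B ^ bit (χ v)) _ _)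
    grow : ∀ v → ∣ toggle v χ ∣ + l ≤ ∣ χ ∣ + suc l
    grow v = ≤-trans (+-monoˡ-≤ l (∣toggle∣≤ v χ)) (≤-reflexive (sym (+-suc ∣ χ ∣ l)))
    bound′ : ∀ v χ′ → ∣ χ′ ∣ ≤ ∣ toggle v χ ∣ + l → F χ′ ≤ c
    bound′ v χ′ q = bound χ′ (≤-trans q (grow v))
    small′ : ∀ v → (∣ toggle v χ ∣ + l) * B ≤ N
    small′ v = ≤-trans (*-monoˡ-≤ B (grow v)) small

  module _ (l : ℕ) where

    rows : List (Vec (Fin N) l)
    rows = vecs (allFin N) l

    length-rows : length rows ≡ N ^ l
    length-rows = trans (length-vecs (allFin N) l) (cong (_^ l) (length-allFin N))

    -- An exponential moment: the mean of B^hits is at most 2 for every variable of a chosen row,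
    -- and rows outside `S` are not scanned.
    ∑-hits : ∀ {m} (S : Fin m → Bool) (χ : Fin N → Bool) → (∣ χ ∣ + ∣ S ∣ * l) * B ≤ N →
             ∑ (vecs rows m) (λ ω → B ^ hits S ω χ) ≤ 2 ^ (l * ∣ S ∣) * length rows ^ m
    ∑-hits-step : ∀ {m} (S : Fin (suc m) → Bool) (χ : Fin N → Bool) → (∣ χ ∣ + ∣ S ∣ * l) * B ≤ N →
                  ∑ rows (λ g → ∑ (vecs rows m) (λ ω → B ^ hits S (g ∷ ω) χ)) ≤ 2 ^ (l * ∣ S ∣) * length rows ^ suc m

    ∑-hits {zero} S χ small = ≤-trans (≤-reflexive (sym (cong (2 ^_) (*-zeroʳ l)))) (≤-reflexive (sym (*-identityʳ _)))
    ∑-hits {suc m} S χ small = ≤-trans (≤-reflexive (∑-vecs rows m (λ ω → B ^ hits S ω χ))) (∑-hits-step S χ small)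

    ∑-hits-step {m} S χ small with S zero
    ... | false = begin
      ∑ rows (λ _ → ∑ (vecs rows m) (λ ω → B ^ hits (S ∘ suc) ω χ))      ≡⟨ ∑-const rows _ ⟩
      R * ∑ (vecs rows m) (λ ω → B ^ hits (S ∘ suc) ω χ)      ≤⟨ *-monoʳ-≤ R (∑-hits (S ∘ suc) χ small) ⟩
      R * (2 ^ (l * ∣ S ∘ suc ∣) * R ^ m)      ≡⟨ solve 3 (λ a b c → a :* (b :* c) := b :* (a :* c)) refl R (2 ^ (l * ∣ S ∘ suc ∣)) (R ^ m) ⟩
      2 ^ (l * ∣ S ∘ suc ∣) * R ^ suc m ∎
      where
      open ≤-Reasoning
      R = length rows
    ... | true = begin
      ∑ rows (λ g → ∑ (vecs rows m) (λ ω → B ^ (hitsRow g χ + hits (S ∘ suc) ω (oddRow g χ))))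
        ≡⟨ ∑-cong rows (λ g → trans (∑-cong (vecs rows m) (λ ω → ^-distribˡ-+-* B (hitsRow g χ) _)) (∑-* (vecs rows m) (B ^ hitsRow g χ) _)) ⟩
      ∑ rows (λ g → B ^ hitsRow g χ * F (oddRow g χ))
        ≤⟨ ∑-hitsRow l χ F c bound (≤-trans (*-monoˡ-≤ B (+-monoʳ-≤ ∣ χ ∣ (m≤m+n l _))) small) ⟩
      (2 * N) ^ l * c                             ≡⟨ cong (_* c) (^-distribʳ-* l 2 N) ⟩
      2 ^ l * N ^ l * c                           ≡⟨ cong (λ z → 2 ^ l * z * c) (sym length-rows) ⟩
      2 ^ l * R * (2 ^ (l * s) * R ^ m)           ≡⟨ solve 4 (λ a b c d → a :* b :* (c :* d) := (a :* c) :* (b :* d)) refl (2 ^ l) R (2 ^ (l * s)) (R ^ m) ⟩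
      (2 ^ l * 2 ^ (l * s)) * R ^ suc m           ≡⟨ cong (_* R ^ suc m) (trans (sym (^-distribˡ-+-* 2 l (l * s))) (cong (2 ^_) (sym (*-suc l s)))) ⟩
      2 ^ (l * suc s) * R ^ suc m                 ∎
      where
      open ≤-Reasoning
      R = length rows
      s = ∣ S ∘ suc ∣
      c = 2 ^ (l * s) * R ^ m
      F : (Fin N → Bool) → ℕ
      F χ′ = ∑ (vecs rows m) (λ ω → B ^ hits (S ∘ suc) ω χ′)
      bound : ∀ χ′ → ∣ χ′ ∣ ≤ ∣ χ ∣ + l → F χ′ ≤ c
      bound χ′ q = ∑-hits (S ∘ suc) χ′ (≤-trans (*-monoˡ-≤ B (≤-trans (+-monoˡ-≤ (s * l) q) (≤-reflexive (+-assoc ∣ χ ∣ l (s * l))))) small)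

-- The range is twice D because expansion gets applied to the symmetric difference of two sets of
-- size at most D.
Expanding : ∀ {Δ N m} → ℕ → (Fin m → Fin Δ → Fin N) → Set
Expanding {N = N} {m} D h = ∀ (S : Fin m → Bool) (X : List (Fin N)) → ∣ S ∣ ≤ D + D →
                (∀ v → par h S v ≡ true → v ∈ X) → ∣ S ∣ ≤ length X

T⇒≡ : ∀ {b} → T b → b ≡ true
T⇒≡ = Equivalence.to T-≡

module _ (N D δ m B : ℕ) (B≥1 : 1 ≤ B) (N≥1 : 1 ≤ N)
         (room : (D + D) * suc (2 * δ) * B ≤ N)
         (sparse : suc (D + D) * (m * 2 ^ suc (2 * δ)) ≤ B ^ δ) where

  private
    Δ : ℕ
    Δ = suc (2 * δ)
    Ω : List (Vec (Vec (Fin N) Δ) m)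
    Ω = vecs (rows N B Δ) m
    ∅ : Fin N → Bool
    ∅ _ = false
    bad : ℕ → (Fin m → Bool) → Vec (Vec (Fin N) Δ) m → Bool
    bad s S ω = ∣ odd S ω ∅ ∣ <ᵇ s

    -- Since Δ = 2δ + 1, the identity `∣odd∣` reads |odd| + 2 hits = s + 2δs; with fewer than s odd
    -- variables at least δs hits remain.
    many-hits : ∀ s S ω → ∣ S ∣ ≡ s → bad s S ω ≡ true → δ * s ≤ hits S ω ∅
    many-hits s S ω refl b = *-cancelˡ-≤ 2 (+-cancelˡ-≤ s _ _ (begin
      s + 2 * (δ * s)               ≡⟨ solve 2 (λ s d → s :+ con 2 :* (d :* s) := s :* (con 1 :+ con 2 :* d)) refl s δ ⟩
      s * Δ                         ≡⟨ cong (_+ s * Δ) (sym (∣∣-∅ ∅ (λ _ → refl))) ⟩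
      ∣ ∅ ∣ + s * Δ                 ≡⟨ sym (∣odd∣ S ω ∅) ⟩
      ∣ odd S ω ∅ ∣ + 2 * hits S ω ∅ ≤⟨ +-monoˡ-≤ (2 * hits S ω ∅) (<⇒≤ (<ᵇ⇒< ∣ odd S ω ∅ ∣ s (Equivalence.from T-≡ b))) ⟩
      s + 2 * hits S ω ∅ ∎))
      where
      open ≤-Reasoning

    -- Markov's inequality for B^hits at the threshold B^(δs).
    rare : ∀ s S → s ≤ D + D → ∣ S ∣ ≡ s → B ^ (δ * s) * ∑ Ω (bit ∘ bad s S) ≤ 2 ^ (Δ * s) * length Ω
    rare s S s≤ refl = begin
      B ^ (δ * s) * ∑ Ω (bit ∘ bad s S)               ≡⟨ sym (∑-* Ω (B ^ (δ * s)) (bit ∘ bad s S)) ⟩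
      ∑ Ω (λ ω → B ^ (δ * s) * bit (bad s S ω))       ≤⟨ ∑-mono Ω (λ ω → markov ω (bad s S ω) refl) ⟩
      ∑ Ω (λ ω → B ^ hits S ω ∅)                      ≤⟨ ∑-hits N B Δ S ∅ fits ⟩
      2 ^ (Δ * s) * length (rows N B Δ) ^ m           ≡⟨ cong (2 ^ (Δ * s) *_) (sym (length-vecs (rows N B Δ) m)) ⟩
      2 ^ (Δ * s) * length Ω                          ∎
      where
      open ≤-Reasoning
      markov : ∀ ω b → bad s S ω ≡ b → B ^ (δ * s) * bit b ≤ B ^ hits S ω ∅
      markov ω true e = ≤-trans (≤-reflexive (*-identityʳ _)) (^-monoʳ-≤ B {{>-nonZero B≥1}} (many-hits s S ω refl e))
      markov ω false e = ≤-trans (≤-reflexive (*-zeroʳ (B ^ (δ * s)))) z≤n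
      fits : (∣ ∅ ∣ + ∣ S ∣ * Δ) * B ≤ N
      fits rewrite ∣∣-∅ ∅ (λ _ → refl) = ≤-trans (*-monoˡ-≤ B (*-monoˡ-≤ Δ s≤)) room

    -- One more node costs a factor m 2^Δ on the left and gains B^δ on the right, which is larger by
    -- `sparse`. The factor `suc (D + D)`, which exceeds the number of sizes, has to be paid only
    -- once.
    small : ∀ s → 1 ≤ s → suc (D + D) * (m ^ s * 2 ^ (Δ * s)) ≤ B ^ (δ * s)
    small (suc zero) _ = begin
      suc (D + D) * (m ^ 1 * 2 ^ (Δ * 1))   ≡⟨ cong (suc (D + D) *_) (cong₂ _*_ (*-identityʳ m) (cong (2 ^_) (*-identityʳ Δ))) ⟩
      suc (D + D) * (m * 2 ^ Δ)             ≤⟨ sparse ⟩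
      B ^ δ                                 ≡⟨ cong (B ^_) (sym (*-identityʳ δ)) ⟩
      B ^ (δ * 1)                           ∎
      where open ≤-Reasoning
    small (suc (suc s)) _ = begin
      suc (D + D) * (m * m ^ suc s * 2 ^ (Δ * suc (suc s)))
        ≡⟨ cong (λ z → suc (D + D) * (m * m ^ suc s * z)) (trans (cong (2 ^_) (*-suc Δ (suc s))) (^-distribˡ-+-* 2 Δ _)) ⟩
      suc (D + D) * (m * m ^ suc s * (2 ^ Δ * 2 ^ (Δ * suc s)))
        ≡⟨ solve 5 (λ a b c d e → a :* (b :* c :* (d :* e)) := (b :* d) :* (a :* (c :* e))) refl (suc (D + D)) m (m ^ suc s) (2 ^ Δ) (2 ^ (Δ * suc s)) ⟩
      (m * 2 ^ Δ) * (suc (D + D) * (m ^ suc s * 2 ^ (Δ * suc s)))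
        ≤⟨ *-mono-≤ (≤-trans (m≤n*m (m * 2 ^ Δ) (suc (D + D))) sparse) (small (suc s) (s≤s z≤n)) ⟩
      B ^ δ * B ^ (δ * suc s)
        ≡⟨ trans (sym (^-distribˡ-+-* B δ _)) (cong (B ^_) (sym (*-suc δ (suc s)))) ⟩
      B ^ (δ * suc (suc s)) ∎
      where
      open ≤-Reasoning

    sizes : List ℕ
    sizes = map suc (upTo (D + D))

    sizes-pos : ∀ {s} → s ∈ sizes → 1 ≤ s × s ≤ D + D
    sizes-pos p with ∈-map⁻ suc p
    ... | s , q , refl = s≤s z≤n , ∈-upTo⁻ q

    length-sizes : length sizes ≡ D + D
    length-sizes = trans (length-map suc (upTo (D + D))) (length-upTo (D + D))

    Ω≥1 : 1 ≤ length Ω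
    Ω≥1 = ≤-trans (pos (N ^ Δ) m (pos N Δ N≥1))
      (≤-reflexive (sym (trans (length-vecs (rows N B Δ) m) (cong (_^ m) (length-rows N B Δ)))))
      where
      pos : ∀ a e → 1 ≤ a → 1 ≤ a ^ e
      pos a e p = m^n>0 a {{>-nonZero p}} e

  expanding-exists : Σ (Fin m → Fin (suc (2 * δ)) → Fin N) (Expanding D)
  expanding-exists = h , expand
    where
    found = union-bound Ω sizes (subsets m) bad (m ^_) (λ s → B ^ (δ * s)) (λ s → 2 ^ (Δ * s)) (suc (D + D))
      (λ {s} _ → length-subsets m s)
      (λ {s} {S} s∈ S∈ → rare s S (proj₂ (sizes-pos s∈)) (subsets-size m s S∈))
      (λ {s} s∈ → small s (proj₁ (sizes-pos s∈)))
      (λ {s} _ → m^n>0 B {{>-nonZero B≥1}} (δ * s))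
      (s≤s (≤-reflexive length-sizes)) Ω≥1
    ω : Vec (Vec (Fin N) Δ) m
    ω = proj₁ found
    good : ∀ {s S} → s ∈ sizes → S ∈ subsets m s → bad s S ω ≡ false
    good = proj₂ found
    h : Fin m → Fin Δ → Fin N
    h t = lookup (lookup ω t)
    expand : Expanding D h
    expand S X S≤ cover with ∣ S ∣ in eS
    ... | zero = z≤n
    ... | suc s with subsets-complete S
    ...   | S′ , S′∈ , S′≗S = ≤-trans (≮⇒≥ not-bad) (∣∣-≤-length _ X cover′)
      where
      not-bad : ¬ ∣ odd S′ ω ∅ ∣ < suc s
      not-bad lt = false≢true (trans (sym (good {suc s} {S′} (∈-map⁺ suc (∈-upTo⁺ S≤)) (subst (λ z → S′ ∈ subsets m z) eS S′∈)))
        (T⇒≡ (<⇒<ᵇ lt)))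
      cover′ : ∀ v → odd S′ ω ∅ v ≡ true → v ∈ X
      cover′ v e = cover v (trans (sym (F₂.⨁-cong S′≗S (λ _ → refl))) (trans (sym (odd-par S′ ω ∅ v)) e))

-- The random second-order recurrence

data Rule (m : ℕ) : Set where
  init : Rule m
  sum  : Bool → Fin m → Fin m → Rule m

data Derivable {m : ℕ} (rule : Fin m → Rule m) : Fin m → Set where
  by-init : ∀ {t} → rule t ≡ init → Derivable rule t
  by-sum  : ∀ {t κ a b} → rule t ≡ sum κ a b → Derivable rule a → Derivable rule b → Derivable rule t

⌊⌋-mono : ∀ {P Q : Set} (P? : Dec P) (Q? : Dec Q) → (P → Q) → bit ⌊ P? ⌋ ≤ bit ⌊ Q? ⌋
⌊⌋-mono (yes p) (yes q) f = ≤-refl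
⌊⌋-mono (yes p) (no ¬q) f = contradiction (f p) ¬q
⌊⌋-mono (no ¬p) Q? f = z≤n

⌊⌋-no : ∀ {P : Set} (P? : Dec P) → ¬ P → bit ⌊ P? ⌋ ≡ 0
⌊⌋-no (yes p) f = contradiction p f
⌊⌋-no (no ¬p) f = refl

_≟ᵥ_ : ∀ {n} (x y : Vec Bool n) → Dec (x ≡ y)
_≟ᵥ_ = Vec.≡-dec Bool._≟_

bools : List Bool
bools = true ∷ false ∷ []

∑-point : ∀ {n} (c : Vec Bool n) → ∑ (vecs bools n) (λ r → bit ⌊ r ≟ᵥ c ⌋) ≤ 1
∑-point [] = ≤-refl
∑-point {suc n} (c₀ ∷ c) = ≤-trans (≤-reflexive (∑-vecs bools n (λ r → bit ⌊ r ≟ᵥ (c₀ ∷ c) ⌋))) (go c₀)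
  where
  term : Bool → Bool → ℕ
  term b c₀ = ∑ (vecs bools n) (λ r → bit ⌊ (b ∷ r) ≟ᵥ (c₀ ∷ c) ⌋)
  same : ∀ b → term b b ≤ 1
  same b = ≤-trans (∑-mono (vecs bools n) (λ r → ⌊⌋-mono ((b ∷ r) ≟ᵥ (b ∷ c)) (r ≟ᵥ c) Vec.∷-injectiveʳ)) (∑-point c)
  diff : ∀ b c₀ → b ≢ c₀ → term b c₀ ≡ 0
  diff b c₀ b≢ = trans (∑-cong (vecs bools n) (λ r → ⌊⌋-no ((b ∷ r) ≟ᵥ (c₀ ∷ c)) (b≢ ∘ Vec.∷-injectiveˡ)))
    (trans (∑-const (vecs bools n) 0) (*-zeroʳ (length (vecs bools n))))
  go : ∀ c₀ → term true c₀ + (term false c₀ + 0) ≤ 1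
  go true rewrite diff false true (λ ()) = ≤-trans (≤-reflexive (+-identityʳ _)) (same true)
  go false rewrite diff true false (λ ()) = ≤-trans (≤-reflexive (+-identityʳ _)) (same false)

unit : ∀ {l} → Fin l → Vec Bool l
unit {suc l} zero = true ∷ replicate l false
unit (suc j) = false ∷ unit j

unit≢𝟘 : ∀ {l} (j : Fin l) → unit j ≢ replicate l false
unit≢𝟘 (suc j) e = unit≢𝟘 j (Vec.∷-injectiveʳ e)

prefix : ∀ {l} → Fin l → Vec Bool l → Vec Bool l
prefix {suc l} zero (x ∷ r) = x ∷ replicate l false
prefix (suc I) (x ∷ r) = x ∷ prefix I r

prefix-last : ∀ {l} (r : Vec Bool (suc l)) → prefix (fromℕ l) r ≡ r
prefix-last {zero} (x ∷ []) = refl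
prefix-last {suc l} (x ∷ r) = cong (x ∷_) (prefix-last r)

prefix-zero : ∀ {l} (r : Vec Bool (suc l)) → prefix zero r ≡ F₂Module._·_ (F₂^ (suc l)) (lookup r zero) (unit zero)
prefix-zero (true ∷ r) = refl
prefix-zero (false ∷ r) = refl

prefix-suc : ∀ {l} (I : Fin l) (r : Vec Bool (suc l)) → prefix (suc I) r ≡
  F₂Module._⊕_ (F₂^ (suc l)) (prefix (inject₁ I) r) (F₂Module._·_ (F₂^ (suc l)) (lookup r (suc I)) (unit (suc I)))
prefix-suc {suc l} zero (x ∷ true ∷ r) = cong₂ _∷_ (sym (xor-identityʳ x)) (cong₂ _∷_ refl (sym (F₂Module.𝟘-⊕ (F₂^ l) _)))
prefix-suc {suc l} zero (x ∷ false ∷ r) = cong₂ _∷_ (sym (xor-identityʳ x)) (cong₂ _∷_ refl (sym (F₂Module.𝟘-⊕ (F₂^ l) _)))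
prefix-suc {suc l} (suc I) (x ∷ r) = trans (cong (x ∷_) (prefix-suc I r)) (push (lookup r (suc I)))
  where
  module V′ = F₂Module (F₂^ (suc l))
  module V″ = F₂Module (F₂^ (suc (suc l)))
  push : ∀ b → x ∷ (prefix (inject₁ I) r V′.⊕ (b V′.· unit (suc I))) ≡
         (x ∷ prefix (inject₁ I) r) V″.⊕ (b V″.· unit (suc (suc I)))
  push true = cong (_∷ _) (sym (xor-identityʳ x))
  push false = cong (_∷ _) (sym (xor-identityʳ x))

-- The order of the columns, packaged so that H can remain a variable in the recurrence; only the
-- construction of an instance needs H to be a successor.
record Columns (H : ℕ) : Set where
  open F₂Module (F₂^ H)
  field
    last      : Fin H
    pred      : Fin H → Maybe (Fin H)
    pred-<    : ∀ {I I′} → pred I ≡ just I′ → toℕ I′ < toℕ I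
    at-last   : ∀ r → prefix last r ≡ r
    at-first  : ∀ {I} r → pred I ≡ nothing → prefix I r ≡ lookup r I · unit I
    at-next   : ∀ {I I′} r → pred I ≡ just I′ → prefix I r ≡ prefix I′ r ⊕ (lookup r I · unit I)

columns : ∀ H′ → Columns (suc H′)
columns H′ = record
  { last = fromℕ H′ ; pred = pred ; pred-< = λ {I} → pred-< I ; at-last = prefix-last
  ; at-first = λ {I} → at-first I ; at-next = λ {I} → at-next I }
  where
  open F₂Module (F₂^ (suc H′))
  pred : Fin (suc H′) → Maybe (Fin (suc H′))
  pred zero = nothing
  pred (suc I) = just (inject₁ I)
  pred-< : ∀ I {I′} → pred I ≡ just I′ → toℕ I′ < toℕ I
  pred-< (suc I) refl = s≤s (≤-reflexive (Fin.toℕ-inject₁ I))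
  at-first : ∀ I r → pred I ≡ nothing → prefix I r ≡ lookup r I · unit I
  at-first zero r e = prefix-zero r
  at-next : ∀ I {I′} r → pred I ≡ just I′ → prefix I r ≡ prefix I′ r ⊕ (lookup r I · unit I)
  at-next (suc I) r refl = prefix-suc I r

module Recurrence (H : ℕ) where

  ℓ : ℕ
  ℓ = H * H

  V W : F₂Module
  V = F₂^ H
  W = V ⊞ V

  private
    module V = F₂Module V
    module W = F₂Module W

  Mat : Set
  Mat = Vec (Vec Bool H) H

  _≟W_ : (x y : Carrier W) → Dec (x ≡ y)
  _≟W_ = ×-≡-dec _≟ᵥ_ _≟ᵥ_

  row* : ∀ {l} → Vec Bool l → Vec (Vec Bool H) l → Vec Bool H
  row* [] [] = V.𝟘
  row* (a ∷ α) (r ∷ A) = (a V.· r) V.⊕ row* α A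

  row*-additive : ∀ {l} (α β : Vec Bool l) A →
    row* (F₂Module._⊕_ (F₂^ l) α β) A ≡ row* α A V.⊕ row* β A
  row*-additive [] [] [] = sym (V.𝟘-⊕ V.𝟘)
  row*-additive (a ∷ α) (b ∷ β) (r ∷ A) =
    trans (cong₂ V._⊕_ (V.·-xor a b r) (row*-additive α β A)) (V.⊕-interchange _ _ _ _)

  row*-𝟘 : ∀ {l} (A : Vec (Vec Bool H) l) → row* (replicate l false) A ≡ V.𝟘
  row*-𝟘 [] = refl
  row*-𝟘 (r ∷ A) = trans (V.𝟘-⊕ _) (row*-𝟘 A)

  row*-unit : ∀ {l} (j : Fin l) (A : Vec (Vec Bool H) l) → row* (unit j) A ≡ lookup A j
  row*-unit zero (r ∷ A) = trans (cong (r V.⊕_) (row*-𝟘 A)) (V.⊕-𝟘 r)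
  row*-unit (suc j) (r ∷ A) = trans (V.𝟘-⊕ _) (row*-unit j A)

  -- Row vectors are coordinates with respect to (Y_i , Y_{i+1}); `pull A` rewrites coordinates
  -- with respect to (Y_{i+1} , Y_{i+2}) using Y_{i+2} = Y_i + A Y_{i+1}.
  pull pull⁻¹ : Mat → Carrier W → Carrier W
  pull A (μ , ν) = ν , (μ V.⊕ row* ν A)
  pull⁻¹ A (μ , ν) = (row* μ A V.⊕ ν) , μ

  pull-solve : ∀ A x y → pull A x ≡ y → x ≡ pull⁻¹ A y
  pull-solve A (μ , ν) y refl = cong (_, ν) (sym (trans (cong (row* ν A V.⊕_) (V.⊕-comm μ _)) (V.⊕-cancelˡ (row* ν A) μ)))

  pull-additive : ∀ A → Additive W W (pull A)
  pull-additive A = record { additive = λ (μ , ν) (μ′ , ν′) → cong (ν V.⊕ ν′ ,_)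
    (trans (cong (μ V.⊕ μ′ V.⊕_) (row*-additive ν ν′ A)) (V.⊕-interchange μ μ′ _ _)) }

  pull-𝟘 : ∀ A → pull A W.𝟘 ≡ W.𝟘
  pull-𝟘 A = Additive.additive-𝟘 (pull-additive A)

  pull-≢𝟘 : ∀ A x → x ≢ W.𝟘 → pull A x ≢ W.𝟘
  pull-≢𝟘 A x x≢ e = x≢ (trans (pull-solve A x W.𝟘 e) (sym (pull-solve A W.𝟘 W.𝟘 (pull-𝟘 A))))

  -- The node (j , I) of a block holds the partial sum Y_i,j + Σ_{I′ ≤ I} A_{j,I′} Y_{i+1},I′.
  loc : Mat → Fin H → Fin H → Carrier W
  loc A j I = unit j , prefix I (lookup A j)

  -- Pulling the local form of block i back through the matrices of blocks 0 to i - 1 expresses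
  -- every node in the coordinates of the one pair (Y_0 , Y_1), so that nodes of different blocks
  -- can be added.
  vecAt : ∀ {T} → Vec Mat T → Fin T → Fin H → Fin H → Carrier W
  vecAt (A ∷ ω) zero j I = loc A j I
  vecAt (A ∷ ω) (suc i) j I = pull A (vecAt ω i j I)

  vecAt≢𝟘 : ∀ {T} (ω : Vec Mat T) i j I → vecAt ω i j I ≢ W.𝟘
  vecAt≢𝟘 (A ∷ ω) zero j I e = unit≢𝟘 j (cong proj₁ e)
  vecAt≢𝟘 (A ∷ ω) (suc i) j I = pull-≢𝟘 A _ (vecAt≢𝟘 ω i j I)

  mats : List Mat
  mats = vecs (vecs bools H) H

  -- Fix all rows of A except the one at the first nonzero coordinate of `α`. That row must then
  -- take one particular value, out of 2^H.
  ∑-row* : ∀ {l} (α : Vec Bool l) τ → α ≢ replicate l false →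
    2 ^ H * ∑ (vecs (vecs bools H) l) (λ A → bit ⌊ row* α A ≟ᵥ τ ⌋) ≤ length (vecs (vecs bools H) l)
  ∑-row* [] τ α≢ = contradiction refl α≢
  ∑-row* {suc l} (true ∷ α) τ α≢ = begin
    2 ^ H * ∑ (vecs R (suc l)) (λ A → bit ⌊ row* (true ∷ α) A ≟ᵥ τ ⌋)
      ≡⟨ cong (2 ^ H *_) (∑-vecs R l (λ A → bit ⌊ row* (true ∷ α) A ≟ᵥ τ ⌋)) ⟩
    2 ^ H * ∑ R (λ r → ∑ (vecs R l) (λ A → bit ⌊ (r V.⊕ row* α A) ≟ᵥ τ ⌋))
      ≡⟨ cong (2 ^ H *_) (∑-swap R (vecs R l) _) ⟩
    2 ^ H * ∑ (vecs R l) (λ A → ∑ R (λ r → bit ⌊ (r V.⊕ row* α A) ≟ᵥ τ ⌋))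
      ≤⟨ *-monoʳ-≤ (2 ^ H) (∑-mono (vecs R l) (λ A → ≤-trans (∑-mono R (λ r → ⌊⌋-mono (_ ≟ᵥ τ) (r ≟ᵥ (row* α A V.⊕ τ))
            (λ e → V.⊕-move (trans (V.⊕-comm (row* α A) r) e)))) (∑-point (row* α A V.⊕ τ)))) ⟩
    2 ^ H * ∑ (vecs R l) (λ A → 1)
      ≡⟨ cong₂ _*_ (sym (length-vecs bools H)) (sym (length≡∑ (vecs R l))) ⟩
    length R * length (vecs R l)
      ≡⟨ sym (length-product _∷_ R (vecs R l)) ⟩
    length (vecs R (suc l)) ∎
    where
    open ≤-Reasoning
    R = vecs bools H
  ∑-row* {suc l} (false ∷ α) τ α≢ = begin
    2 ^ H * ∑ (vecs R (suc l)) (λ A → bit ⌊ row* (false ∷ α) A ≟ᵥ τ ⌋)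
      ≡⟨ cong (2 ^ H *_) (∑-vecs R l (λ A → bit ⌊ row* (false ∷ α) A ≟ᵥ τ ⌋)) ⟩
    2 ^ H * ∑ R (λ r → ∑ (vecs R l) (λ A → bit ⌊ (V.𝟘 V.⊕ row* α A) ≟ᵥ τ ⌋))
      ≡⟨ sym (∑-* R (2 ^ H) _) ⟩
    ∑ R (λ r → 2 ^ H * ∑ (vecs R l) (λ A → bit ⌊ (V.𝟘 V.⊕ row* α A) ≟ᵥ τ ⌋))
      ≤⟨ ∑-mono R (λ r → ≤-trans (*-monoʳ-≤ (2 ^ H) (∑-mono (vecs R l) (λ A → ⌊⌋-mono (_ ≟ᵥ τ) (row* α A ≟ᵥ τ) (trans (sym (V.𝟘-⊕ _))))))
            (∑-row* α τ (α≢ ∘ cong (false ∷_)))) ⟩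
    ∑ R (λ r → length (vecs R l))
      ≡⟨ ∑-const R _ ⟩
    length R * length (vecs R l)
      ≡⟨ sym (length-product _∷_ R (vecs R l)) ⟩
    length (vecs R (suc l)) ∎
    where
    open ≤-Reasoning
    R = vecs bools H

  -- If ν ≠ 0 then A₁ randomises the first half of the coordinates; otherwise μ ≠ 0 and A₀ randomises the second.
  ∑-pull² : ∀ γ τ → γ ≢ W.𝟘 →
    2 ^ H * ∑ mats (λ A₀ → ∑ mats (λ A₁ → bit ⌊ pull A₀ (pull A₁ γ) ≟W τ ⌋)) ≤ length mats * length mats
  ∑-pull² (μ , ν) (σ , τ) γ≢ with ν ≟ᵥ V.𝟘
  ... | no ν≢ = begin
    2 ^ H * ∑ mats (λ A₀ → ∑ mats (λ A₁ → bit ⌊ pull A₀ (pull A₁ (μ , ν)) ≟W (σ , τ) ⌋))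
      ≡⟨ sym (∑-* mats (2 ^ H) _) ⟩
    ∑ mats (λ A₀ → 2 ^ H * ∑ mats (λ A₁ → bit ⌊ pull A₀ (pull A₁ (μ , ν)) ≟W (σ , τ) ⌋))
      ≤⟨ ∑-mono mats (λ A₀ → ≤-trans (*-monoʳ-≤ (2 ^ H) (∑-mono mats (λ A₁ →
            ⌊⌋-mono (_ ≟W (σ , τ)) (row* ν A₁ ≟ᵥ (μ V.⊕ σ)) (λ e → V.⊕-move (cong proj₁ e))))) (∑-row* ν (μ V.⊕ σ) ν≢)) ⟩
    ∑ mats (λ A₀ → length mats)
      ≡⟨ ∑-const mats _ ⟩
    length mats * length mats ∎
    where open ≤-Reasoning
  ... | yes refl = begin
    2 ^ H * ∑ mats (λ A₀ → ∑ mats (λ A₁ → bit ⌊ pull A₀ (pull A₁ (μ , ν)) ≟W (σ , τ) ⌋))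
      ≡⟨ cong (2 ^ H *_) (∑-swap mats mats _) ⟩
    2 ^ H * ∑ mats (λ A₁ → ∑ mats (λ A₀ → bit ⌊ pull A₀ (pull A₁ (μ , ν)) ≟W (σ , τ) ⌋))
      ≡⟨ sym (∑-* mats (2 ^ H) _) ⟩
    ∑ mats (λ A₁ → 2 ^ H * ∑ mats (λ A₀ → bit ⌊ pull A₀ (pull A₁ (μ , ν)) ≟W (σ , τ) ⌋))
      ≤⟨ ∑-mono mats (λ A₁ → ≤-trans (*-monoʳ-≤ (2 ^ H) (∑-mono mats (λ A₀ →
            ⌊⌋-mono (_ ≟W (σ , τ)) (row* μ A₀ ≟ᵥ τ) (λ e → trans (cong (λ z → row* z A₀) (sym (drop A₁)))
              (trans (sym (V.𝟘-⊕ _)) (cong proj₂ e)))))) (∑-row* μ τ (λ { refl → γ≢ refl }))) ⟩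
    ∑ mats (λ A₁ → length mats)
      ≡⟨ ∑-const mats _ ⟩
    length mats * length mats ∎
    where
    open ≤-Reasoning
    drop : ∀ A₁ → μ V.⊕ row* V.𝟘 A₁ ≡ μ
    drop A₁ = trans (cong (μ V.⊕_) (row*-𝟘 A₁)) (V.⊕-𝟘 μ)

  node : ∀ {T} → Fin T → Fin H → Fin H → Fin (T * ℓ)
  node i j I = combine i (combine j I)

  block : ∀ {T} → Fin (T * ℓ) → Fin T
  block t = proj₁ (remQuot ℓ t)

  pos : ∀ {T} → Fin (T * ℓ) → Fin H × Fin H
  pos {T} t = remQuot H (proj₂ (remQuot {T} ℓ t))

  blk : ∀ {T} → Fin (T * ℓ) → ℕ
  blk {T} t = toℕ (block {T} t)

  is-node : ∀ {T} (t : Fin (T * ℓ)) → node (block {T} t) (proj₁ (pos {T} t)) (proj₂ (pos {T} t)) ≡ t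
  is-node {T} t = trans (cong (combine (block {T} t)) (Fin.combine-remQuot {H} H (proj₂ (remQuot {T} ℓ t)))) (Fin.combine-remQuot {T} ℓ t)

  block-node : ∀ {T} (i : Fin T) j I → block {T} (node i j I) ≡ i
  block-node i j I = cong proj₁ (Fin.remQuot-combine i (combine j I))

  pos-node : ∀ {T} (i : Fin T) j I → pos {T} (node i j I) ≡ (j , I)
  pos-node i j I = trans (cong (λ z → remQuot H (proj₂ z)) (Fin.remQuot-combine i (combine j I))) (Fin.remQuot-combine j I)

  vec : ∀ {T} → Vec Mat T → Fin (T * ℓ) → Carrier W
  vec {T} ω t = vecAt ω (block {T} t) (proj₁ (pos {T} t)) (proj₂ (pos {T} t))

  private
    vecOf : ∀ {T} → Vec Mat T → Fin T × Fin ℓ → Carrier W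
    vecOf ω (i , u) = vecAt ω i (proj₁ (remQuot {H} H u)) (proj₂ (remQuot {H} H u))

  vec-node : ∀ {T} (ω : Vec Mat T) i j I → vec ω (node i j I) ≡ vecAt ω i j I
  vec-node ω i j I = cong₂ (λ i p → vecAt ω i (proj₁ p) (proj₂ p)) (block-node i j I) (pos-node i j I)

  remQuot-↑ˡ : ∀ {T} (u : Fin ℓ) → remQuot {suc T} ℓ (u ↑ˡ (T * ℓ)) ≡ (zero , u)
  remQuot-↑ˡ {T} u = Fin.remQuot-combine {suc T} zero u

  remQuot-↑ʳ : ∀ {T} (t : Fin (T * ℓ)) → remQuot {suc T} ℓ (ℓ ↑ʳ t) ≡ (suc (block {T} t) , proj₂ (remQuot {T} ℓ t))
  remQuot-↑ʳ {T} t = trans (cong (λ z → remQuot {suc T} ℓ (ℓ ↑ʳ z)) (sym (Fin.combine-remQuot {T} ℓ t)))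
    (Fin.remQuot-combine {suc T} (suc (block {T} t)) (proj₂ (remQuot {T} ℓ t)))

  blk-↑ˡ : ∀ {T} (u : Fin ℓ) → blk {suc T} (u ↑ˡ (T * ℓ)) ≡ 0
  blk-↑ˡ {T} u = cong (toℕ ∘ proj₁) (remQuot-↑ˡ {T} u)

  blk-↑ʳ : ∀ {T} (t : Fin (T * ℓ)) → blk {suc T} (ℓ ↑ʳ t) ≡ suc (blk {T} t)
  blk-↑ʳ {T} t = cong (toℕ ∘ proj₁) (remQuot-↑ʳ {T} t)

  vec-↑ʳ : ∀ {T} A (ω : Vec Mat T) t → vec (A ∷ ω) (ℓ ↑ʳ t) ≡ pull A (vec ω t)
  vec-↑ʳ {T} A ω t = cong (vecOf (A ∷ ω)) (remQuot-↑ʳ {T} t)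

  z : ∀ {T} → Vec Mat T → (Fin (T * ℓ) → Bool) → Carrier W
  z {T} ω S = W.⨁ S (vec ω)

  z-head : ∀ {T} → Vec Mat (suc T) → (Fin (suc T * ℓ) → Bool) → Carrier W
  z-head {T} ω S = W.⨁ (λ u → S (u ↑ˡ (T * ℓ))) (λ u → vec ω (u ↑ˡ (T * ℓ)))

  z-cons : ∀ {T} A (ω : Vec Mat T) S → z (A ∷ ω) S ≡ z-head (A ∷ ω) S W.⊕ pull A (z ω (S ∘ (ℓ ↑ʳ_)))
  z-cons {T} A ω S = trans (W.⨁-split ℓ (T * ℓ) S (vec (A ∷ ω))) (cong (z-head (A ∷ ω) S W.⊕_)
    (trans (W.⨁-cong {S = S ∘ (ℓ ↑ʳ_)} (λ _ → refl) (vec-↑ʳ A ω)) (sym (Additive.additive-⨁ (pull-additive A) (S ∘ (ℓ ↑ʳ_)) (vec ω)))))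

  z-cons-∅ : ∀ {T} A (ω : Vec Mat T) S → (∀ t → S t ≡ true → blk {suc T} t ≢ 0) → z (A ∷ ω) S ≡ pull A (z ω (S ∘ (ℓ ↑ʳ_)))
  z-cons-∅ {T} A ω S avoid = trans (z-cons A ω S) (trans (cong (W._⊕ pull A (z ω (S ∘ (ℓ ↑ʳ_)))) (W.⨁-vanishes _ _
    (λ u e → contradiction (blk-↑ˡ {T} u) (avoid _ e)))) (W.𝟘-⊕ _))

  upper : ∀ {T} → ℕ → (Fin (T * ℓ) → Bool) → Fin (T * ℓ) → Bool
  upper {T} e S t = S t ∧ (suc e <ᵇ blk {T} t)

  Avoids : ∀ {T} → ℕ → (Fin (T * ℓ) → Bool) → Set
  Avoids {T} e S = ∀ t → S t ≡ true → blk {T} t ≢ e × blk {T} t ≢ suc e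

  avoids? : ∀ {T} e (S : Fin (T * ℓ) → Bool) → Dec (Avoids {T} e S)
  avoids? {T} e S = Fin.all? (λ t → (S t Bool.≟ true) →-dec (¬? (blk {T} t ℕ.≟ e) ×-dec ¬? (blk {T} t ℕ.≟ suc e)))

  -- The final application has τ = 0; a general τ is carried because peeling off a block before the
  -- gap shifts it.
  Bad : ∀ {T} → ℕ → (Fin (T * ℓ) → Bool) → Carrier W → Vec Mat T → Set
  Bad {T} e S τ ω = z ω S ≡ τ × z ω (upper {T} e S) ≢ W.𝟘

  bad? : ∀ {T} e S τ (ω : Vec Mat T) → Dec (Bad e S τ ω)
  bad? {T} e S τ ω = (z ω S ≟W τ) ×-dec ¬? (z ω (upper {T} e S) ≟W W.𝟘)

  private
    ∧-true : ∀ a b → a ∧ b ≡ true → a ≡ true × b ≡ true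
    ∧-true true true e = refl , refl

  upper-∅ : ∀ {T} e S t → upper {T} e S t ≡ true → blk {T} t ≢ 0
  upper-∅ {T} e S t p q with proj₂ (∧-true (S t) _ p)
  ... | r rewrite q = contradiction r λ ()

  z-upper : ∀ {T} A (ω : Vec Mat T) e S → z (A ∷ ω) (upper {suc T} (suc e) S) ≡ pull A (z ω (upper {T} e (S ∘ (ℓ ↑ʳ_))))
  z-upper {T} A ω e S = trans (z-cons-∅ A ω _ (upper-∅ {suc T} (suc e) S)) (cong (pull A) (W.⨁-cong
    (λ t → cong (λ b → S (ℓ ↑ʳ t) ∧ (suc (suc e) <ᵇ b)) (blk-↑ʳ {T} t)) (λ _ → refl)))

  -- Only the matrices of the blocks e and e + 1 are random here; all others are fixed.
  ∑-bad : ∀ T e (S : Fin (T * ℓ) → Bool) τ → suc e < T → Avoids {T} e S →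
    2 ^ H * ∑ (vecs mats T) (λ ω → bit ⌊ bad? e S τ ω ⌋) ≤ length (vecs mats T)
  ∑-bad (suc T) (suc e) S τ (s≤s e<T) avoid = begin
    2 ^ H * ∑ (vecs mats (suc T)) (λ ω → bit ⌊ bad? (suc e) S τ ω ⌋)
      ≡⟨ cong (2 ^ H *_) (∑-vecs mats T (λ ω → bit ⌊ bad? (suc e) S τ ω ⌋)) ⟩
    2 ^ H * ∑ mats (λ A → ∑ (vecs mats T) (λ ω → bit ⌊ bad? (suc e) S τ (A ∷ ω) ⌋))
      ≡⟨ sym (∑-* mats (2 ^ H) _) ⟩
    ∑ mats (λ A → 2 ^ H * ∑ (vecs mats T) (λ ω → bit ⌊ bad? (suc e) S τ (A ∷ ω) ⌋))
      ≤⟨ ∑-mono mats (λ A → ≤-trans (*-monoʳ-≤ (2 ^ H) (∑-mono (vecs mats T) (λ ω →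
            ⌊⌋-mono (bad? (suc e) S τ (A ∷ ω)) (bad? e S′ (τ′ A ω) ω) (step A ω))))
            (≤-trans (≤-reflexive (cong (2 ^ H *_) (∑-cong (vecs mats T) (λ ω → cong (λ x → bit ⌊ bad? e S′ x ω ⌋) (τ′-const A ω)))))
              (∑-bad T e S′ (τ″ A) e<T avoid′))) ⟩
    ∑ mats (λ A → length (vecs mats T))
      ≡⟨ ∑-const mats _ ⟩
    length mats * length (vecs mats T)
      ≡⟨ sym (length-product _∷_ mats (vecs mats T)) ⟩
    length (vecs mats (suc T)) ∎
    where
    open ≤-Reasoning
    S′ : Fin (T * ℓ) → Bool
    S′ = S ∘ (ℓ ↑ʳ_)
    -- Block 0 contributes a vector depending on `A` alone. Moving it to the right-hand side and
    -- inverting `pull A` gives the value that the remaining blocks have to hit.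
    τ′ : Mat → Vec Mat T → Carrier W
    τ′ A ω = pull⁻¹ A (z-head (A ∷ ω) S W.⊕ τ)
    head : Mat → Fin ℓ → Carrier W
    head A u = loc A (proj₁ (remQuot {H} H u)) (proj₂ (remQuot {H} H u))
    τ″ : Mat → Carrier W
    τ″ A = pull⁻¹ A (W.⨁ (λ u → S (u ↑ˡ (T * ℓ))) (head A) W.⊕ τ)
    vec-↑ˡ : ∀ A (ω : Vec Mat T) u → vec (A ∷ ω) (u ↑ˡ (T * ℓ)) ≡ head A u
    vec-↑ˡ A ω u = cong (vecOf (A ∷ ω)) (remQuot-↑ˡ {T} u)
    τ′-const : ∀ A ω → τ′ A ω ≡ τ″ A
    τ′-const A ω = cong (λ x → pull⁻¹ A (x W.⊕ τ)) (W.⨁-cong (λ _ → refl) (vec-↑ˡ A ω))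
    step : ∀ A ω → Bad (suc e) S τ (A ∷ ω) → Bad e S′ (τ′ A ω) ω
    step A ω (zS , up≢) =
      pull-solve A _ _ (W.⊕-move (trans (sym (z-cons A ω S)) zS)) ,
      λ up → up≢ (trans (z-upper A ω e S) (trans (cong (pull A) up) (pull-𝟘 A)))
    avoid′ : Avoids {T} e S′
    avoid′ t st with avoid (ℓ ↑ʳ t) st
    ... | p , q = (λ r → p (trans (blk-↑ʳ {T} t) (cong suc r))) , (λ r → q (trans (blk-↑ʳ {T} t) (cong suc r)))
  ∑-bad (suc (suc T)) zero S τ e<T avoid = begin
    2 ^ H * ∑ (vecs mats (suc (suc T))) f
      ≡⟨ cong (2 ^ H *_) (trans (∑-vecs mats (suc T) f) (∑-cong mats (λ A₀ → trans (∑-vecs mats T (λ ω → f (A₀ ∷ ω))) (∑-swap mats (vecs mats T) _)))) ⟩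
    2 ^ H * ∑ mats (λ A₀ → ∑ (vecs mats T) (λ ω → ∑ mats (λ A₁ → f (A₀ ∷ A₁ ∷ ω))))
      ≡⟨ cong (2 ^ H *_) (∑-swap mats (vecs mats T) _) ⟩
    2 ^ H * ∑ (vecs mats T) (λ ω → ∑ mats (λ A₀ → ∑ mats (λ A₁ → f (A₀ ∷ A₁ ∷ ω))))
      ≡⟨ sym (∑-* (vecs mats T) (2 ^ H) _) ⟩
    ∑ (vecs mats T) (λ ω → 2 ^ H * ∑ mats (λ A₀ → ∑ mats (λ A₁ → f (A₀ ∷ A₁ ∷ ω))))
      ≤⟨ ∑-mono (vecs mats T) per ⟩
    ∑ (vecs mats T) (λ ω → length mats * length mats)
      ≡⟨ ∑-const (vecs mats T) _ ⟩
    length (vecs mats T) * (length mats * length mats)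
      ≡⟨ solve 2 (λ a b → a :* (b :* b) := b :* (b :* a)) refl (length (vecs mats T)) (length mats) ⟩
    length mats * (length mats * length (vecs mats T))
      ≡⟨ cong (length mats *_) (sym (length-product _∷_ mats (vecs mats T))) ⟩
    length mats * length (vecs mats (suc T))
      ≡⟨ sym (length-product _∷_ mats (vecs mats (suc T))) ⟩
    length (vecs mats (suc (suc T))) ∎
    where
    open ≤-Reasoning
    f : Vec Mat (suc (suc T)) → ℕ
    f ω = bit ⌊ bad? zero S τ ω ⌋
    S′ : Fin (suc T * ℓ) → Bool
    S′ = S ∘ (ℓ ↑ʳ_)
    S″ : Fin (T * ℓ) → Bool
    S″ = S′ ∘ (ℓ ↑ʳ_)
    z-S : ∀ A₀ A₁ ω → z (A₀ ∷ A₁ ∷ ω) S ≡ pull A₀ (pull A₁ (z ω S″))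
    z-S A₀ A₁ ω = trans (z-cons-∅ A₀ (A₁ ∷ ω) S (λ t st → proj₁ (avoid t st)))
      (cong (pull A₀) (z-cons-∅ A₁ ω S′ (λ t st r → proj₂ (avoid _ st) (trans (blk-↑ʳ {suc T} t) (cong suc r)))))
    z-up : ∀ A₀ A₁ ω → z (A₀ ∷ A₁ ∷ ω) (upper {suc (suc T)} zero S) ≡ z (A₀ ∷ A₁ ∷ ω) S
    z-up A₀ A₁ ω = W.⨁-cong same (λ _ → refl)
      where
      same : ∀ t → upper {suc (suc T)} zero S t ≡ S t
      same t with S t in st
      ... | false = refl
      ... | true with blk {suc (suc T)} t | avoid t st
      ...   | zero | p , q = contradiction refl p
      ...   | suc zero | p , q = contradiction refl q
      ...   | suc (suc b) | p , q = refl
    per : ∀ ω → 2 ^ H * ∑ mats (λ A₀ → ∑ mats (λ A₁ → f (A₀ ∷ A₁ ∷ ω))) ≤ length mats * length mats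
    -- All of `S` lies after the gap here. If its sum is already 0 before the two random matrices
    -- act, then so is the part after the gap and nothing is bad; otherwise the two matrices
    -- randomise it.
    per ω with z ω S″ ≟W W.𝟘
    ... | yes z≡𝟘 = ≤-trans (≤-reflexive (trans (cong (2 ^ H *_) (trans (∑-cong mats (λ A₀ → trans (∑-cong mats (λ A₁ →
            ⌊⌋-no (bad? zero S τ (A₀ ∷ A₁ ∷ ω)) (λ (_ , up≢) → up≢ (trans (z-up A₀ A₁ ω) (trans (z-S A₀ A₁ ω)
              (trans (cong (pull A₀ ∘ pull A₁) z≡𝟘) (trans (cong (pull A₀) (pull-𝟘 A₁)) (pull-𝟘 A₀))))))))
            (zeros mats))) (zeros mats))) (*-zeroʳ (2 ^ H)))) z≤n
      where
      zeros : ∀ {A : Set} (xs : List A) → ∑ xs (λ _ → 0) ≡ 0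
      zeros xs = trans (∑-const xs 0) (*-zeroʳ (length xs))
    ... | no z≢𝟘 = ≤-trans (*-monoʳ-≤ (2 ^ H) (∑-mono mats (λ A₀ → ∑-mono mats (λ A₁ →
            ⌊⌋-mono (bad? zero S τ (A₀ ∷ A₁ ∷ ω)) (_ ≟W τ) (λ (zS , _) → trans (sym (z-S A₀ A₁ ω)) zS)))))
            (∑-pull² (z ω S″) τ z≢𝟘)
  ∑-bad (suc zero) zero S τ (s≤s ()) avoid

  -- The size bound is D + 1 because the target will be added to a set of at most D nodes.
  Independent : ∀ {T} → ℕ → Vec Mat T → Set
  Independent {T} D ω = ∀ e (S : Fin (T * ℓ) → Bool) → suc e < T → ∣ S ∣ ≤ suc D → Avoids {T} e S →
    z ω S ≡ W.𝟘 → z ω (upper {T} e S) ≡ W.𝟘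

  module _ (T D : ℕ) (m≥1 : 1 ≤ T * (H * H)) (large : suc (T * suc (suc D)) * (T * ℓ) ^ suc D ≤ 2 ^ H) where

    private
      m = T * ℓ
      Ω = vecs mats T
      es : List (ℕ × ℕ)
      es = cartesianProductWith _,_ (upTo T) (upTo (suc (suc D)))
      -- The side conditions belong to the event, so that the union bound can range over all gaps,
      -- sizes and subsets; where they fail the event is empty.
      Full : ℕ × ℕ → (Fin m → Bool) → Vec Mat T → Set
      Full (e , s) S ω = (suc e < T × Avoids {T} e S) × Bad e S W.𝟘 ω
      full? : ∀ x S ω → Dec (Full x S ω)
      full? (e , s) S ω = ((suc e ℕ.<? T) ×-dec avoids? {T} e S) ×-dec bad? e S W.𝟘 ω

      rare : ∀ x S → 2 ^ H * ∑ Ω (λ ω → bit ⌊ full? x S ω ⌋) ≤ 1 * length Ω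
      rare (e , s) S with (suc e ℕ.<? T) ×-dec avoids? {T} e S
      ... | no ¬p = ≤-trans (≤-reflexive (trans (cong (2 ^ H *_) (trans (∑-const Ω 0) (*-zeroʳ (length Ω)))) (*-zeroʳ (2 ^ H)))) z≤n
      ... | yes p@(e<T , avoid) = ≤-trans (*-monoʳ-≤ (2 ^ H) (∑-mono Ω (λ ω → ⌊⌋-mono (yes p ×-dec bad? e S W.𝟘 ω) (bad? e S W.𝟘 ω) proj₂)))
        (≤-trans (∑-bad T e S W.𝟘 e<T avoid) (≤-reflexive (sym (*-identityˡ _))))

      small : ∀ {x} → x ∈ es → suc (T * suc (suc D)) * (m ^ proj₂ x * 1) ≤ 2 ^ H
      small {e , s} x∈ = ≤-trans (*-monoʳ-≤ (suc (T * suc (suc D))) (≤-trans (≤-reflexive (*-identityʳ _))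
        (^-monoʳ-≤ m {{>-nonZero m≥1}} (≤-pred (∈-upTo⁻ (proj₂ (∈-cartesianProduct⁻ (upTo T) (upTo (suc (suc D))) x∈))))))) large

      power-pos : ∀ a e → 1 ≤ a → 1 ≤ a ^ e
      power-pos a e p = m^n>0 a {{>-nonZero p}} e

      Ω≥1 : 1 ≤ length Ω
      Ω≥1 = ≤-trans (power-pos (length mats) T (≤-trans (power-pos (length (vecs bools H)) H
          (≤-trans (power-pos 2 H (s≤s z≤n)) (≤-reflexive (sym (length-vecs bools H)))))
          (≤-reflexive (sym (length-vecs (vecs bools H) H))))) (≤-reflexive (sym (length-vecs mats T)))

      length-es : length es ≡ T * suc (suc D)
      length-es = trans (length-product _,_ (upTo T) (upTo (suc (suc D)))) (cong₂ _*_ (length-upTo T) (length-upTo (suc (suc D))))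

    private
      avoids-bad : ∀ ω → (∀ {x S} → x ∈ es → S ∈ subsets m (proj₂ x) → ⌊ full? x S ω ⌋ ≡ false) → Independent D ω
      avoids-bad ω good e S e<T S≤ avoid zS with subsets-complete S
      ... | S′ , S′∈ , S′≗S with z ω (upper {T} e S) ≟W W.𝟘
      ...   | yes p = p
      ...   | no up≢ = contradiction (good {e , ∣ S ∣} {S′} (∈-cartesianProduct⁺ (∈-upTo⁺ (≤-trans (n≤1+n _) e<T)) (∈-upTo⁺ (s≤s S≤))) S′∈)
                 (is-bad (full? (e , ∣ S ∣) S′ ω))
        where
        isFull : Full (e , ∣ S ∣) S′ ω
        isFull = (e<T , λ t st → avoid t (trans (sym (S′≗S t)) st)) ,
          (trans (W.⨁-cong S′≗S (λ _ → refl)) zS ,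
           λ up → up≢ (trans (W.⨁-cong (λ t → cong (_∧ (suc e <ᵇ blk {T} t)) (sym (S′≗S t))) (λ _ → refl)) up))
        is-bad : ∀ (d : Dec (Full (e , ∣ S ∣) S′ ω)) → ⌊ d ⌋ ≢ false
        is-bad (yes _) ()
        is-bad (no ¬p) _ = ¬p isFull

      avoiding : ∃ λ ω → ∀ {x S} → x ∈ es → S ∈ subsets m (proj₂ x) → ⌊ full? x S ω ⌋ ≡ false
      avoiding = union-bound Ω es (λ x → subsets m (proj₂ x)) (λ x S ω → ⌊ full? x S ω ⌋)
        (λ x → m ^ proj₂ x) (λ _ → 2 ^ H) (λ _ → 1) (suc (T * suc (suc D)))
        (λ {x} _ → length-subsets m (proj₂ x)) (λ {x} {S} _ _ → rare x S) small (λ _ → power-pos 2 H (s≤s z≤n))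
        (s≤s (≤-reflexive length-es)) Ω≥1

    independent-exists : Σ (Vec Mat T) (Independent D)
    independent-exists = proj₁ avoiding , avoids-bad (proj₁ avoiding) (proj₂ avoiding)

  -- Three-term sums that compute the recurrence

  entry : Mat → Fin H → Fin H → Bool
  entry A j I = lookup (lookup A j) I

  module _ (C : Columns H) where

    open Columns C

    -- The entry I of Y_{i+2} is the last partial sum of row I in block i. This lemma sees that
    -- entry as the second half of the coordinates of the next block, `pull-pull-right` as the first
    -- half two blocks later.
    pull-left : ∀ A I → pull A (V.𝟘 , unit I) ≡ loc A I last
    pull-left A I = cong (unit I ,_) (trans (V.𝟘-⊕ _) (trans (row*-unit I A) (sym (at-last _))))

    pull-pull-right : ∀ A A′ j → pull A (pull A′ (unit j , V.𝟘)) ≡ loc A j last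
    pull-pull-right A A′ j = trans (cong (pull A) (cong (V.𝟘 ,_) (trans (cong (unit j V.⊕_) (row*-𝟘 A′)) (V.⊕-𝟘 _)))) (pull-left A j)

    private
      ·-right : ∀ κ (y : Carrier V) → (V.𝟘 , κ V.· y) ≡ κ W.· (V.𝟘 , y)
      ·-right true y = refl
      ·-right false y = refl

      pull-comb : ∀ A x κ y → pull A (x W.⊕ (κ W.· y)) ≡ pull A x W.⊕ (κ W.· pull A y)
      pull-comb A x κ y = trans (Additive.additive (pull-additive A) x (κ W.· y)) (cong (pull A x W.⊕_) (Additive.additive-· (pull-additive A) κ y))

    loc-first : ∀ A j {I} → pred I ≡ nothing → loc A j I ≡ (unit j , V.𝟘) W.⊕ (entry A j I W.· (V.𝟘 , unit I))
    loc-first A j {I} e = trans (cong₂ _,_ (sym (V.⊕-𝟘 (unit j))) (trans (at-first (lookup A j) e) (sym (V.𝟘-⊕ _))))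
      (cong ((unit j , V.𝟘) W.⊕_) (·-right (entry A j I) (unit I)))

    loc-next : ∀ A j {I I′} → pred I ≡ just I′ → loc A j I ≡ loc A j I′ W.⊕ (entry A j I W.· (V.𝟘 , unit I))
    loc-next A j {I} {I′} e = trans (cong₂ _,_ (sym (V.⊕-𝟘 (unit j))) (at-next (lookup A j) e))
      (cong (loc A j I′ W.⊕_) (·-right (entry A j I) (unit I)))

    vecAt-first : ∀ {T} (ω : Vec Mat (suc (suc T))) (i : Fin T) j {I} → pred I ≡ nothing → vecAt ω (suc (suc i)) j I ≡
      vecAt ω (inject₁ (inject₁ i)) j last W.⊕
      (entry (lookup ω (suc (suc i))) j I W.· vecAt ω (inject₁ (suc i)) I last)
    vecAt-first (A₀ ∷ A₁ ∷ A₂ ∷ ω) zero j {I} e = begin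
      pull A₀ (pull A₁ (loc A₂ j I))
        ≡⟨ cong (λ z → pull A₀ (pull A₁ z)) (loc-first A₂ j e) ⟩
      pull A₀ (pull A₁ ((unit j , V.𝟘) W.⊕ (κ W.· (V.𝟘 , unit I))))
        ≡⟨ cong (pull A₀) (pull-comb A₁ (unit j , V.𝟘) κ (V.𝟘 , unit I)) ⟩
      pull A₀ (pull A₁ (unit j , V.𝟘) W.⊕ (κ W.· pull A₁ (V.𝟘 , unit I)))
        ≡⟨ pull-comb A₀ _ κ (pull A₁ (V.𝟘 , unit I)) ⟩
      pull A₀ (pull A₁ (unit j , V.𝟘)) W.⊕ (κ W.· pull A₀ (pull A₁ (V.𝟘 , unit I)))
        ≡⟨ cong₂ (λ x y → x W.⊕ (κ W.· pull A₀ y)) (pull-pull-right A₀ A₁ j) (pull-left A₁ I) ⟩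
      loc A₀ j last W.⊕ (κ W.· pull A₀ (loc A₁ I last)) ∎
      where
      open ≡-Reasoning
      κ = entry A₂ j I
    vecAt-first (A ∷ ω@(_ ∷ _ ∷ _)) (suc i) j {I} e = trans (cong (pull A) (vecAt-first ω i j e))
      (pull-comb A _ (entry (lookup ω (suc (suc i))) j I) (vecAt ω (inject₁ (suc i)) I last))

    vecAt-next : ∀ {T} (ω : Vec Mat (suc (suc T))) (i : Fin T) j {I I′} → pred I ≡ just I′ → vecAt ω (suc (suc i)) j I ≡
      vecAt ω (suc (suc i)) j I′ W.⊕
      (entry (lookup ω (suc (suc i))) j I W.· vecAt ω (inject₁ (suc i)) I last)
    vecAt-next (A₀ ∷ A₁ ∷ A₂ ∷ ω) zero j {I} {I′} e = begin
      pull A₀ (pull A₁ (loc A₂ j I))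
        ≡⟨ cong (λ z → pull A₀ (pull A₁ z)) (loc-next A₂ j e) ⟩
      pull A₀ (pull A₁ (loc A₂ j I′ W.⊕ (κ W.· (V.𝟘 , unit I))))
        ≡⟨ cong (pull A₀) (pull-comb A₁ (loc A₂ j I′) κ (V.𝟘 , unit I)) ⟩
      pull A₀ (pull A₁ (loc A₂ j I′) W.⊕ (κ W.· pull A₁ (V.𝟘 , unit I)))
        ≡⟨ pull-comb A₀ _ κ (pull A₁ (V.𝟘 , unit I)) ⟩
      pull A₀ (pull A₁ (loc A₂ j I′)) W.⊕ (κ W.· pull A₀ (pull A₁ (V.𝟘 , unit I)))
        ≡⟨ cong (λ y → pull A₀ (pull A₁ (loc A₂ j I′)) W.⊕ (κ W.· pull A₀ y)) (pull-left A₁ I) ⟩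
      pull A₀ (pull A₁ (loc A₂ j I′)) W.⊕ (κ W.· pull A₀ (loc A₁ I last)) ∎
      where
      open ≡-Reasoning
      κ = entry A₂ j I
    vecAt-next (A ∷ ω@(_ ∷ _ ∷ _)) (suc i) j {I} {I′} e = trans (cong (pull A) (vecAt-next ω i j e))
      (pull-comb A _ (entry (lookup ω (suc (suc i))) j I) (vecAt ω (inject₁ (suc i)) I last))

    -- The last node of row j in block i carries the entry j of Y_{i+2}. Hence row j of block i + 2
    -- starts from that node and adds multiples of the entries of Y_{i+3}, which are the last nodes
    -- of block i + 1. The first two blocks have no such predecessors and are initialised.
    ruleAt : ∀ {T} → Vec Mat T → Fin T → Fin H → Fin H → Rule (T * ℓ)
    ruleAt ω zero j I = init
    ruleAt ω (suc zero) j I = init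
    ruleAt ω (suc (suc i)) j I = sum (entry (lookup ω (suc (suc i))) j I) (start (pred I)) (node (inject₁ (suc i)) I last)
      where
      start : Maybe (Fin H) → Fin _
      start nothing = node (inject₁ (inject₁ i)) j last
      start (just I′) = node (suc (suc i)) j I′

    rule : ∀ {T} → Vec Mat T → Fin (T * ℓ) → Rule (T * ℓ)
    rule {T} ω t = ruleAt ω (block {T} t) (proj₁ (pos {T} t)) (proj₂ (pos {T} t))

    rule-node : ∀ {T} (ω : Vec Mat T) i j I → rule ω (node i j I) ≡ ruleAt ω i j I
    rule-node ω i j I = cong₂ (λ i p → ruleAt ω i (proj₁ p) (proj₂ p)) (block-node i j I) (pos-node i j I)

    blk-node : ∀ {T} (i : Fin T) j I → blk {T} (node i j I) ≡ toℕ i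
    blk-node i j I = cong toℕ (block-node i j I)

    -- The distance of at most two blocks is what prevents a rule from jumping over a gap of two
    -- blocks.
    Sound : ∀ {T} → Vec Mat T → Fin (T * ℓ) → Rule (T * ℓ) → Set
    Sound {T} ω t init = blk {T} t ≤ 1
    Sound {T} ω t (sum κ a b) = (vec ω t ≡ vec ω a W.⊕ (κ W.· vec ω b)) ×
      (blk {T} a ≤ blk {T} t × blk {T} t ≤ 2 + blk {T} a) × (blk {T} b ≤ blk {T} t × blk {T} t ≤ 2 + blk {T} b)

    private
      near : ∀ {x x′ y y′} → x ≡ x′ → y ≡ y′ → x′ ≤ y′ → y′ ≤ 2 + x′ → x ≤ y × y ≤ 2 + x
      near refl refl p q = p , q

      inj-eq : ∀ {T} (i : Fin T) → toℕ (inject₁ (suc i)) ≡ suc (toℕ i)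
      inj-eq i = Fin.toℕ-inject₁ (suc i)

      inj²-eq : ∀ {T} (i : Fin T) → toℕ (inject₁ (inject₁ i)) ≡ toℕ i
      inj²-eq i = trans (Fin.toℕ-inject₁ (inject₁ i)) (Fin.toℕ-inject₁ i)

    ruleAt-sound : ∀ {T} (ω : Vec Mat T) i j I → Sound ω (node i j I) (ruleAt ω i j I)
    ruleAt-sound ω zero j I = ≤-trans (≤-reflexive (blk-node zero j I)) z≤n
    ruleAt-sound ω (suc zero) j I = ≤-reflexive (blk-node (suc zero) j I)
    ruleAt-sound ω (suc (suc i)) j I with pred I in e
    ... | nothing = trans (vec-node ω (suc (suc i)) j I) (trans (vecAt-first ω i j e)
            (sym (cong₂ (λ x y → x W.⊕ (entry (lookup ω (suc (suc i))) j I W.· y)) (vec-node ω (inject₁ (inject₁ i)) j last) (vec-node ω (inject₁ (suc i)) I last)))) ,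
          near (trans (blk-node (inject₁ (inject₁ i)) j last) (inj²-eq i)) (blk-node (suc (suc i)) j I) (m≤n+m _ 2) ≤-refl ,
          near (trans (blk-node (inject₁ (suc i)) I last) (inj-eq i)) (blk-node (suc (suc i)) j I) (n≤1+n _) (n≤1+n _)
    ... | just I′ = trans (vec-node ω (suc (suc i)) j I) (trans (vecAt-next ω i j e)
            (sym (cong₂ (λ x y → x W.⊕ (entry (lookup ω (suc (suc i))) j I W.· y)) (vec-node ω (suc (suc i)) j I′) (vec-node ω (inject₁ (suc i)) I last)))) ,
          near (blk-node (suc (suc i)) j I′) (blk-node (suc (suc i)) j I) ≤-refl (m≤n+m _ 2) ,
          near (trans (blk-node (inject₁ (suc i)) I last) (inj-eq i)) (blk-node (suc (suc i)) j I) (n≤1+n _) (n≤1+n _)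

    rule-sound : ∀ {T} (ω : Vec Mat T) t → Sound ω t (rule ω t)
    rule-sound {T} ω t = subst (λ u → Sound ω u (rule ω t)) (is-node {T} t) (ruleAt-sound ω (block {T} t) _ _)

    private
      -- Induction along the row, inside the induction over blocks. `y` is fuel above the column
      -- index, since `pred` is only known to decrease it.
      derivable-row : ∀ {T} (ω : Vec Mat (suc (suc T))) (i : Fin T) →
        (∀ i′ → toℕ i′ < suc (suc (toℕ i)) → ∀ j → Derivable (rule ω) (node i′ j last)) →
        ∀ y j I → toℕ I < y → Derivable (rule ω) (node (suc (suc i)) j I)
      derivable-row ω i earlier (suc y) j I q with pred I in e | rule-node ω (suc (suc i)) j I
      ... | nothing | r = by-sum r
            (earlier (inject₁ (inject₁ i)) (≤-trans (≤-reflexive (cong suc (inj²-eq i))) (n≤1+n _)) j)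
            (earlier (inject₁ (suc i)) (≤-reflexive (cong suc (inj-eq i))) I)
      ... | just I′ | r = by-sum r
            (derivable-row ω i earlier y j I′ (≤-trans (pred-< e) (≤-pred q)))
            (earlier (inject₁ (suc i)) (≤-reflexive (cong suc (inj-eq i))) I)

      derivable-node : ∀ {T} (ω : Vec Mat T) x (i : Fin T) → toℕ i < x → ∀ j I → Derivable (rule ω) (node i j I)
      derivable-node ω x zero p j I = by-init (rule-node ω zero j I)
      derivable-node ω x (suc zero) p j I = by-init (rule-node ω (suc zero) j I)
      derivable-node ω (suc x) (suc (suc i)) (s≤s p) j I =
        derivable-row ω i (λ i′ q j′ → derivable-node ω x i′ (≤-trans q p) j′ last) H j I (Fin.toℕ<n I)

    derivable : ∀ {T} (ω : Vec Mat T) t → Derivable (rule ω) t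
    derivable {T} ω t = subst (Derivable (rule ω)) (is-node {T} t)
      (derivable-node ω T (block {T} t) (Fin.toℕ<n (block {T} t)) (proj₁ (pos {T} t)) (proj₂ (pos {T} t)))

-- Duplicator's invariant

fresh : (L : List ℕ) → Σ ℕ λ j → j ≤ length L × j ∉ L
fresh L with Fin.any? (λ (j : Fin (suc (length L))) → ¬? (any? (toℕ j ℕ.≟_) L))
... | yes (j , j∉) = toℕ j , ≤-pred (Fin.toℕ<n j) , j∉
... | no none = contradiction (Fin.pigeonhole (n<1+n (length L)) (λ j → index (found j))) clash
  where
  found : ∀ (j : Fin (suc (length L))) → toℕ j ∈ L
  found j with any? (toℕ j ℕ.≟_) L
  ... | yes p = p
  ... | no p = contradiction (j , p) none
  clash : ¬ (Σ _ λ i → Σ _ λ j → i Fin.< j × index (found i) ≡ index (found j))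
  clash (i , j , i<j , e) = <⇒≢ i<j (trans (lookup-index (found i))
    (trans (cong (List.lookup L) e) (sym (lookup-index (found j)))))

⨁-true : ∀ {m} (f : Fin m → Bool) → F₂.⨁ (λ _ → true) f ≡ true → ∃ λ i → f i ≡ true
⨁-true {suc m} f e with f zero in f0
... | true = zero , f0
... | false with ⨁-true (f ∘ suc) e
...   | i , p = suc i , p

val-toggle : ∀ {Δ N m} (h : Fin m → Fin Δ → Fin N) p v S → val h (toggle v p) S ≡ val h p S xor par h S v
val-toggle h p v S = trans (F₂.⨁-cong {S = S} (λ _ → refl) (λ t → F₂.⨁-⊕ (λ _ → true) (λ i → p (h t i)) (λ i → ⁅ v ⁆ (h t i))))
  (F₂.⨁-⊕ S (nodeSum h p) (nodeSum h ⁅ v ⁆))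

-- What the game uses of the two random objects: `expanding` for the condensation, `independent` and
-- `sum-blk` for the gaps. `vec` gives the linear form of a node in the first two vectors of the
-- recurrence.
record System (D : ℕ) : Set₁ where
  field
    {m N Δ}     : ℕ
    h           : Fin m → Fin Δ → Fin N
    expanding   : Expanding D h
    W           : F₂Module
    _≟W_        : (x y : Carrier W) → Dec (x ≡ y)
    vec         : Fin m → Carrier W
    blk         : Fin m → ℕ
    rule        : Fin m → Rule m
    target      : Fin m
    derivable   : Derivable rule target
    target≢𝟘    : vec target ≢ F₂Module.𝟘 W

  module W = F₂Module W

  top : ℕ
  top = blk target

  z : (Fin m → Bool) → Carrier W
  z S = W.⨁ S vec

  Avoids : ℕ → (Fin m → Bool) → Set
  Avoids e S = ∀ t → S t ≡ true → blk t ≢ e × blk t ≢ suc e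

  upper : ℕ → (Fin m → Bool) → Fin m → Bool
  upper e S t = S t ∧ (suc e <ᵇ blk t)

  field
    independent : ∀ e S → suc e ≤ top → ∣ S ∣ ≤ suc D → Avoids e S → z S ≡ W.𝟘 → z (upper e S) ≡ W.𝟘
    init-blk    : ∀ {t} → rule t ≡ init → blk t ≤ 1
    sum-vec     : ∀ {t κ a b} → rule t ≡ sum κ a b → vec t ≡ vec a W.⊕ (κ W.· vec b)
    sum-blk     : ∀ {t κ a b} → rule t ≡ sum κ a b →
                  (blk a ≤ blk t × blk t ≤ 2 + blk a) × (blk b ≤ blk t × blk t ≤ 2 + blk b)

module Invariant {D : ℕ} (𝒮 : System D) where
  open System 𝒮

  -- The sets of nodes whose joint value is determined by the variables in X.
  Local : List (Fin N) → (Fin m → Bool) → Set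
  Local X S = ∣ S ∣ ≤ D × (∀ v → par h S v ≡ true → v ∈ X)

  -- The nodes before the gap e , e + 1 are treated as 0, those after it as part of a trajectory on which
  -- the target is 1: whatever this determines on the local sets must hold for p.
  record Safe (e : ℕ) (X : List (Fin N)) (p : Fin N → Bool) : Set where
    field
      gap   : ∀ S → Local X S → Avoids e S
      value : ∀ ε S → Local X S → z (upper e S) ≡ ε W.· vec target → val h p S ≡ ε

  open Safe

  _∈?_ : (v : Fin N) (X : List (Fin N)) → Dec (v ∈ X)
  v ∈? X = any? (v Fin.≟_) X

  local? : ∀ X S → Dec (Local X S)
  local? X S = (∣ S ∣ ℕ.≤? D) ×-dec Fin.all? (λ v → (par h S v Bool.≟ true) →-dec (v ∈? X))

  local-resp : ∀ {X S S′} → S ≗ S′ → Local X S → Local X S′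
  local-resp e (small , cov) = ≤-trans (≤-reflexive (sym (∣∣-cong e))) small ,
    λ v q → cov v (trans (F₂.⨁-cong e (λ _ → refl)) q)

  local-mono : ∀ {X Y S} → (∀ {v} → v ∈ X → v ∈ Y) → Local X S → Local Y S
  local-mono sub (small , cov) = small , λ v q → sub (cov v q)

  safe-mono : ∀ {e X Y p} → (∀ {v} → v ∈ X → v ∈ Y) → Safe e Y p → Safe e X p
  safe-mono sub s = record { gap = λ S l → gap s S (local-mono sub l) ; value = λ ε S l → value s ε S (local-mono sub l) }

  local-drop : ∀ {v X S} → Local (v ∷ X) S → par h S v ≡ false → Local X S
  local-drop {v} {X} {S} (small , cov) odd = small , cov′
    where
    cov′ : ∀ u → par h S u ≡ true → u ∈ X
    cov′ u q with cov u q
    ... | there u∈ = u∈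
    ... | here refl = contradiction (trans (sym odd) q) false≢true

  -- By expansion, the local sets form a vector space.
  local-△ : ∀ {v X S S′} → length X ≤ D → Local (v ∷ X) S → Local (v ∷ X) S′ →
            par h S v ≡ true → par h S′ v ≡ true → Local X (S △ S′)
  local-△ {v} {X} {S} {S′} X≤ (S≤ , cov) (S′≤ , cov′) q q′ =
    ≤-trans (expanding (S △ S′) X (≤-trans (∣∣-△ S S′) (+-mono-≤ S≤ S′≤)) inside) X≤ , inside
    where
    split : ∀ u → par h (S △ S′) u ≡ par h S u xor par h S′ u
    split u = F₂.⨁-△ S S′ _
    tail : ∀ {u} → u ≢ v → u ∈ v ∷ X → u ∈ X
    tail u≢v (here e) = contradiction e u≢v
    tail u≢v (there u∈) = u∈
    inside : ∀ u → par h (S △ S′) u ≡ true → u ∈ X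
    inside u r with u Fin.≟ v
    ... | yes refl = contradiction (trans (sym (cong₂ _xor_ q q′)) (trans (sym (split u)) r)) false≢true
    ... | no u≢v with par h S u in pu | par h S′ u in pu′
    ...   | true | _ = tail u≢v (cov u pu)
    ...   | false | true = tail u≢v (cov′ u pu′)
    ...   | false | false = contradiction (trans (sym (cong₂ _xor_ pu pu′)) (trans (sym (split u)) r)) false≢true

  -- Gaussian elimination over the variables of `X`: among the local sets in which `v` occurs oddly
  -- fix one, `S₀`; any other differs from it by a set local to the remaining variables. So each
  -- variable adds at most the D nodes of one basis set. With no variables, expansion leaves only
  -- the empty set.
  cover : ∀ X → length X ≤ D → Σ (List (Fin m)) λ K → length K ≤ length X * D ×
          (∀ S → Local X S → ∀ t → S t ≡ true → t ∈ K)
  cover [] X≤ = [] , z≤n , λ S (S≤ , cov) t st → contradiction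
    (trans (sym (∣∣≡0 S (n≤0⇒n≡0 (expanding S [] (≤-trans S≤ (m≤m+n D D)) cov)) t)) st) false≢true
  cover (v ∷ X) X≤ with cover X (≤-trans (n≤1+n _) X≤)
    | anySubset? {P = λ S → Local (v ∷ X) S × par h S v ≡ true}
        (λ e (l , q) → local-resp e l , trans (sym (F₂.⨁-cong e (λ _ → refl))) q)
        (λ S → local? (v ∷ X) S ×-dec (par h S v Bool.≟ true))
  ... | K , K≤ , cov | no none = K , ≤-trans K≤ (m≤n+m _ D) , λ S l t st → cov S (local-drop l (even S l)) t st
    where
    even : ∀ S → Local (v ∷ X) S → par h S v ≡ false
    even S l with par h S v in q
    ... | false = refl
    ... | true = contradiction (S , l , q) none
  ... | K , K≤ , cov | yes (S₀ , l₀ , q₀) with elements S₀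
  ...   | ys , len , mem = ys ++ K ,
          ≤-trans (≤-reflexive (length-++ ys)) (+-mono-≤ (≤-trans (≤-reflexive len) (proj₁ l₀)) K≤) , cov′
    where
    cov′ : ∀ S → Local (v ∷ X) S → ∀ t → S t ≡ true → t ∈ ys ++ K
    cov′ S l t st with par h S v in q
    ... | false = ∈-++⁺ʳ ys (cov S (local-drop l q) t st)
    ... | true with S₀ t in s₀t
    ...   | true = ∈-++⁺ˡ (mem t s₀t)
    ...   | false = ∈-++⁺ʳ ys (cov (S △ S₀) (local-△ (≤-trans (n≤1+n _) X≤) l l₀ q q₀) t (cong₂ _xor_ st s₀t))

  -- Duplicator retreats by at most this many blocks per round.
  step : ℕ
  step = D * D + D * D

  -- The windows e - 2j , e - 2j + 1 for j ≤ D^2 are disjoint, and a node can lie only in the one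
  -- with j = ⌊(e + 1 - blk) / 2⌋. The cover has at most D^2 nodes, so one of the D^2 + 1 windows is
  -- free.
  gap-exists : ∀ e X → length X ≤ D → step ≤ e →
    Σ ℕ λ e′ → e′ ≤ e × e ≤ e′ + step × (∀ S → Local X S → Avoids e′ S)
  gap-exists e X X≤ step≤e with cover X X≤
  ... | K , K≤ , cov with fresh (map (λ t → ⌊ suc e ∸ blk t /2⌋) K)
  ...   | j , j≤ , j∉ = e ∸ (j + j) , m∸n≤m e (j + j) ,
            ≤-trans (≤-reflexive (sym (m∸n+n≡m jj≤e))) (+-monoʳ-≤ (e ∸ (j + j)) jj≤step) , avoid
    where
    j≤D² : j ≤ D * D
    j≤D² = ≤-trans j≤ (≤-trans (≤-reflexive (length-map _ K)) (≤-trans K≤ (*-monoˡ-≤ D X≤)))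
    jj≤step : j + j ≤ step
    jj≤step = +-mono-≤ j≤D² j≤D²
    jj≤e : j + j ≤ e
    jj≤e = ≤-trans jj≤step step≤e
    avoid : ∀ S → Local X S → Avoids (e ∸ (j + j)) S
    avoid S l t st = low , high
      where
      hit : ⌊ suc e ∸ blk t /2⌋ ≢ j
      hit q = j∉ (subst (_∈ _) q (∈-map⁺ (λ t → ⌊ suc e ∸ blk t /2⌋) (cov S l t st)))
      low : blk t ≢ e ∸ (j + j)
      low q = hit (trans (cong (λ b → ⌊ suc e ∸ b /2⌋) q) (trans (cong ⌊_/2⌋
        (trans (+-∸-assoc 1 (m∸n≤m e (j + j))) (cong suc (m∸[m∸n]≡n jj≤e)))) (sym (n≡⌈n+n/2⌉ j))))
      high : blk t ≢ suc (e ∸ (j + j))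
      high q = hit (trans (cong (λ b → ⌊ suc e ∸ b /2⌋) q) (trans (cong ⌊_/2⌋ (m∸[m∸n]≡n jj≤e)) (sym (n≡⌊n+n/2⌋ j))))

  <ᵇ-true : ∀ {a b} → a < b → (a <ᵇ b) ≡ true
  <ᵇ-true a<b = T⇒≡ (<⇒<ᵇ a<b)

  <ᵇ-false : ∀ {a b} → b ≤ a → (a <ᵇ b) ≡ false
  <ᵇ-false {a} {b} b≤a with a <ᵇ b in q
  ... | false = refl
  ... | true = contradiction (<ᵇ⇒< a b (Equivalence.from T-≡ q)) (≤⇒≯ b≤a)

  -- Independence across the gap at e lets the break move down from e to e′.
  value-lower : ∀ {e e′ X p} → Safe e X p → suc (suc e) ≤ top → e′ ≤ e →
    ∀ ε S → Local X S → z (upper e′ S) ≡ ε W.· vec target → val h p S ≡ ε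
  value-lower {e} {e′} {X} {p} safe e<top e′≤e ε S l zS = value safe ε S l (W.⊕≡𝟘 (begin
    z (upper e S) W.⊕ (ε W.· vec target)           ≡⟨ cong (z (upper e S) W.⊕_) (sym zε) ⟩
    z (upper e S) W.⊕ z εM                         ≡⟨ sym (W.⨁-△ (upper e S) εM vec) ⟩
    z (upper e S △ εM)                             ≡⟨ W.⨁-cong (λ t → sym (upper-S₁ t)) (λ _ → refl) ⟩
    z (upper e S₁)                                 ≡⟨ independent e S₁ (≤-trans (n≤1+n _) e<top) S₁≤ avoid zS₁ ⟩
    W.𝟘                                            ∎))
    where
    open ≡-Reasoning
    εM : Fin m → Bool
    εM t = ε ∧ ⁅ target ⁆ t
    zε : z εM ≡ ε W.· vec target
    zε = go ε
      where
      go : ∀ ε → z (λ t → ε ∧ ⁅ target ⁆ t) ≡ ε W.· vec target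
      go true = ⨁-⁅⁆ W target vec
      go false = W.⨁-∅ (λ _ → false) vec (λ _ → refl)
    -- The hypothesis on `S` is rewritten as a vanishing sum over `S₁`, whose nodes avoid the old
    -- gap. Independence makes the part after the old gap vanish separately, and this is the
    -- hypothesis under which `safe` fixes the value.
    S₁ : Fin m → Bool
    S₁ = upper e′ S △ εM
    zS₁ : z S₁ ≡ W.𝟘
    zS₁ = trans (W.⨁-△ (upper e′ S) εM vec) (trans (cong₂ W._⊕_ zS zε) (W.⊕-self _))
    ∧-proj₁ : ∀ {a b} → a ∧ b ≡ true → a ≡ true
    ∧-proj₁ {true} _ = refl
    ∧-proj₂ : ∀ {a b} → a ∧ b ≡ true → b ≡ true
    ∧-proj₂ {true} q = q
    S₁≤ : ∣ S₁ ∣ ≤ suc D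
    S₁≤ = ≤-trans (∣∣-△ (upper e′ S) εM) (≤-trans (+-mono-≤
      (≤-trans (∣∣-mono {S = upper e′ S} {S} (λ t → ∧-proj₁)) (proj₁ l))
      (≤-trans (∣∣-mono {S = εM} {⁅ target ⁆} (λ t → ∧-proj₂ {ε})) (≤-reflexive (∣⁅⁆∣ target)))) (≤-reflexive (+-comm D 1)))
    avoid : Avoids e S₁
    avoid t q with upper e′ S t in ut
    ... | true = gap safe S l t (∧-proj₁ ut)
    ... | false rewrite ⁅⁆-≡ target t (∧-proj₂ {ε} q) =
      (λ r → <⇒≢ (≤-trans (n≤1+n _) e<top) (sym r)) , (λ r → <⇒≢ e<top (sym r))
    upper-S₁ : ∀ t → upper e S₁ t ≡ (upper e S △ εM) t
    upper-S₁ t with t Fin.≟ target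
    ... | yes refl rewrite <ᵇ-true e<top | <ᵇ-true (≤-trans (s≤s (s≤s e′≤e)) e<top) = ∧-identityʳ _
    ... | no _ rewrite ∧-zeroʳ ε = trans (cong (_∧ (suc e <ᵇ blk t)) (xor-identityʳ _)) (trans (go (S t)) (sym (xor-identityʳ _)))
      where
      go : ∀ s → (s ∧ (suc e′ <ᵇ blk t)) ∧ (suc e <ᵇ blk t) ≡ s ∧ (suc e <ᵇ blk t)
      go false = refl
      go true with suc e <ᵇ blk t in q
      ... | false = ∧-zeroʳ _
      ... | true rewrite <ᵇ-true (≤-trans (s≤s (s≤s e′≤e)) (<ᵇ⇒< (suc e) (blk t) (Equivalence.from T-≡ q))) = refl

  module Extension {e : ℕ} {X : List (Fin N)} {p : Fin N → Bool} (safe : Safe e X p)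
      (e<top : suc (suc e) ≤ top) (e′ : ℕ) (e′≤e : e′ ≤ e) (v : Fin N) (v∉X : v ∉ X) (vX≤ : length (v ∷ X) ≤ D) where
    -- The sets whose value the new invariant prescribes and which change value when `v` is toggled.
    -- If there is one, it determines by `β` whether `v` has to be toggled; if there is none, the
    -- value at `v` is free.
    Forcing : (Fin m → Bool) → Set
    Forcing S = (Local (v ∷ X) S × par h S v ≡ true) × (z (upper e′ S) ≡ vec target ⊎ z (upper e′ S) ≡ W.𝟘)
    z-resp : ∀ {S S′} → S ≗ S′ → z (upper e′ S) ≡ z (upper e′ S′)
    z-resp q = W.⨁-cong (λ t → cong (_∧ (suc e′ <ᵇ blk t)) (q t)) (λ _ → refl)
    forcing-resp : ∀ {S S′} → S ≗ S′ → Forcing S → Forcing S′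
    forcing-resp q ((l , o) , inj₁ r) = (local-resp q l , trans (sym (F₂.⨁-cong q (λ _ → refl))) o) , inj₁ (trans (sym (z-resp q)) r)
    forcing-resp q ((l , o) , inj₂ r) = (local-resp q l , trans (sym (F₂.⨁-cong q (λ _ → refl))) o) , inj₂ (trans (sym (z-resp q)) r)
    forcing? : Dec (∃ Forcing)
    forcing? = anySubset? forcing-resp (λ S → (local? (v ∷ X) S ×-dec (par h S v Bool.≟ true))
      ×-dec ((z (upper e′ S) ≟W vec target) ⊎-dec (z (upper e′ S) ≟W W.𝟘)))
    β-of : Dec (∃ Forcing) → Bool
    β-of (yes (S₀ , _ , inj₁ _)) = val h p S₀ xor true
    β-of (yes (S₀ , _ , inj₂ _)) = val h p S₀ xor false
    β-of (no _) = false
    β : Bool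
    β = β-of forcing?
    p′ : Fin N → Bool
    p′ = if β then toggle v p else p
    agree : ∀ u → u ∈ X → p′ u ≡ p u
    agree u u∈ with β
    ... | false = refl
    ... | true = trans (cong (p u xor_) (⁅⁆-≢ v u (λ { refl → v∉X u∈ }))) (xor-identityʳ (p u))
    X≤ : length X ≤ D
    X≤ = ≤-trans (n≤1+n _) vX≤
    val-p′ : ∀ S → val h p′ S ≡ val h p S xor (β ∧ par h S v)
    val-p′ S with β
    ... | true = val-toggle h p v S
    ... | false = sym (xor-identityʳ _)
    -- Forcing sets never conflict: `v` cancels in the symmetric difference of two of them, which is
    -- therefore local to `X`, where the old invariant already fixes the value. Repairing `S₀` thus
    -- repairs every `S`.
    forced : ∀ ε₀ S₀ ε S → (Local (v ∷ X) S₀ × par h S₀ v ≡ true) → z (upper e′ S₀) ≡ ε₀ W.· vec target →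
      Local (v ∷ X) S → par h S v ≡ true → z (upper e′ S) ≡ ε W.· vec target →
      val h p S xor (val h p S₀ xor ε₀) ≡ ε
    forced ε₀ S₀ ε S (l₀ , o₀) z₀ l o zS = begin
      val h p S xor (val h p S₀ xor ε₀)    ≡⟨ sym (xor-assoc (val h p S) _ _) ⟩
      (val h p S xor val h p S₀) xor ε₀    ≡⟨ cong (_xor ε₀) (sym (F₂.⨁-△ S S₀ (nodeSum h p))) ⟩
      val h p (S △ S₀) xor ε₀              ≡⟨ cong (_xor ε₀) (value-lower safe e<top e′≤e (ε xor ε₀) (S △ S₀) (local-△ X≤ l l₀ o o₀) z△) ⟩
      (ε xor ε₀) xor ε₀                    ≡⟨ xor-assoc ε ε₀ ε₀ ⟩
      ε xor (ε₀ xor ε₀)                    ≡⟨ cong (ε xor_) (xor-same ε₀) ⟩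
      ε xor false                          ≡⟨ xor-identityʳ ε ⟩
      ε                                    ∎
      where
      open ≡-Reasoning
      z△ : z (upper e′ (S △ S₀)) ≡ (ε xor ε₀) W.· vec target
      z△ = trans (W.⨁-cong (λ t → ∧-distribʳ-xor (suc e′ <ᵇ blk t) (S t) (S₀ t)) (λ _ → refl)) (trans (W.⨁-△ (upper e′ S) (upper e′ S₀) vec)
        (trans (cong₂ W._⊕_ zS z₀) (sym (W.·-xor ε ε₀ (vec target)))))
    odd-case : ∀ d ε S → Local (v ∷ X) S → par h S v ≡ true → z (upper e′ S) ≡ ε W.· vec target → val h p S xor β-of d ≡ ε
    odd-case (yes (S₀ , lo , inj₁ r)) ε S l o zS = forced true S₀ ε S lo r l o zS
    odd-case (yes (S₀ , lo , inj₂ r)) ε S l o zS = forced false S₀ ε S lo r l o zS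
    odd-case (no none) true S l o zS = contradiction (S , (l , o) , inj₁ zS) none
    odd-case (no none) false S l o zS = contradiction (S , (l , o) , inj₂ zS) none
    value′ : ∀ ε S → Local (v ∷ X) S → z (upper e′ S) ≡ ε W.· vec target → val h p′ S ≡ ε
    value′ ε S l zS = trans (val-p′ S) (by-parity (par h S v) refl)
      where
      by-parity : ∀ b → par h S v ≡ b → val h p S xor (β ∧ b) ≡ ε
      by-parity true o = trans (cong (val h p S xor_) (∧-identityʳ β)) (odd-case forcing? ε S l o zS)
      by-parity false o = trans (cong (val h p S xor_) (∧-zeroʳ β)) (trans (xor-identityʳ _)
        (value-lower safe e<top e′≤e ε S (local-drop l o) zS))

  extend : ∀ {e X p} → Safe e X p → suc (suc e) ≤ top → step ≤ e → ∀ v → length (v ∷ X) ≤ D →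
    Σ ℕ λ e′ → Σ (Fin N → Bool) λ p′ → e′ ≤ e × e ≤ e′ + step × Safe e′ (v ∷ X) p′ × (∀ u → u ∈ X → p′ u ≡ p u)
  extend {e} {X} {p} safe e<top step≤e v vX≤ = go (v ∈? X)
    where
    Goal : Set
    Goal = Σ ℕ λ e′ → Σ (Fin N → Bool) λ p′ → e′ ≤ e × e ≤ e′ + step × Safe e′ (v ∷ X) p′ × (∀ u → u ∈ X → p′ u ≡ p u)
    go : Dec (v ∈ X) → Goal
    go (yes v∈X) = e , p , ≤-refl , m≤m+n e step , safe-mono sub safe , λ _ _ → refl
      where
      sub : ∀ {u} → u ∈ v ∷ X → u ∈ X
      sub (here refl) = v∈X
      sub (there u∈) = u∈
    go (no v∉X) = found (gap-exists e (v ∷ X) vX≤ step≤e)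
      where
      found : (Σ ℕ λ e′ → e′ ≤ e × e ≤ e′ + step × (∀ S → Local (v ∷ X) S → Avoids e′ S)) → Goal
      found (e′ , e′≤e , e≤ , avoid) = e′ , E.p′ , e′≤e , e≤ , record { gap = avoid ; value = E.value′ } , E.agree
        where module E = Extension safe e<top e′ e′≤e v v∉X vX≤

  -- By expansion the only local set is empty. It could be asked to have value 1 only if the target
  -- were the zero form.
  safe-[] : ∀ e p → Safe e [] p
  safe-[] e p = record { gap = λ S l t st → contradiction (trans (sym (empty S l t)) st) false≢true ; value = value′ }
    where
    empty : ∀ S → Local [] S → ∀ t → S t ≡ false
    empty S (S≤ , cov) = ∣∣≡0 S (n≤0⇒n≡0 (expanding S [] (≤-trans S≤ (m≤m+n D D)) cov))
    z-∅ : ∀ S → Local [] S → z (upper e S) ≡ W.𝟘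
    z-∅ S l = W.⨁-∅ (upper e S) vec (λ t → cong (_∧ (suc e <ᵇ blk t)) (empty S l t))
    value′ : ∀ ε S → Local [] S → z (upper e S) ≡ ε W.· vec target → val h p S ≡ ε
    value′ true S l q = contradiction (trans (sym q) (z-∅ S l)) target≢𝟘
    value′ false S l q = F₂.⨁-∅ S _ (empty S l)

  Covers : List (Fin N) → Fin m → Set
  Covers X t = ∀ i → h t i ∈ X

  par-⁅⁆ : ∀ t v → par h ⁅ t ⁆ v ≡ true → ∃ λ i → h t i ≡ v
  par-⁅⁆ t v q with ⨁-true _ (trans (sym (⨁-⁅⁆ F₂ t (nodeSum h ⁅ v ⁆))) q)
  ... | i , r = i , ⁅⁆-≡ v (h t i) r

  val-⁅⁆ : ∀ p t → val h p ⁅ t ⁆ ≡ nodeSum h p t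
  val-⁅⁆ p t = ⨁-⁅⁆ F₂ t (nodeSum h p)

  module _ (D≥3 : 3 ≤ D) {e : ℕ} {X : List (Fin N)} {p : Fin N → Bool} (safe : Safe e X p) where

    par-covered : ∀ {t} → Covers X t → ∀ v → par h ⁅ t ⁆ v ≡ true → v ∈ X
    par-covered {t} c v q with par-⁅⁆ t v q
    ... | i , refl = c i

    local-⁅⁆ : ∀ {t} → Covers X t → Local X ⁅ t ⁆
    local-⁅⁆ {t} c = ≤-trans (≤-reflexive (∣⁅⁆∣ t)) (≤-trans (s≤s z≤n) D≥3) , par-covered c

    gap-⁅⁆ : ∀ {t} → Covers X t → blk t ≢ e × blk t ≢ suc e
    gap-⁅⁆ {t} c = gap safe ⁅ t ⁆ (local-⁅⁆ c) t (⁅⁆-refl t)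

    z-upper-⁅⁆ : ∀ t → z (upper e ⁅ t ⁆) ≡ (suc e <ᵇ blk t) W.· vec t
    z-upper-⁅⁆ t with suc e <ᵇ blk t in q
    ... | true = trans (W.⨁-cong same (λ _ → refl)) (⨁-⁅⁆ W t vec)
      where
      same : ∀ u → upper e ⁅ t ⁆ u ≡ ⁅ t ⁆ u
      same u with u Fin.≟ t
      ... | yes refl = q
      ... | no _ = refl
    ... | false = W.⨁-∅ _ vec none
      where
      none : ∀ u → upper e ⁅ t ⁆ u ≡ false
      none u with u Fin.≟ t
      ... | yes refl = q
      ... | no _ = refl

    -- With `init-value` and `sum-value` this extracts from the invariant what the relations test:
    -- on covered nodes the difference `p` solves the homogeneous rules and yet is 1 at the target.
    target-value : suc (suc e) ≤ top → Covers X target → nodeSum h p target ≡ true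
    target-value e<top c = trans (sym (val-⁅⁆ p target)) (value safe true ⁅ target ⁆ (local-⁅⁆ c)
      (trans (z-upper-⁅⁆ target) (cong (W._· vec target) (<ᵇ-true e<top))))

    init-value : 1 ≤ e → ∀ {t} → rule t ≡ init → Covers X t → nodeSum h p t ≡ false
    init-value e≥1 {t} r c = trans (sym (val-⁅⁆ p t)) (value safe false ⁅ t ⁆ (local-⁅⁆ c)
      (trans (z-upper-⁅⁆ t) (cong (W._· vec t) (<ᵇ-false (≤-trans (init-blk r) (≤-trans e≥1 (n≤1+n e)))))))

    -- A rule cannot straddle the gap, so it lies entirely above or entirely below it.
    side : ∀ {a t} → Covers X a → Covers X t → blk a ≤ blk t → blk t ≤ 2 + blk a → (suc e <ᵇ blk a) ≡ (suc e <ᵇ blk t)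
    side {a} {t} ca ct a≤t t≤a with <-cmp (suc e) (blk a)
    ... | tri< lt _ _ = trans (<ᵇ-true lt) (sym (<ᵇ-true (≤-trans lt a≤t)))
    ... | tri≈ _ q _ = contradiction (sym q) (proj₂ (gap-⁅⁆ ca))
    ... | tri> _ _ gt = trans (<ᵇ-false (≤-trans (n≤1+n _) gt)) (sym (<ᵇ-false t≤e+1))
      where
      a<e : blk a < e
      a<e = ≤∧≢⇒< (≤-pred gt) (proj₁ (gap-⁅⁆ ca))
      t≤e+1 : blk t ≤ suc e
      t≤e+1 = ≤-trans t≤a (s≤s a<e)

    sum-value : ∀ {t κ a b} → rule t ≡ sum κ a b → Covers X t → Covers X a → Covers X b →
      (nodeSum h p t xor nodeSum h p a) xor (κ ∧ nodeSum h p b) ≡ false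
    sum-value {t} {κ} {a} {b} r ct ca cb = trans (sym val-S) (value safe false S (S≤ , covS) zS)
      where
      open ≡-Reasoning
      κb : Fin m → Bool
      κb u = κ ∧ ⁅ b ⁆ u
      -- Symmetric differences, so that coincidences among `t`, `a` and `b` cancel exactly as they
      -- do in the equation.
      S : Fin m → Bool
      S = (⁅ t ⁆ △ ⁅ a ⁆) △ κb
      ⨁-κb : ∀ (M : F₂Module) f → F₂Module.⨁ M κb f ≡ F₂Module._·_ M κ (f b)
      ⨁-κb M f = go κ
        where
        go : ∀ κ → F₂Module.⨁ M (λ u → κ ∧ ⁅ b ⁆ u) f ≡ F₂Module._·_ M κ (f b)
        go true = ⨁-⁅⁆ M b f
        go false = F₂Module.⨁-∅ M (λ _ → false) f (λ _ → refl)
      ⨁-S : ∀ (M : F₂Module) f → F₂Module.⨁ M S f ≡ F₂Module._⊕_ M (F₂Module._⊕_ M (f t) (f a)) (F₂Module._·_ M κ (f b))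
      ⨁-S M f = trans (F₂Module.⨁-△ M (⁅ t ⁆ △ ⁅ a ⁆) κb f) (cong₂ (F₂Module._⊕_ M)
        (trans (F₂Module.⨁-△ M ⁅ t ⁆ ⁅ a ⁆ f) (cong₂ (F₂Module._⊕_ M) (⨁-⁅⁆ M t f) (⨁-⁅⁆ M a f))) (⨁-κb M f))
      ·≡∧ : ∀ k x → F₂Module._·_ F₂ k x ≡ k ∧ x
      ·≡∧ true x = refl
      ·≡∧ false x = refl
      val-S : val h p S ≡ (nodeSum h p t xor nodeSum h p a) xor (κ ∧ nodeSum h p b)
      val-S = trans (⨁-S F₂ (nodeSum h p)) (cong ((nodeSum h p t xor nodeSum h p a) xor_) (·≡∧ κ (nodeSum h p b)))
      S≤ : ∣ S ∣ ≤ D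
      S≤ = ≤-trans (∣∣-△ (⁅ t ⁆ △ ⁅ a ⁆) κb) (≤-trans (+-mono-≤ (≤-trans (∣∣-△ ⁅ t ⁆ ⁅ a ⁆)
        (≤-reflexive (cong₂ _+_ (∣⁅⁆∣ t) (∣⁅⁆∣ a)))) (≤-trans (∣∣-mono {S = κb} {⁅ b ⁆} (λ u → snd κ)) (≤-reflexive (∣⁅⁆∣ b)))) D≥3)
        where
        snd : ∀ k {x} → k ∧ x ≡ true → x ≡ true
        snd true q = q
      covS : ∀ v → par h S v ≡ true → v ∈ X
      covS v q with nodeSum h ⁅ v ⁆ t in qt | nodeSum h ⁅ v ⁆ a in qa | nodeSum h ⁅ v ⁆ b in qb
      ... | true | _ | _ = par-covered ct v (trans (val-⁅⁆ ⁅ v ⁆ t) qt)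
      ... | false | true | _ = par-covered ca v (trans (val-⁅⁆ ⁅ v ⁆ a) qa)
      ... | false | false | true = par-covered cb v (trans (val-⁅⁆ ⁅ v ⁆ b) qb)
      ... | false | false | false = contradiction (trans (sym (trans (⨁-S F₂ (nodeSum h ⁅ v ⁆))
              (trans (cong₂ _xor_ (cong₂ _xor_ qt qa) (cong (F₂Module._·_ F₂ κ) qb)) (F₂.·-𝟘 κ)))) q) false≢true
      -- All three nodes lie on the same side of the gap, so one factor `σ` multiplies the whole
      -- relation among their vectors.
      σ : Bool
      σ = suc e <ᵇ blk t
      side-a : (suc e <ᵇ blk a) ≡ σ
      side-a = side ca ct (proj₁ (proj₁ (sum-blk r))) (proj₂ (proj₁ (sum-blk r)))
      side-b : (suc e <ᵇ blk b) ≡ σ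
      side-b = side cb ct (proj₁ (proj₂ (sum-blk r))) (proj₂ (proj₂ (sum-blk r)))
      weight : Fin m → Carrier W
      weight u = (suc e <ᵇ blk u) W.· vec u
      z-upper : ∀ S → z (upper e S) ≡ W.⨁ S weight
      z-upper S = go S blk vec
        where
        go : ∀ {m} (S : Fin m → Bool) (blk : Fin m → ℕ) (vec : Fin m → Carrier W) →
             W.⨁ (λ u → S u ∧ (suc e <ᵇ blk u)) vec ≡ W.⨁ S (λ u → (suc e <ᵇ blk u) W.· vec u)
        go {zero} S blk vec = refl
        go {suc m} S blk vec = cong₂ W._⊕_ (nest (S zero)) (go (S ∘ suc) (blk ∘ suc) (vec ∘ suc))
          where
          nest : ∀ s → (s ∧ (suc e <ᵇ blk zero)) W.· vec zero ≡ s W.· ((suc e <ᵇ blk zero) W.· vec zero)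
          nest true = refl
          nest false = refl
      zS : z (upper e S) ≡ W.𝟘
      zS = begin
        z (upper e S)                                                    ≡⟨ z-upper S ⟩
        W.⨁ S weight                                                     ≡⟨ ⨁-S W weight ⟩
        (weight t W.⊕ weight a) W.⊕ (κ W.· weight b)
          ≡⟨ cong₂ (λ x y → (weight t W.⊕ (x W.· vec a)) W.⊕ (κ W.· (y W.· vec b))) side-a side-b ⟩
        ((σ W.· vec t) W.⊕ (σ W.· vec a)) W.⊕ (κ W.· (σ W.· vec b))      ≡⟨ collect σ ⟩
        σ W.· ((vec t W.⊕ vec a) W.⊕ (κ W.· vec b))                      ≡⟨ cong (σ W.·_) cancel ⟩
        σ W.· W.𝟘                                                        ≡⟨ W.·-𝟘 σ ⟩
        W.𝟘                                                              ∎
        where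
        collect : ∀ s → ((s W.· vec t) W.⊕ (s W.· vec a)) W.⊕ (κ W.· (s W.· vec b)) ≡ s W.· ((vec t W.⊕ vec a) W.⊕ (κ W.· vec b))
        collect true = refl
        collect false = trans (cong₂ W._⊕_ (W.𝟘-⊕ W.𝟘) (W.·-𝟘 κ)) (W.𝟘-⊕ W.𝟘)
        cancel : (vec t W.⊕ vec a) W.⊕ (κ W.· vec b) ≡ W.𝟘
        cancel = trans (W.⊕-assoc _ _ _) (trans (cong (vec t W.⊕_) (sym (sum-vec r))) (W.⊕-self _))

-- The two structures and the game on them

countFin-+ : ∀ a b (f : Fin (a + b) → Bool) → countFin (a + b) f ≡ countFin a (f ∘ (_↑ˡ b)) + countFin b (f ∘ (a ↑ʳ_))
countFin-+ zero b f = refl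
countFin-+ (suc a) b f = trans (cong (bit (f zero) +_) (countFin-+ a b (f ∘ suc))) (sym (+-assoc (bit (f zero)) _ _))

anyFin-count : ∀ n (f : Fin n → Bool) → anyFin n f ≡ (0 <ᵇ countFin n f)
anyFin-count zero f = refl
anyFin-count (suc n) f with f zero
... | true = refl
... | false = anyFin-count n (f ∘ suc)

count-swap : ∀ n (g : Fin n → Bool → Bool) (p : Fin n → Bool) →
  countFin n (λ v → g v (p v)) + countFin n (λ v → g v (not (p v))) ≡ countFin n (λ v → g v false) + countFin n (λ v → g v true)
count-swap zero g p = refl
count-swap (suc n) g p = trans (+-interchange (bit (g zero (p zero))) _ (bit (g zero (not (p zero)))) _)
  (trans (cong₂ _+_ (head (p zero)) (count-swap n (g ∘ suc) (p ∘ suc)))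
    (+-interchange (bit (g zero false)) (bit (g zero true)) _ _))
  where
  head : ∀ b → bit (g zero b) + bit (g zero (not b)) ≡ bit (g zero false) + bit (g zero true)
  head false = refl
  head true = +-comm (bit (g zero true)) _

upd-same : ∀ {v} {A : Set} (s : Fin v → A) x a → upd s x a x ≡ a
upd-same s x a with x Fin.≟ x
... | yes _ = refl
... | no x≢x = contradiction refl x≢x

upd-other : ∀ {v} {A : Set} (s : Fin v → A) x a y → y ≢ x → upd s x a y ≡ s y
upd-other s x a y y≢x with y Fin.≟ x
... | yes y≡x = contradiction y≡x y≢x
... | no _ = refl

∈-mapMaybe⁺ : ∀ {A B : Set} (f : A → Maybe B) {xs x y} → x ∈ xs → f x ≡ just y → y ∈ mapMaybe f xs
∈-mapMaybe⁺ f {x ∷ xs} (here refl) e with f x | e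
... | just _ | refl = here refl
∈-mapMaybe⁺ f {x ∷ xs} (there p) e with f x
... | just _ = there (∈-mapMaybe⁺ f p e)
... | nothing = ∈-mapMaybe⁺ f p e

∈-mapMaybe⁻ : ∀ {A B : Set} (f : A → Maybe B) {xs y} → y ∈ mapMaybe f xs → ∃ λ x → f x ≡ just y
∈-mapMaybe⁻ f {x ∷ xs} p with f x in e
... | nothing = ∈-mapMaybe⁻ f {xs} p
∈-mapMaybe⁻ f {x ∷ xs} (here refl) | just _ = x , e
∈-mapMaybe⁻ f {x ∷ xs} (there p) | just _ = ∈-mapMaybe⁻ f {xs} p

module Structures {D : ℕ} (𝒮 : System D) (r : ℕ) where
  open System 𝒮
  open Invariant 𝒮

  n : ℕ
  n = N + (N + r)

  -- An element is a variable with a truth value, or one of r padding elements.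
  El : Set
  El = (Fin N × Bool) ⊎ Fin r

  dec : Fin n → El
  dec e with splitAt N e
  ... | inj₁ v = inj₁ (v , false)
  ... | inj₂ e′ with splitAt N e′
  ...   | inj₁ v = inj₁ (v , true)
  ...   | inj₂ x = inj₂ x

  enc : El → Fin n
  enc (inj₁ (v , false)) = v ↑ˡ (N + r)
  enc (inj₁ (v , true)) = N ↑ʳ (v ↑ˡ r)
  enc (inj₂ x) = N ↑ʳ (N ↑ʳ x)

  dec-enc : ∀ x → dec (enc x) ≡ x
  dec-enc (inj₁ (v , false)) rewrite Fin.splitAt-↑ˡ N v (N + r) = refl
  dec-enc (inj₁ (v , true)) rewrite Fin.splitAt-↑ʳ N (N + r) (v ↑ˡ r) | Fin.splitAt-↑ˡ N v r = refl
  dec-enc (inj₂ x) rewrite Fin.splitAt-↑ʳ N (N + r) (N ↑ʳ x) | Fin.splitAt-↑ʳ N r x = refl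

  enc-dec : ∀ e → enc (dec e) ≡ e
  enc-dec e with splitAt N e in q
  ... | inj₁ v = Fin.splitAt⁻¹-↑ˡ q
  ... | inj₂ e′ with splitAt N e′ in q′
  ...   | inj₁ v = trans (cong (N ↑ʳ_) (Fin.splitAt⁻¹-↑ˡ q′)) (Fin.splitAt⁻¹-↑ʳ q)
  ...   | inj₂ x = trans (cong (N ↑ʳ_) (Fin.splitAt⁻¹-↑ʳ {N} q′)) (Fin.splitAt⁻¹-↑ʳ q)

  flipEl : (Fin N → Bool) → El → El
  flipEl p (inj₁ (v , b)) = inj₁ (v , b xor p v)
  flipEl p (inj₂ x) = inj₂ x

  flip : (Fin N → Bool) → Fin n → Fin n
  flip p e = enc (flipEl p (dec e))

  dec-flip : ∀ p e → dec (flip p e) ≡ flipEl p (dec e)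
  dec-flip p e = dec-enc (flipEl p (dec e))

  flip-involutive : ∀ p e → flip p (flip p e) ≡ e
  flip-involutive p e = trans (cong (enc ∘ flipEl p) (dec-flip p e)) (trans (cong enc (twice (dec e))) (enc-dec e))
    where
    twice : ∀ x → flipEl p (flipEl p x) ≡ x
    twice (inj₁ (v , b)) = cong (λ c → inj₁ (v , c)) (trans (xor-assoc b (p v) (p v)) (trans (cong (b xor_) (xor-same (p v))) (xor-identityʳ b)))
    twice (inj₂ x) = refl

  flip-cong : ∀ p p′ e → (∀ v b → dec e ≡ inj₁ (v , b) → p v ≡ p′ v) → flip p e ≡ flip p′ e
  flip-cong p p′ e agree with dec e in q
  ... | inj₁ (v , b) = cong (λ c → enc (inj₁ (v , b xor c))) (agree v b refl)
  ... | inj₂ x = refl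

  -- A flip permutes the two elements of each variable and fixes the padding. Being a bijection, it
  -- answers counting quantifiers.
  count-flip : ∀ p (f : Fin n → Bool) → countFin n (f ∘ flip p) ≡ countFin n f
  count-flip p f = trans (parts (f ∘ flip p)) (trans (cong₂ _+_ (trans (cong₂ _+_
      (∣∣-cong (λ v → cong f (flip-enc (inj₁ (v , false))))) (∣∣-cong (λ v → trans (cong f (flip-enc (inj₁ (v , true)))) (cong (λ b → f (enc (inj₁ (v , b)))) (true-xor (p v))))))
      (count-swap N (λ v b → f (enc (inj₁ (v , b)))) p)) (∣∣-cong (λ x → cong f (flip-enc (inj₂ x))))) (sym (parts f)))
    where
    parts : ∀ g → countFin n g ≡ (countFin N (λ v → g (enc (inj₁ (v , false)))) + countFin N (λ v → g (enc (inj₁ (v , true)))))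
              + countFin r (λ x → g (enc (inj₂ x)))
    parts g = trans (countFin-+ N (N + r) g) (trans (cong (countFin N (g ∘ (_↑ˡ (N + r))) +_) (countFin-+ N r (g ∘ (N ↑ʳ_))))
      (sym (+-assoc (countFin N (g ∘ (_↑ˡ (N + r)))) _ _)))
    flip-enc : ∀ x → flip p (enc x) ≡ enc (flipEl p x)
    flip-enc x = cong (enc ∘ flipEl p) (dec-enc x)

  isVar : Fin N → Fin n → Bool
  isVar v e with dec e
  ... | inj₁ (u , _) = ⌊ u Fin.≟ v ⌋
  ... | inj₂ _ = false

  value-of : Fin n → Bool
  value-of e with dec e
  ... | inj₁ (_ , b) = b
  ... | inj₂ _ = false

  isVar-flip : ∀ p v e → isVar v (flip p e) ≡ isVar v e
  isVar-flip p v e rewrite dec-flip p e with dec e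
  ... | inj₁ _ = refl
  ... | inj₂ _ = refl

  isVar-dec : ∀ v e → isVar v e ≡ true → ∃ λ b → dec e ≡ inj₁ (v , b)
  isVar-dec v e q with dec e
  ... | inj₁ (u , b) = b , cong (λ w → inj₁ (w , b)) (⁅⁆-≡ v u q)

  value-flip : ∀ p v e → isVar v e ≡ true → value-of (flip p e) ≡ value-of e xor p v
  value-flip p v e q rewrite dec-flip p e with dec e
  ... | inj₁ (u , b) rewrite ⁅⁆-≡ v u q = refl

  matches : Fin m → (Fin Δ → Fin n) → Bool
  matches t x = allFinB Δ (λ i → isVar (h t i) (x i))

  parity : (Fin Δ → Fin n) → Bool
  parity x = F₂.⨁ (λ _ → true) (value-of ∘ x)

  allFinB-cong : ∀ {l} {f g : Fin l → Bool} → f ≗ g → allFinB l f ≡ allFinB l g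
  allFinB-cong {zero} e = refl
  allFinB-cong {suc l} e = cong₂ _∧_ (e zero) (allFinB-cong (e ∘ suc))

  allFinB-true : ∀ {l} {f : Fin l → Bool} → allFinB l f ≡ true → ∀ i → f i ≡ true
  allFinB-true {suc l} {f} e zero with f zero
  ... | true = refl
  allFinB-true {suc l} {f} e (suc i) with f zero
  ... | true = allFinB-true e i

  allFinB-intro : ∀ {l} {f : Fin l → Bool} → (∀ i → f i ≡ true) → allFinB l f ≡ true
  allFinB-intro {zero} e = refl
  allFinB-intro {suc l} e = cong₂ _∧_ (e zero) (allFinB-intro (e ∘ suc))

  matches-cong : ∀ t {x y} → x ≗ y → matches t x ≡ matches t y
  matches-cong t e = allFinB-cong (λ i → cong (isVar (h t i)) (e i))

  parity-cong : ∀ {x y} → x ≗ y → parity x ≡ parity y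
  parity-cong e = F₂.⨁-cong (λ _ → refl) (λ i → cong value-of (e i))

  matches-flip : ∀ p t {x y} → (∀ i → y i ≡ flip p (x i)) → matches t y ≡ matches t x
  matches-flip p t {x} e = trans (matches-cong t e) (allFinB-cong (λ i → isVar-flip p (h t i) (x i)))

  parity-flip : ∀ p t {x y} → (∀ i → y i ≡ flip p (x i)) → matches t x ≡ true → parity y ≡ parity x xor nodeSum h p t
  parity-flip p t {x} e mt = trans (parity-cong e) (trans
    (F₂.⨁-cong {S = λ _ → true} (λ _ → refl) (λ i → value-flip p (h t i) (x i) (allFinB-true mt i)))
    (F₂.⨁-⊕ (λ _ → true) (value-of ∘ x) (λ i → p (h t i))))

  -- Symbol 0 is the target constraint and symbol `suc t` the rule of node t. The arity is uniform:
  -- three slots of Δ variables, one for each node of a three-term sum.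
  σ : Vocab
  σ = record { nsym = suc m ; arity = λ _ → 3 * Δ }

  slot : ∀ {A : Set} → Fin 3 → (Fin (3 * Δ) → A) → Fin Δ → A
  slot c τ i = τ (combine c i)

  Holds : Rule m → Fin m → (x y z : Fin Δ → Fin n) → Bool
  Holds init t x y z = matches t x ∧ not (parity x)
  Holds (sum κ a b) t x y z =
    (matches t x ∧ (matches a y ∧ matches b z)) ∧ not ((parity x xor parity y) xor (κ ∧ parity z))

  -- The structures for β = false and β = true differ only in the value required of the target.
  𝔖 : Bool → Structure σ n
  𝔖 β zero τ = matches target (slot zero τ) ∧ not (parity (slot zero τ) xor β)
  𝔖 β (suc t) τ = Holds (rule t) t (slot zero τ) (slot (suc zero) τ) (slot (suc (suc zero)) τ)

  Pebbled : List (Fin N) → Fin n → Set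
  Pebbled X e = ∀ v b → dec e ≡ inj₁ (v , b) → v ∈ X

  matches-covers : ∀ {X t x} → (∀ i → Pebbled X (x i)) → matches t x ≡ true → Covers X t
  matches-covers {X} {t} {x} peb mt i with isVar-dec (h t i) (x i) (allFinB-true mt i)
  ... | b , q = peb i (h t i) b q

  module _ (D≥3 : 3 ≤ D) {e : ℕ} {X : List (Fin N)} {p : Fin N → Bool} (safe : Safe e X p)
           (e≥1 : 1 ≤ e) (e<top : suc (suc e) ≤ top) where

    -- Flips preserve which variables a tuple names, so both sides fail together on tuples that do
    -- not match. On matching tuples the parities change by node sums of `p`; the rule is linear and
    -- these sums satisfy it.
    holds-flip : ∀ ρ t {x y z x′ y′ z′} → rule t ≡ ρ →
      (∀ i → Pebbled X (x i)) → (∀ i → Pebbled X (y i)) → (∀ i → Pebbled X (z i)) →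
      (∀ i → x′ i ≡ flip p (x i)) → (∀ i → y′ i ≡ flip p (y i)) → (∀ i → z′ i ≡ flip p (z i)) →
      Holds ρ t x y z ≡ Holds ρ t x′ y′ z′
    holds-flip init t {x} {x′ = x′} rt px py pz x≡ y≡ z≡ rewrite matches-flip p t x≡ with matches t x in mx
    ... | false = refl
    ... | true = cong not (sym (trans (parity-flip p t x≡ mx) (trans (cong (parity x xor_)
            (init-value D≥3 safe e≥1 rt (matches-covers px mx))) (xor-identityʳ _))))
    holds-flip (sum κ a b) t {x} {y} {z} {x′} {y′} {z′} rt px py pz x≡ y≡ z≡
      rewrite matches-flip p t x≡ | matches-flip p a y≡ | matches-flip p b z≡
      with matches t x in mx | matches a y in my | matches b z in mz
    ... | false | _ | _ = refl
    ... | true | false | _ = refl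
    ... | true | true | false = refl
    ... | true | true | true = cong not (sym (trans
            (cong₂ _xor_ (cong₂ _xor_ (parity-flip p t x≡ mx) (parity-flip p a y≡ my)) (cong (κ ∧_) (parity-flip p b z≡ mz)))
            (trans (regroup κ (parity x) (nodeSum h p t) (parity y) (nodeSum h p a) (parity z) (nodeSum h p b))
              (trans (cong (((parity x xor parity y) xor (κ ∧ parity z)) xor_)
                (sum-value D≥3 safe rt (matches-covers px mx) (matches-covers py my) (matches-covers pz mz))) (xor-identityʳ _)))))
      where
      regroup : ∀ κ a a′ b b′ c c′ → ((a xor a′) xor (b xor b′)) xor (κ ∧ (c xor c′)) ≡
                ((a xor b) xor (κ ∧ c)) xor ((a′ xor b′) xor (κ ∧ c′))
      regroup κ a a′ b b′ c c′ = trans (cong₂ _xor_ (F₂.⊕-interchange a a′ b b′) (∧-distribˡ-xor κ c c′))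
        (F₂.⊕-interchange (a xor b) (a′ xor b′) (κ ∧ c) (κ ∧ c′))

    rel-flip : ∀ R {τ τ′} → (∀ q → Pebbled X (τ q)) → (∀ q → τ′ q ≡ flip p (τ q)) → 𝔖 false R τ ≡ 𝔖 true R τ′
    rel-flip zero {τ} {τ′} peb eτ rewrite matches-flip p target {slot zero τ} {slot zero τ′} (λ i → eτ _) with matches target (slot zero τ) in mt
    ... | false = refl
    ... | true = cong not (sym (trans (cong (_xor true) (parity-flip p target {slot zero τ} {slot zero τ′} (λ i → eτ _) mt))
            (trans (xor-assoc (parity (slot zero τ)) _ true) (cong (λ b → parity (slot zero τ) xor (b xor true))
              (target-value D≥3 safe e<top (matches-covers (λ i → peb _) mt))))))
    rel-flip (suc t) peb eτ = holds-flip (rule t) t refl (λ i → peb _) (λ i → peb _) (λ i → peb _) (λ i → eτ _) (λ i → eτ _) (λ i → eτ _)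

  -- Equivalence of formulas by induction, one game round per quantifier

  module Equivalent (d : ℕ) (d<D : suc d ≤ D) (D≥3 : 3 ≤ D) where

    var : Fin n → Maybe (Fin N)
    var e with dec e
    ... | inj₁ (v , _) = just v
    ... | inj₂ _ = nothing

    var-dec : ∀ e {v b} → dec e ≡ inj₁ (v , b) → var e ≡ just v
    var-dec e q with dec e | q
    ... | inj₁ _ | refl = refl

    dec-var : ∀ e {v} → var e ≡ just v → ∃ λ b → dec e ≡ inj₁ (v , b)
    dec-var e q with dec e | q
    ... | inj₁ (v , b) | refl = b , refl

    pebble : (Fin d → Bool) → (Fin d → Fin n) → Fin d → Maybe (Fin N)
    pebble B s y = if B y then var (s y) else nothing

    pebbles : (Fin d → Bool) → (Fin d → Fin n) → List (Fin N)
    pebbles B s = mapMaybe (pebble B s) (allFin d)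

    length-pebbles : ∀ B s → length (pebbles B s) ≤ d
    length-pebbles B s = ≤-trans (length-mapMaybe (pebble B s) (allFin d)) (≤-reflexive (length-allFin d))

    pebbled : ∀ B s y → T (B y) → Pebbled (pebbles B s) (s y)
    pebbled B s y By v b q = ∈-mapMaybe⁺ (pebble B s) (∈-allFin y) (trans (cong (λ c → if c then var (s y) else nothing) (T⇒≡ By)) (var-dec (s y) q))

    pebbles⁻ : ∀ B s {v} → v ∈ pebbles B s → ∃ λ y → T (B y) × ∃ λ b → dec (s y) ≡ inj₁ (v , b)
    pebbles⁻ B s v∈ with ∈-mapMaybe⁻ (pebble B s) {allFin d} v∈
    ... | y , q with B y in By
    ...   | true = y , Equivalence.from T-≡ By , dec-var (s y) q

    Related : (Fin d → Bool) → (p : Fin N → Bool) → (s s′ : Fin d → Fin n) → Set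
    Related B p s s′ = ∀ y → T (B y) → s′ y ≡ flip p (s y)

    pebbles-upd : ∀ B s x a {v} → v ∈ pebbles (upd B x true) (upd s x a) → (∃ λ b → dec a ≡ inj₁ (v , b)) ⊎ v ∈ pebbles B s
    pebbles-upd B s x a v∈ with pebbles⁻ (upd B x true) (upd s x a) v∈
    ... | y , By , b , q with y Fin.≟ x
    ...   | yes _ = inj₁ (b , q)
    ...   | no _ = inj₂ (pebbled B s y By _ b q)

    related-upd : ∀ B p p′ s s′ x a a′ → Related B p s s′ → (∀ u → u ∈ pebbles B s → p′ u ≡ p u) → a′ ≡ flip p′ a →
      Related (upd B x true) p′ (upd s x a) (upd s′ x a′)
    related-upd B p p′ s s′ x a a′ rl agree ea y By with y Fin.≟ x
    ... | yes _ = ea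
    ... | no _ = trans (rl y By) (flip-cong p p′ (s y) (λ v b q → sym (agree v (pebbled B s y By v b q))))

    -- `B` marks the pebbled variables; only there need the two assignments correspond. The position
    -- of the gap is a budget from which every quantifier still to come takes at most `step`.
    equivalent : ∀ (ψ : Formula σ d) B s s′ p e → ClosedUnder B ψ → Safe e (pebbles B s) p → Related B p s s′ →
      suc (qr ψ * step) ≤ e → suc (suc e) ≤ top → eval (𝔖 false) s ψ ≡ eval (𝔖 true) s′ ψ

    count-equivalent : ∀ (φ : Formula σ d) x B s s′ p e → ClosedUnder (upd B x true) φ → Safe e (pebbles B s) p → Related B p s s′ →
      suc (suc (qr φ) * step) ≤ e → suc (suc e) ≤ top →
      countFin n (λ a → eval (𝔖 false) (upd s x a) φ) ≡ countFin n (λ a → eval (𝔖 true) (upd s′ x a) φ)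
    count-equivalent φ x B s s′ p e cl safe rl e≥ e<top =
      trans (∣∣-cong pointwise) (count-flip b (λ a → eval (𝔖 true) (upd s′ x a) φ))
      where
      X = pebbles B s
      B′ = upd B x true
      step≤e : step ≤ e
      step≤e = ≤-trans (m≤m+n step _) (≤-trans (n≤1+n _) e≥)
      answer : ∀ v → Σ ℕ λ e′ → Σ (Fin N → Bool) λ p′ → e′ ≤ e × e ≤ e′ + step × Safe e′ (v ∷ X) p′ × (∀ u → u ∈ X → p′ u ≡ p u)
      answer v = extend safe e<top step≤e v (≤-trans (s≤s (length-pebbles B s)) d<D)
      -- Every variable `v` has its own answer, possibly with its own gap. The bijection takes from
      -- it the value at `v` only; after `v` is chosen the game continues with the whole of that
      -- answer, which agrees with `p` on the earlier pebbles.
      b : Fin N → Bool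
      b v = proj₁ (proj₂ (answer v)) v
      pointwise : ∀ a → eval (𝔖 false) (upd s x a) φ ≡ eval (𝔖 true) (upd s′ x (flip b a)) φ
      pointwise a = by-kind (dec a) refl
        where
        by-kind : ∀ k → dec a ≡ k → eval (𝔖 false) (upd s x a) φ ≡ eval (𝔖 true) (upd s′ x (flip b a)) φ
        by-kind (inj₂ _) q = equivalent φ B′ (upd s x a) (upd s′ x (flip b a)) p e cl (safe-mono sub safe)
            (related-upd B p p s s′ x a (flip b a) rl (λ _ _ → refl) (flip-cong b p a (λ v c r → contradiction (trans (sym q) r) λ ())))
            (≤-trans (s≤s (m≤n+m _ step)) e≥) e<top
          where
          sub : ∀ {v} → v ∈ pebbles B′ (upd s x a) → v ∈ X
          sub v∈ with pebbles-upd B s x a v∈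
          ... | inj₁ (c , r) = contradiction (trans (sym q) r) λ ()
          ... | inj₂ w = w
        by-kind (inj₁ (v , c)) q = go (answer v) refl
          where
          go : ∀ w → answer v ≡ w → eval (𝔖 false) (upd s x a) φ ≡ eval (𝔖 true) (upd s′ x (flip b a)) φ
          go (e′ , p′ , e′≤e , e≤ , safe′ , agree) w≡ = equivalent φ B′ (upd s x a) (upd s′ x (flip b a)) p′ e′ cl (safe-mono sub safe′)
              (related-upd B p p′ s s′ x a (flip b a) rl agree (flip-cong b p′ a at-v))
              (+-cancelʳ-≤ step _ _ (≤-trans (≤-reflexive (cong suc (+-comm (qr φ * step) step))) (≤-trans e≥ e≤)))
              (≤-trans (s≤s (s≤s e′≤e)) e<top)
            where
            at-v : ∀ u c′ → dec a ≡ inj₁ (u , c′) → b u ≡ p′ u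
            at-v u c′ r with trans (sym q) r
            ... | refl = cong (λ w → proj₁ (proj₂ w) v) w≡
            sub : ∀ {u} → u ∈ pebbles B′ (upd s x a) → u ∈ v ∷ X
            sub u∈ with pebbles-upd B s x a u∈
            ... | inj₂ w = there w
            ... | inj₁ (c′ , r) with trans (sym q) r
            ...   | refl = here refl

    equivalent (eq x y) B s s′ p e (Bx , By) safe rl e≥ e<top rewrite rl x Bx | rl y By = same
      where
      same : ⌊ s x Fin.≟ s y ⌋ ≡ ⌊ flip p (s x) Fin.≟ flip p (s y) ⌋
      same with s x Fin.≟ s y | flip p (s x) Fin.≟ flip p (s y)
      ... | yes _ | yes _ = refl
      ... | no _ | no _ = refl
      ... | yes q | no ¬q = contradiction (cong (flip p) q) ¬q
      ... | no ¬q | yes q = contradiction (trans (sym (flip-involutive p (s x))) (trans (cong (flip p) q) (flip-involutive p (s y)))) ¬q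
    equivalent (rel R xs) B s s′ p e cl safe rl e≥ e<top =
      rel-flip D≥3 safe e≥ e<top R (λ q → pebbled B s (xs q) (cl q)) (λ q → rl (xs q) (cl q))
    equivalent (neg φ) B s s′ p e cl safe rl e≥ e<top = cong not (equivalent φ B s s′ p e cl safe rl e≥ e<top)
    equivalent (and φ ψ) B s s′ p e (cl₁ , cl₂) safe rl e≥ e<top = cong₂ _∧_
      (equivalent φ B s s′ p e cl₁ safe rl (≤-trans (s≤s (*-monoˡ-≤ step (m≤m⊔n (qr φ) (qr ψ)))) e≥) e<top)
      (equivalent ψ B s s′ p e cl₂ safe rl (≤-trans (s≤s (*-monoˡ-≤ step (m≤n⊔m (qr φ) (qr ψ)))) e≥) e<top)
    equivalent (ex x φ) B s s′ p e cl safe rl e≥ e<top =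
      trans (anyFin-count n _) (trans (cong (0 <ᵇ_) (count-equivalent φ x B s s′ p e cl safe rl e≥ e<top)) (sym (anyFin-count n _)))
    equivalent (exGe j x φ) B s s′ p e cl safe rl e≥ e<top =
      cong (j ≤ᵇ_) (count-equivalent φ x B s s′ p e cl safe rl e≥ e<top)

    -- Without pebbles every gap is safe, so it is put at e = 1 + `qr ψ * step`. The summand 3 is
    -- this 1 plus the two blocks of the gap, which must lie below the target.
    sentence-equivalent : ∀ (ψ : Formula σ d) → Sentence ψ → 3 + qr ψ * step ≤ top →
      ∀ s s′ → eval (𝔖 false) s ψ ≡ eval (𝔖 true) s′ ψ
    sentence-equivalent ψ cl bound s s′ = equivalent ψ (λ _ → false) s s′ (λ _ → false) (suc (qr ψ * step)) cl
      (safe-mono (λ v∈ → contradiction (proj₁ (proj₂ (pebbles⁻ (λ _ → false) s v∈))) λ ()) (safe-[] _ _)) (λ y ()) ≤-refl bound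

-- Blocks of existential quantifiers

exs : ∀ {σ v l} → (Fin l → Fin v) → Formula σ v → Formula σ v
exs {l = zero} g φ = φ
exs {l = suc l} g φ = ex (g zero) (exs (g ∘ suc) φ)

exs-FO : ∀ {σ v l} (g : Fin l → Fin v) {φ : Formula σ v} → IsFO φ → IsFO (exs g φ)
exs-FO {l = zero} g fo = fo
exs-FO {l = suc l} g fo = exs-FO (g ∘ suc) fo

exs-closed : ∀ {σ v l} (g : Fin l → Fin v) {φ : Formula σ v} B →
  (∀ B′ → (∀ y → T (B y) → T (B′ y)) → (∀ i → T (B′ (g i))) → ClosedUnder B′ φ) → ClosedUnder B (exs g φ)
exs-closed {l = zero} g B c = c B (λ _ t → t) (λ ())
exs-closed {l = suc l} g B c = exs-closed (g ∘ suc) (upd B (g zero) true) λ B′ mono at →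
  c B′ (λ y By → mono y (keep y By)) λ { zero → mono (g zero) (Equivalence.from T-≡ (upd-same B (g zero) true)) ; (suc i) → at i }
  where
  keep : ∀ y → T (B y) → T (upd B (g zero) true y)
  keep y By with y Fin.≟ g zero
  ... | yes _ = tt
  ... | no _ = By

anyFin⁻ : ∀ n (f : Fin n → Bool) → T (anyFin n f) → ∃ λ a → T (f a)
anyFin⁻ (suc n) f t with f zero in q
... | true = zero , Equivalence.from T-≡ q
... | false with anyFin⁻ n (f ∘ suc) t
...   | a , u = suc a , u

anyFin⁺ : ∀ n (f : Fin n → Bool) a → T (f a) → T (anyFin n f)
anyFin⁺ (suc n) f zero t with f zero
... | true = tt
anyFin⁺ (suc n) f (suc a) t with f zero
... | true = tt
... | false = anyFin⁺ n (f ∘ suc) a t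

exs-sound : ∀ {σ v l n} (A : Structure σ n) (g : Fin l → Fin v) (φ : Formula σ v) s → T (eval A s (exs g φ)) →
  ∃ λ s′ → (∀ y → (∀ i → g i ≢ y) → s′ y ≡ s y) × T (eval A s′ φ)
exs-sound {l = zero} A g φ s t = s , (λ _ _ → refl) , t
exs-sound {l = suc l} {n} A g φ s t with anyFin⁻ n _ t
... | a , u with exs-sound A (g ∘ suc) φ (upd s (g zero) a) u
...   | s′ , off , w = s′ , (λ y y∉ → trans (off y (y∉ ∘ suc)) (upd-other s (g zero) a y (y∉ zero ∘ sym))) , w

-- Injectivity of `g` ensures that no later quantifier of the block overwrites an earlier witness.
exs-complete : ∀ {σ v l n} (A : Structure σ n) (g : Fin l → Fin v) (φ : Formula σ v) s (τ : Fin l → Fin n) →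
  (∀ {i j} → g i ≡ g j → i ≡ j) →
  (∀ s′ → (∀ i → s′ (g i) ≡ τ i) → (∀ y → (∀ i → g i ≢ y) → s′ y ≡ s y) → T (eval A s′ φ)) →
  T (eval A s (exs g φ))
exs-complete {l = zero} A g φ s τ inj c = c s (λ ()) (λ _ _ → refl)
exs-complete {l = suc l} {n} A g φ s τ inj c = anyFin⁺ n _ (τ zero)
  (exs-complete A (g ∘ suc) φ (upd s (g zero) (τ zero)) (τ ∘ suc) (Fin.suc-injective ∘ inj)
    λ s′ at off → c s′
      (λ { zero → trans (off (g zero) (λ i q → contradiction (inj q) λ ())) (upd-same s (g zero) (τ zero)) ; (suc i) → at i })
      (λ y y∉ → trans (off y (y∉ ∘ suc)) (upd-other s (g zero) (τ zero) y (y∉ zero ∘ sym))))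

-- The distinguishing sentence

-- The inequalities are stated cyclically because the recursion in `even` rotates the roles of the
-- three groups.
record Disjoint {Δ k : ℕ} (x y z : Fin Δ → Fin k) : Set where
  field
    injˣ : ∀ {i j} → x i ≡ x j → i ≡ j
    injʸ : ∀ {i j} → y i ≡ y j → i ≡ j
    injᶻ : ∀ {i j} → z i ≡ z j → i ≡ j
    x≢y : ∀ i j → x i ≢ y j
    y≢z : ∀ i j → y i ≢ z j
    z≢x : ∀ i j → z i ≢ x j

rotate : ∀ {Δ k} {x y z : Fin Δ → Fin k} → Disjoint x y z → Disjoint y z x
rotate d = record { injˣ = injʸ ; injʸ = injᶻ ; injᶻ = injˣ ; x≢y = y≢z ; y≢z = z≢x ; z≢x = x≢y }
  where open Disjoint d

module Distinguishing {D : ℕ} (𝒮 : System D) (r k : ℕ) (3Δ≤k : 3 * System.Δ 𝒮 ≤ k) where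
  open System 𝒮
  open Structures 𝒮 r

  pick : ∀ {A : Set} (x y z : A) → Fin 3 → A
  pick x y z zero = x
  pick x y z (suc zero) = y
  pick x y z (suc (suc zero)) = z

  tuple : (x y z : Fin Δ → Fin k) → Fin (3 * Δ) → Fin k
  tuple x y z q = pick x y z (proj₁ (remQuot {3} Δ q)) (proj₂ (remQuot {3} Δ q))

  slot-tuple : ∀ (s : Fin k → Fin n) x y z c i → slot c (s ∘ tuple x y z) i ≡ s (pick x y z c i)
  slot-tuple s x y z c i = cong (λ q → s (pick x y z (proj₁ q) (proj₂ q))) (Fin.remQuot-combine {3} c i)

  -- even d x y z says that x is a tuple of node t whose truth values add up to 0.
  even : ∀ {t} → Derivable rule t → (x y z : Fin Δ → Fin k) → Formula σ k
  even {t} (by-init _) x y z = rel (suc t) (tuple x x x)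
  even {t} (by-sum _ da db) x y z = exs y (exs z (and (even da y z x) (and (even db z x y) (rel (suc t) (tuple x y z)))))

  even-FO : ∀ {t} (d : Derivable rule t) x y z → IsFO (even d x y z)
  even-FO (by-init _) x y z = tt
  even-FO (by-sum _ da db) x y z = exs-FO y (exs-FO z (even-FO da y z x , even-FO db z x y , tt))

  closed-tuple : ∀ (B : Fin k → Bool) x y z → (∀ i → T (B (x i))) → (∀ i → T (B (y i))) → (∀ i → T (B (z i))) → ∀ q → T (B (tuple x y z q))
  closed-tuple B x y z cx cy cz q with proj₁ (remQuot {3} Δ q)
  ... | zero = cx _
  ... | suc zero = cy _
  ... | suc (suc zero) = cz _

  even-closed : ∀ {t} (d : Derivable rule t) x y z B → (∀ i → T (B (x i))) → ClosedUnder B (even d x y z)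
  even-closed (by-init _) x y z B cx = closed-tuple B x x x cx cx cx
  even-closed (by-sum _ da db) x y z B cx = exs-closed y B λ B₁ mono₁ cy → exs-closed z B₁ λ B₂ mono₂ cz →
    even-closed da y z x B₂ (λ i → mono₂ _ (cy i)) , even-closed db z x y B₂ cz ,
    closed-tuple B₂ x y z (λ i → mono₂ _ (mono₁ _ (cx i))) (λ i → mono₂ _ (cy i)) cz

  Even : Fin m → (Fin Δ → Fin n) → Set
  Even t x = matches t x ≡ true × parity x ≡ false

  T-∧⁻ : ∀ a {b} → T (a ∧ b) → T a × T b
  T-∧⁻ true t = tt , t

  T-∧⁺ : ∀ {a b} → T a → T b → T (a ∧ b)
  T-∧⁺ p q = Equivalence.from T-∧ (p , q)

  T-not : ∀ {a} → T (not a) → a ≡ false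
  T-not {false} _ = refl

  not-T : ∀ {a} → a ≡ false → T (not a)
  not-T refl = tt

  even-cong : ∀ {t x y} → x ≗ y → Even t x → Even t y
  even-cong {t} e (mt , pt) = trans (sym (matches-cong t e)) mt , trans (sym (parity-cong e)) pt

  -- Induction on the derivation, valid in both structures since they share the rules: once the
  -- tuples at `y` and `z` are even, the relation forces the one at `x` to be even. Quantifying `y`
  -- and `z` leaves `x` intact by disjointness, and what the subformulas quantify is local to them.
  even-sound : ∀ β {t} (d : Derivable rule t) x y z → Disjoint x y z → ∀ s → T (eval (𝔖 β) s (even d x y z)) → Even t (s ∘ x)
  even-sound β {t} (by-init rt) x y z dis s ok = even-cong {t} (slot-tuple s x x x zero) (T⇒≡ (proj₁ parts) , T-not (proj₂ parts))
    where
    τ : Fin (3 * Δ) → Fin n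
    τ = s ∘ tuple x x x
    parts : T (matches t (slot zero τ)) × T (not (parity (slot zero τ)))
    parts = T-∧⁻ (matches t (slot zero τ))
      (subst (λ ρ → T (Holds ρ t (slot zero τ) (slot (suc zero) τ) (slot (suc (suc zero)) τ))) rt ok)
  even-sound β {t} (by-sum {κ = κ} {a} {b} rt da db) x y z dis s ok =
    let s₁ , off₁ , ok₁ = exs-sound (𝔖 β) y (exs z (and (even da y z x) (and (even db z x y) (rel (suc t) (tuple x y z))))) s ok
        s₂ , off₂ , ok₂ = exs-sound (𝔖 β) z (and (even da y z x) (and (even db z x y) (rel (suc t) (tuple x y z)))) s₁ ok₁
        oka , ok₃ = T-∧⁻ (eval (𝔖 β) s₂ (even da y z x)) ok₂
        okb , okt = T-∧⁻ (eval (𝔖 β) s₂ (even db z x y)) ok₃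
    in conclude s₂ (λ i → trans (off₂ (x i) (λ j → z≢x j i)) (off₁ (x i) (λ j q → x≢y i j (sym q))))
         (even-sound β da y z x (rotate dis) s₂ oka) (even-sound β db z x y (rotate (rotate dis)) s₂ okb) okt
    where
    open Disjoint dis
    conclude : ∀ s₂ → (∀ i → s₂ (x i) ≡ s (x i)) → Even a (s₂ ∘ y) → Even b (s₂ ∘ z) → T (𝔖 β (suc t) (s₂ ∘ tuple x y z)) → Even t (s ∘ x)
    conclude s₂ back (_ , ey) (_ , ez) okt = even-cong {t} (λ i → trans (slot-tuple s₂ x y z zero i) (back i))
      (T⇒≡ (proj₁ (T-∧⁻ (matches t (slot zero τ)) (proj₁ parts))) , even-x)
      where
      τ : Fin (3 * Δ) → Fin n
      τ = s₂ ∘ tuple x y z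
      px = parity (slot zero τ)
      parts : T (matches t (slot zero τ) ∧ (matches a (slot (suc zero) τ) ∧ matches b (slot (suc (suc zero)) τ))) ×
              T (not ((px xor parity (slot (suc zero) τ)) xor (κ ∧ parity (slot (suc (suc zero)) τ))))
      parts = T-∧⁻ (matches t (slot zero τ) ∧ (matches a (slot (suc zero) τ) ∧ matches b (slot (suc (suc zero)) τ)))
        (subst (λ ρ → T (Holds ρ t (slot zero τ) (slot (suc zero) τ) (slot (suc (suc zero)) τ))) rt okt)
      even-x : px ≡ false
      even-x = trans (sym (trans (cong₂ _xor_
          (trans (cong (px xor_) (trans (parity-cong (slot-tuple s₂ x y z (suc zero))) ey)) (xor-identityʳ px))
          (trans (cong (κ ∧_) (trans (parity-cong (slot-tuple s₂ x y z (suc (suc zero)))) ez)) (∧-zeroʳ κ))) (xor-identityʳ px)))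
        (T-not (proj₂ parts))

  zeros : Fin m → Fin Δ → Fin n
  zeros t i = enc (inj₁ (h t i , false))

  even-zeros : ∀ t {x} → x ≗ zeros t → Even t x
  even-zeros t e = trans (matches-cong t e) (allFinB-intro is) , trans (parity-cong e) (F₂.⨁-vanishes (λ _ → true) _ (λ i _ → val0 i))
    where
    is : ∀ i → isVar (h t i) (zeros t i) ≡ true
    is i rewrite dec-enc (inj₁ (h t i , false)) = ⁅⁆-refl (h t i)
    val0 : ∀ i → value-of (zeros t i) ≡ false
    val0 i rewrite dec-enc (inj₁ (h t i , false)) = refl

  -- The assignment that gives every variable the value false satisfies all homogeneous rules, so it
  -- supplies the witnesses.
  even-complete : ∀ β {t} (d : Derivable rule t) x y z → Disjoint x y z → ∀ s → (∀ i → s (x i) ≡ zeros t i) → T (eval (𝔖 β) s (even d x y z))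
  even-complete β {t} (by-init rt) x y z dis s at =
    subst (λ ρ → T (Holds ρ t (slot zero τ) (slot (suc zero) τ) (slot (suc (suc zero)) τ))) (sym rt)
      (T-∧⁺ (Equivalence.from T-≡ (proj₁ ev)) (not-T (proj₂ ev)))
    where
    τ : Fin (3 * Δ) → Fin n
    τ = s ∘ tuple x x x
    ev : Even t (slot zero τ)
    ev = even-zeros t (λ i → trans (slot-tuple s x x x zero i) (at i))
  even-complete β {t} (by-sum {κ = κ} {a} {b} rt da db) x y z dis s at =
    exs-complete (𝔖 β) y _ s (zeros a) injʸ λ s₁ at₁ off₁ →
    exs-complete (𝔖 β) z _ s₁ (zeros b) injᶻ λ s₂ at₂ off₂ →
      let atx : ∀ i → s₂ (x i) ≡ zeros t i
          atx i = trans (off₂ (x i) (λ j → z≢x j i)) (trans (off₁ (x i) (λ j q → x≢y i j (sym q))) (at i))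
          aty : ∀ i → s₂ (y i) ≡ zeros a i
          aty i = trans (off₂ (y i) (λ j q → y≢z i j (sym q))) (at₁ i)
      in T-∧⁺ (even-complete β da y z x (rotate dis) s₂ aty)
              (T-∧⁺ (even-complete β db z x y (rotate (rotate dis)) s₂ at₂) (base s₂ atx aty at₂))
    where
    open Disjoint dis
    base : ∀ s₂ → (∀ i → s₂ (x i) ≡ zeros t i) → (∀ i → s₂ (y i) ≡ zeros a i) → (∀ i → s₂ (z i) ≡ zeros b i) →
      T (𝔖 β (suc t) (s₂ ∘ tuple x y z))
    base s₂ atx aty atz = subst (λ ρ → T (Holds ρ t (slot zero τ) (slot (suc zero) τ) (slot (suc (suc zero)) τ))) (sym rt)
      (T-∧⁺ (Equivalence.from T-≡ (cong₂ _∧_ (proj₁ et) (cong₂ _∧_ (proj₁ ea) (proj₁ eb))))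
        (not-T (trans (cong₂ _xor_ (cong₂ _xor_ (proj₂ et) (proj₂ ea)) (cong (κ ∧_) (proj₂ eb))) (∧-zeroʳ κ))))
      where
      τ : Fin (3 * Δ) → Fin n
      τ = s₂ ∘ tuple x y z
      et : Even t (slot zero τ)
      et = even-zeros t (λ i → trans (slot-tuple s₂ x y z zero i) (atx i))
      ea : Even a (slot (suc zero) τ)
      ea = even-zeros a (λ i → trans (slot-tuple s₂ x y z (suc zero) i) (aty i))
      eb : Even b (slot (suc (suc zero)) τ)
      eb = even-zeros b (λ i → trans (slot-tuple s₂ x y z (suc (suc zero)) i) (atz i))

  group : Fin 3 → Fin Δ → Fin k
  group c i = inject≤ (combine c i) 3Δ≤k

  group-injective : ∀ c i c′ i′ → group c i ≡ group c′ i′ → c ≡ c′ × i ≡ i′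
  group-injective c i c′ i′ q = Fin.combine-injective c i c′ i′ (Fin.inject≤-injective 3Δ≤k 3Δ≤k _ _ q)

  private
    g₀ g₁ g₂ : Fin Δ → Fin k
    g₀ = group zero
    g₁ = group (suc zero)
    g₂ = group (suc (suc zero))

    dis : Disjoint g₀ g₁ g₂
    dis = record
      { injˣ = λ q → proj₂ (group-injective zero _ zero _ q)
      ; injʸ = λ q → proj₂ (group-injective (suc zero) _ (suc zero) _ q)
      ; injᶻ = λ q → proj₂ (group-injective (suc (suc zero)) _ (suc (suc zero)) _ q)
      ; x≢y = λ i j q → contradiction (proj₁ (group-injective zero i (suc zero) j q)) λ ()
      ; y≢z = λ i j q → contradiction (proj₁ (group-injective (suc zero) i (suc (suc zero)) j q)) λ ()
      ; z≢x = λ i j q → contradiction (proj₁ (group-injective (suc (suc zero)) i zero j q)) λ () }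

  sentence : Formula σ k
  sentence = exs g₀ (and (even derivable g₀ g₁ g₂) (rel zero (tuple g₀ g₀ g₀)))

  sentence-FO : IsFO sentence
  sentence-FO = exs-FO g₀ (even-FO derivable g₀ g₁ g₂ , tt)

  sentence-closed : Sentence sentence
  sentence-closed = exs-closed g₀ _ λ B _ cx → even-closed derivable g₀ g₁ g₂ B cx , closed-tuple B g₀ g₀ g₀ cx cx cx

  sentence-true : 𝔖 false ⊨ sentence
  sentence-true s = exs-complete (𝔖 false) g₀ _ s (zeros target) (Disjoint.injˣ dis) λ s′ at _ →
    T-∧⁺ (even-complete false derivable g₀ g₁ g₂ dis s′ at) (final s′ at)
    where
    final : ∀ s′ → (∀ i → s′ (g₀ i) ≡ zeros target i) → T (𝔖 false zero (s′ ∘ tuple g₀ g₀ g₀))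
    final s′ at = T-∧⁺ (Equivalence.from T-≡ (proj₁ ev)) (not-T (trans (xor-identityʳ _) (proj₂ ev)))
      where
      ev : Even target (slot zero (s′ ∘ tuple g₀ g₀ g₀))
      ev = even-zeros target (λ i → trans (slot-tuple s′ g₀ g₀ g₀ zero i) (at i))

  -- The derivation forces the tuple of the target to be even, whereas symbol 0 of this structure
  -- holds of odd tuples only.
  sentence-false : Fin n → ¬ (𝔖 true ⊨ sentence)
  sentence-false a holds =
    let s , _ , ok = exs-sound (𝔖 true) g₀ (and (even derivable g₀ g₁ g₂) (rel zero (tuple g₀ g₀ g₀))) (λ _ → a) (holds (λ _ → a))
        ok₁ , ok₂ = T-∧⁻ (eval (𝔖 true) s (even derivable g₀ g₁ g₂)) ok
    in odd-target s (even-sound true derivable g₀ g₁ g₂ dis s ok₁) ok₂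
    where
    odd-target : ∀ s → Even target (s ∘ g₀) → ¬ T (𝔖 true zero (s ∘ tuple g₀ g₀ g₀))
    odd-target s (_ , ev) ok = false≢true (trans (sym (T-not (proj₂ (T-∧⁻ (matches target τ₀) ok)))) (cong (_xor true)
      (trans (parity-cong (slot-tuple s g₀ g₀ g₀ zero)) ev)))
      where
      τ₀ : Fin Δ → Fin n
      τ₀ = slot zero (s ∘ tuple g₀ g₀ g₀)

-- Choice of parameters

module _ (N D δ B T′ H : ℕ) (C : Columns H)
         (B≥1 : 1 ≤ B) (N≥1 : 1 ≤ N) (m≥1 : 1 ≤ suc T′ * (H * H))
         (room : (D + D) * suc (2 * δ) * B ≤ N)
         (sparse : suc (D + D) * (suc T′ * (H * H) * 2 ^ suc (2 * δ)) ≤ B ^ δ)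
         (large : suc (suc T′ * suc (suc D)) * (suc T′ * (H * H)) ^ suc D ≤ 2 ^ H) where

  private
    open module R = Recurrence H using (Mat; Independent)
    graph : Σ (Fin (suc T′ * (H * H)) → Fin (suc (2 * δ)) → Fin N) (Expanding D)
    graph = expanding-exists N D δ (suc T′ * (H * H)) B B≥1 N≥1 room sparse
    matrices : Σ (Vec Mat (suc T′)) (Independent D)
    matrices = R.independent-exists (suc T′) D m≥1 large
    ω = proj₁ matrices
    -- The last node of the last row in the last block; as blocks are numbered from 0, it lies in
    -- block T′.
    target : Fin (suc T′ * (H * H))
    target = R.node (fromℕ T′) (Columns.last C) (Columns.last C)
    blk-target : R.blk {suc T′} target ≡ T′
    blk-target = trans (R.blk-node C (fromℕ T′) (Columns.last C) (Columns.last C)) (Fin.toℕ-fromℕ T′)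
    sound : ∀ {t ρ} → R.rule C ω t ≡ ρ → R.Sound C ω t ρ
    sound {t} q = subst (R.Sound C ω t) q (R.rule-sound C ω t)

  system : System D
  system = record
    { m = suc T′ * (H * H) ; N = N ; Δ = suc (2 * δ)
    ; h = proj₁ graph ; expanding = proj₂ graph
    ; W = R.W ; _≟W_ = R._≟W_ ; vec = R.vec ω ; blk = R.blk {suc T′} ; rule = R.rule C ω
    ; target = target ; derivable = R.derivable C ω target
    ; target≢𝟘 = λ q → R.vecAt≢𝟘 ω _ _ _ q
    ; independent = λ e S e< S≤ avoid zS → proj₂ matrices e S (s≤s (≤-trans e< (≤-reflexive blk-target))) S≤ avoid zS
    ; init-blk = λ q → sound q
    ; sum-vec = λ q → proj₁ (sound q)
    ; sum-blk = λ q → proj₂ (sound q) }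

  top-system : System.top system ≡ T′
  top-system = blk-target

-- The rank bound n^(k / q) is expressed without roots.
Separated : (d k n q : ℕ) → Set
Separated d k n q =
  Σ Vocab λ σ → Σ (Structure σ n) λ A → Σ (Structure σ n) λ B →
    KAry k σ ×
    (Σ (Formula σ k) λ φ → IsFO φ × Sentence φ × (A ⊨ φ) × ¬ (B ⊨ φ)) ×
    ((ψ : Formula σ d) → Sentence ψ → qr ψ ^ q ≤ n ^ (1 * k) → (A ⊨ ψ) ⇔ (B ⊨ ψ))

separate : ∀ {D} (𝒮 : System D) d k r q → suc d ≤ D → 3 ≤ D → 3 * System.Δ 𝒮 ≤ k → 1 ≤ System.N 𝒮 →
  (∀ e → e ^ q ≤ (System.N 𝒮 + (System.N 𝒮 + r)) ^ (1 * k) → 3 + e * (D * D + D * D) ≤ System.top 𝒮) →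
  Separated d k (System.N 𝒮 + (System.N 𝒮 + r)) q
separate 𝒮 d k r q d<D D≥3 3Δ≤k N≥1 enough =
  S.σ , S.𝔖 false , S.𝔖 true , (λ _ → 3Δ≤k) ,
  (Dist.sentence , Dist.sentence-FO , Dist.sentence-closed , Dist.sentence-true , Dist.sentence-false element) ,
  λ ψ cl qr≤ → mk⇔ (λ A⊨ s → subst T (same ψ cl qr≤ s) (A⊨ s)) (λ B⊨ s → subst T (sym (same ψ cl qr≤ s)) (B⊨ s))
  where
  module S = Structures 𝒮 r
  module Dist = Distinguishing 𝒮 r k 3Δ≤k
  module Eq = S.Equivalent d d<D D≥3
  element : Fin S.n
  element = first (≤-trans N≥1 (m≤m+n _ _))
    where
    first : ∀ {l} → 1 ≤ l → Fin l
    first (s≤s _) = zero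
  same : ∀ ψ → Sentence ψ → qr ψ ^ q ≤ S.n ^ (1 * k) → ∀ s → eval (S.𝔖 false) s ψ ≡ eval (S.𝔖 true) s ψ
  same ψ cl qr≤ s = Eq.sentence-equivalent ψ cl (enough (qr ψ) qr≤) s s

n≤2^n : ∀ n → n ≤ 2 ^ n
n≤2^n zero = z≤n
n≤2^n (suc n) = ≤-trans (+-mono-≤ (m^n>0 2 n) (n≤2^n n)) (≤-reflexive (cong (2 ^ n +_) (sym (+-identityʳ (2 ^ n)))))

<[1+m/c]*c : ∀ m c .{{_ : NonZero c}} → m < suc (m / c) * c
<[1+m/c]*c m c = ≤-trans (s≤s (≤-reflexive (m≡m%n+[m/n]*n m c))) (+-monoˡ-≤ (m / c * c) (m%n<n m c))

module _ (d k n : ℕ) (k≥87 : 87 ≤ k) (k≤d : k ≤ d) (big : d * k * (d * k) * 9216 ≤ n) where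

  private
    x : ℕ
    x = d * k

    k≥1 : 1 ≤ k
    k≥1 = ≤-trans (s≤s z≤n) k≥87

    d≥1 : 1 ≤ d
    d≥1 = ≤-trans k≥1 k≤d

    x≥1 : 1 ≤ x
    x≥1 = *-mono-≤ d≥1 k≥1

    d≤x : d ≤ x
    d≤x = m≤m*n d k {{>-nonZero k≥1}}

    k≤x : k ≤ x
    k≤x = m≤n*m k d {{>-nonZero d≥1}}

    quadratic : ∀ c → c ≤ 9216 → x * x * c ≤ n
    quadratic c c≤ = ≤-trans (*-monoʳ-≤ (x * x) c≤) big

    linear : ∀ c → c ≤ 9216 → x * c ≤ n
    linear c c≤ = ≤-trans (*-monoˡ-≤ c (m≤m*n x x {{>-nonZero x≥1}})) (quadratic c c≤)

    const≤ : ∀ c → c ≤ x * c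
    const≤ c = m≤n*m c x {{>-nonZero x≥1}}

    n≥1 : 1 ≤ n
    n≥1 = ≤-trans (const≤ 1) (linear 1 (≤ᵇ⇒≤ 1 9216 tt))

    D : ℕ
    D = suc d

    -- Here 3Δ = 12ρ + 75, so `ρ` is the largest value for which three nodes fit into k variables.
    -- The rank will be bounded by n^ρ, and τ = ρ + 1 leaves a factor n for the blocks lost per
    -- round. There are n^(τ + 4) nodes; one more factor n absorbs the sizes in the union bound, and
    -- the factor 2 in `δ` comes from B being of order at least √n.
    ρ τ δ Δ : ℕ
    ρ = (k ∸ 75) / 12
    τ = suc ρ
    δ = 2 * (τ + 5)
    Δ = suc (2 * δ)

    3Δ≤k : 3 * Δ ≤ k
    3Δ≤k = begin
      3 * Δ                    ≡⟨ solve 1 (λ r → con 3 :* (con 1 :+ con 2 :* (con 2 :* (con 1 :+ r :+ con 5))) := r :* con 12 :+ con 75) refl ρ ⟩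
      ρ * 12 + 75              ≤⟨ +-monoˡ-≤ 75 (m/n*n≤m (k ∸ 75) 12) ⟩
      (k ∸ 75) + 75            ≡⟨ m∸n+n≡m (≤-trans (≤ᵇ⇒≤ 75 87 tt) k≥87) ⟩
      k                        ∎
      where open ≤-Reasoning

    Δ≤k : Δ ≤ k
    Δ≤k = ≤-trans (m≤n*m Δ 3) 3Δ≤k

    τ≤k : τ ≤ k
    τ≤k = ≤-trans (≤-trans (m≤m+n τ 5) (≤-trans (m≤n*m (τ + 5) 2) (≤-trans (m≤n*m δ 2) (n≤1+n _)))) Δ≤k

    -- This is where k ≥ 87 = 75 + 12 is used.
    ρ≥1 : 1 ≤ ρ
    ρ≥1 = positive ρ refl
      where
      positive : ∀ r → r ≡ ρ → 1 ≤ r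
      positive zero e = contradiction (≤-trans (<[1+m/c]*c (k ∸ 75) 12) (≤-reflexive (cong (λ r → suc r * 12) (sym e))))
        (≤⇒≯ (∸-monoˡ-≤ 75 k≥87))
      positive (suc r) e = s≤s z≤n

    -- The origin of ε = 1 / 99: k is at most 12ρ + 87, and ρ ≥ 1 turns this into a multiple of ρ.
    k≤ρ*99 : k ≤ ρ * 99
    k≤ρ*99 = begin
      k                        ≡⟨ sym (m∸n+n≡m (≤-trans (≤ᵇ⇒≤ 75 87 tt) k≥87)) ⟩
      (k ∸ 75) + 75            ≤⟨ +-monoˡ-≤ 75 (<⇒≤ (<[1+m/c]*c (k ∸ 75) 12)) ⟩
      suc ρ * 12 + 75          ≡⟨ solve 1 (λ r → (con 1 :+ r) :* con 12 :+ con 75 := r :* con 12 :+ con 87) refl ρ ⟩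
      ρ * 12 + 87              ≤⟨ +-monoʳ-≤ (ρ * 12) (m≤n*m 87 ρ {{>-nonZero ρ≥1}}) ⟩
      ρ * 12 + ρ * 87          ≡⟨ sym (*-distribˡ-+ ρ 12 87) ⟩
      ρ * 99                   ∎
      where open ≤-Reasoning

    N r c : ℕ
    N = ⌊ n /2⌋
    -- One padding element when n is odd, none otherwise.
    r = ⌈ n /2⌉ ∸ ⌊ n /2⌋
    c = (D + D) * Δ

    n≡ : N + (N + r) ≡ n
    n≡ = trans (cong (N +_) (m+[n∸m]≡n (⌊n/2⌋≤⌈n/2⌉ n))) (⌊n/2⌋+⌈n/2⌉≡n n)

    instance
      c≢0 : NonZero c
      c≢0 = >-nonZero (*-mono-≤ {1} {D + D} (s≤s z≤n) (s≤s z≤n))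

    B : ℕ
    B = N / c

    c≤4x : c ≤ x * 4
    c≤4x = begin
      (D + D) * Δ              ≤⟨ *-mono-≤ (+-mono-≤ 1+d≤ 1+d≤) Δ≤k ⟩
      (d * 2 + d * 2) * k      ≡⟨ solve 2 (λ d k → (d :* con 2 :+ d :* con 2) :* k := d :* k :* con 4) refl d k ⟩
      x * 4                    ∎
      where
      open ≤-Reasoning
      1+d≤ : suc d ≤ d * 2
      1+d≤ = ≤-trans (+-monoˡ-≤ d d≥1) (≤-reflexive (solve 1 (λ d → d :+ d := d :* con 2) refl d))

    n≤1+2N : n ≤ suc (N + N)
    n≤1+2N = ≤-trans (≤-reflexive (sym (⌊n/2⌋+⌈n/2⌉≡n n))) (≤-trans (+-monoʳ-≤ N (half n)) (≤-reflexive (+-suc N N)))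
      where
      half : ∀ n → ⌈ n /2⌉ ≤ suc ⌊ n /2⌋
      half zero = z≤n
      half (suc zero) = ≤-refl
      half (suc (suc n)) = s≤s (half n)

    c≤N : c ≤ N
    c≤N = ≮⇒≥ λ N<c → <⇒≱ (begin-strict
      n                        ≤⟨ n≤1+2N ⟩
      suc (N + N)              <⟨ s≤s (≤-reflexive (sym (+-suc N N))) ⟩
      suc N + suc N            ≤⟨ +-mono-≤ (≤-trans N<c c≤4x) (≤-trans N<c c≤4x) ⟩
      x * 4 + x * 4            ≡⟨ sym (*-distribˡ-+ x 4 4) ⟩
      x * 8                    ∎) (linear 8 (≤ᵇ⇒≤ 8 9216 tt))
      where open ≤-Reasoning

    N≥1 : 1 ≤ N
    N≥1 = ≤-trans (*-mono-≤ {1} {D + D} (s≤s z≤n) (s≤s z≤n)) c≤N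

    B≥1 : 1 ≤ B
    B≥1 = positive B refl
      where
      positive : ∀ b → b ≡ B → 1 ≤ b
      positive zero e = contradiction (≤-trans (<[1+m/c]*c N c) (≤-reflexive (trans (cong (λ b → suc b * c) (sym e)) (+-identityʳ c)))) (≤⇒≯ c≤N)
      positive (suc b) e = s≤s z≤n

    room : c * B ≤ N
    room = ≤-trans (≤-reflexive (*-comm c B)) (m/n*n≤m N c)

    -- 24 = 3 · 2 · 4, from n ≤ 3N, N ≤ (B + 1) c ≤ 2Bc and c ≤ 4x.
    n≤24xB : n ≤ x * 24 * B
    n≤24xB = begin
      n                        ≤⟨ n≤1+2N ⟩
      suc (N + N)              ≤⟨ +-monoˡ-≤ (N + N) N≥1 ⟩
      N + (N + N)              ≡⟨ solve 1 (λ n → n :+ (n :+ n) := n :* con 3) refl N ⟩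
      N * 3                    ≤⟨ *-monoˡ-≤ 3 (<⇒≤ (<[1+m/c]*c N c)) ⟩
      suc B * c * 3            ≤⟨ *-monoˡ-≤ 3 (*-mono-≤ (+-monoˡ-≤ B B≥1) c≤4x) ⟩
      (B + B) * (x * 4) * 3    ≡⟨ solve 2 (λ b x → (b :+ b) :* (x :* con 4) :* con 3 := x :* con 24 :* b) refl B x ⟩
      x * 24 * B               ∎
      where open ≤-Reasoning

    -- The origin of 9216 = 16 · 24^2: squaring n ≤ 24xB and dividing by n ≥ 9216 x^2. The 16 is
    -- needed because 2^Δ = 2 · 16^(τ + 5).
    16n≤B² : 16 * n ≤ B * B
    16n≤B² = *-cancelˡ-≤ (x * x * 576) {{>-nonZero (*-mono-≤ (*-mono-≤ x≥1 x≥1) (s≤s {n = 575} z≤n))}} (begin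
      x * x * 576 * (16 * n)           ≡⟨ solve 2 (λ x n → x :* con 576 :* (con 16 :* n) := x :* con 9216 :* n) refl (x * x) n ⟩
      x * x * 9216 * n                 ≤⟨ *-monoˡ-≤ n big ⟩
      n * n                            ≤⟨ *-mono-≤ n≤24xB n≤24xB ⟩
      x * 24 * B * (x * 24 * B)        ≡⟨ solve 2 (λ x b → x :* con 24 :* b :* (x :* con 24 :* b) := x :* x :* con 576 :* (b :* b)) refl x B ⟩
      x * x * 576 * (B * B)            ∎)
      where open ≤-Reasoning

    -- `L` is the number of blocks. With H = n^2 one has 2^H ≥ n^n, which dominates the number of
    -- small sets of nodes, and each block has only n^4 nodes.
    H L : ℕ
    H = n * n
    L = n ^ τ

    sparse : suc (D + D) * (L * (H * H) * 2 ^ Δ) ≤ B ^ δ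
    sparse = begin
      suc (D + D) * (L * (H * H) * 2 ^ Δ)
        ≡⟨ cong (λ z → suc (D + D) * (L * (H * H) * (2 * z))) (trans (cong (2 ^_) (solve 1 (λ t → con 2 :* (con 2 :* t) := con 4 :* t) refl (τ + 5))) (sym (^-*-assoc 2 4 (τ + 5)))) ⟩
      suc (D + D) * (L * (H * H) * (2 * 16 ^ (τ + 5)))
        ≡⟨ solve 4 (λ a t h s → a :* (t :* h :* (con 2 :* s)) := (a :* con 2) :* (t :* h :* s)) refl (suc (D + D)) L (H * H) (16 ^ (τ + 5)) ⟩
      (suc (D + D) * 2) * (L * (H * H) * 16 ^ (τ + 5))
        ≤⟨ *-monoˡ-≤ (L * (H * H) * 16 ^ (τ + 5)) small ⟩
      n * (L * (H * H) * 16 ^ (τ + 5))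
        ≡⟨ solve 3 (λ n t s → n :* (t :* (n :* n :* (n :* n)) :* s) := s :* (t :* (n :* (n :* (n :* (n :* (n :* con 1))))))) refl n L (16 ^ (τ + 5)) ⟩
      16 ^ (τ + 5) * (n ^ τ * n ^ 5)
        ≡⟨ cong (16 ^ (τ + 5) *_) (sym (^-distribˡ-+-* n τ 5)) ⟩
      16 ^ (τ + 5) * n ^ (τ + 5)
        ≡⟨ sym (^-distribʳ-* (τ + 5) 16 n) ⟩
      (16 * n) ^ (τ + 5)
        ≤⟨ ^-monoˡ-≤ (τ + 5) 16n≤B² ⟩
      (B * B) ^ (τ + 5)
        ≡⟨ cong (_^ (τ + 5)) (cong (B *_) (sym (*-identityʳ B))) ⟩
      (B ^ 2) ^ (τ + 5)
        ≡⟨ ^-*-assoc B 2 (τ + 5) ⟩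
      B ^ δ ∎
      where
      open ≤-Reasoning
      small : suc (D + D) * 2 ≤ n
      small = begin
        suc (D + D) * 2        ≡⟨ solve 1 (λ d → (con 1 :+ (con 1 :+ d :+ (con 1 :+ d))) :* con 2 := d :* con 4 :+ con 6) refl d ⟩
        d * 4 + 6              ≤⟨ +-mono-≤ (*-monoˡ-≤ 4 d≤x) (const≤ 6) ⟩
        x * 4 + x * 6          ≡⟨ sym (*-distribˡ-+ x 4 6) ⟩
        x * 10                 ≤⟨ linear 10 (≤ᵇ⇒≤ 10 9216 tt) ⟩
        n                      ∎

    L≥1 : 1 ≤ L
    L≥1 = m^n>0 n {{>-nonZero n≥1}} τ

    large : suc (L * suc (suc D)) * (L * (H * H)) ^ suc D ≤ 2 ^ H
    large = begin
      suc (L * suc (suc D)) * (L * (H * H)) ^ suc D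
        ≤⟨ *-mono-≤ count (≤-reflexive (trans (cong (_^ suc D) nodes) (^-*-assoc n (τ + 4) (suc D)))) ⟩
      n ^ suc τ * n ^ ((τ + 4) * suc D)
        ≡⟨ sym (^-distribˡ-+-* n (suc τ) ((τ + 4) * suc D)) ⟩
      n ^ (suc τ + (τ + 4) * suc D)
        ≤⟨ ^-monoʳ-≤ n {{>-nonZero n≥1}} exponent ⟩
      n ^ n
        ≤⟨ ^-monoˡ-≤ n (n≤2^n n) ⟩
      (2 ^ n) ^ n
        ≡⟨ ^-*-assoc 2 n n ⟩
      2 ^ H ∎
      where
      open ≤-Reasoning
      nodes : L * (H * H) ≡ n ^ (τ + 4)
      nodes = trans (cong (L *_) (solve 1 (λ n → n :* n :* (n :* n) := n :* (n :* (n :* (n :* con 1)))) refl n)) (sym (^-distribˡ-+-* n τ 4))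
      count : suc (L * suc (suc D)) ≤ n ^ suc τ
      count = begin
        suc (L * suc (suc D))        ≤⟨ +-monoˡ-≤ (L * suc (suc D)) L≥1 ⟩
        L + L * suc (suc D)          ≡⟨ sym (*-suc L (suc (suc D))) ⟩
        L * suc (suc (suc D))        ≤⟨ *-monoʳ-≤ L d+4≤n ⟩
        L * n                        ≡⟨ *-comm L n ⟩
        n ^ suc τ                    ∎
        where
        d+4≤n : 4 + d ≤ n
        d+4≤n = ≤-trans (+-mono-≤ (const≤ 4) (≤-trans d≤x (≤-reflexive (sym (*-identityʳ x)))))
          (≤-trans (≤-reflexive (sym (*-distribˡ-+ x 4 1))) (linear 5 (≤ᵇ⇒≤ 5 9216 tt)))
      exponent : suc τ + (τ + 4) * suc D ≤ n
      exponent = begin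
        suc τ + (τ + 4) * suc D      ≤⟨ +-mono-≤ (s≤s (≤-trans τ≤k k≤x)) (*-mono-≤ τ+4≤ 2+d≤) ⟩
        suc x + (k * 5) * (d * 3)    ≤⟨ +-monoˡ-≤ _ (+-monoˡ-≤ x x≥1) ⟩
        (x + x) + (k * 5) * (d * 3)  ≡⟨ solve 2 (λ d k → (d :* k :+ d :* k) :+ (k :* con 5) :* (d :* con 3) := d :* k :* con 17) refl d k ⟩
        x * 17                       ≤⟨ linear 17 (≤ᵇ⇒≤ 17 9216 tt) ⟩
        n                            ∎
        where
        τ+4≤ : τ + 4 ≤ k * 5
        τ+4≤ = ≤-trans (+-mono-≤ (≤-trans τ≤k (≤-reflexive (sym (*-identityʳ k)))) (m≤n*m 4 k {{>-nonZero k≥1}})) (≤-reflexive (sym (*-distribˡ-+ k 1 4)))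
        2+d≤ : suc D ≤ d * 3
        2+d≤ = ≤-trans (+-mono-≤ (m≤n*m 2 d {{>-nonZero d≥1}}) (≤-reflexive (sym (*-identityʳ d)))) (≤-reflexive (sym (*-distribˡ-+ d 2 1)))

    rank-bound : ∀ e → e ^ 99 ≤ n ^ (1 * k) → e ≤ n ^ ρ
    rank-bound e small = ≮⇒≥ λ nρ<e → <⇒≱ (^-monoˡ-< 99 nρ<e) (begin
      e ^ 99                   ≤⟨ small ⟩
      n ^ (1 * k)              ≡⟨ cong (n ^_) (*-identityˡ k) ⟩
      n ^ k                    ≤⟨ ^-monoʳ-≤ n {{>-nonZero n≥1}} k≤ρ*99 ⟩
      n ^ (ρ * 99)             ≡⟨ sym (^-*-assoc n ρ 99) ⟩
      (n ^ ρ) ^ 99             ∎)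
      where open ≤-Reasoning

    -- The summand is 4, one more than the game asks for, because the last of L blocks has number L
    -- - 1. The extra power of n in `L` pays for the at most 2D^2 blocks lost per round.
    enough : ∀ e → e ^ 99 ≤ n ^ (1 * k) → 4 + e * (D * D + D * D) ≤ L
    enough e small = begin
      4 + e * (D * D + D * D)              ≤⟨ +-mono-≤ (m≤n*m 4 (n ^ ρ) {{>-nonZero (m^n>0 n {{>-nonZero n≥1}} ρ)}}) (*-monoˡ-≤ (D * D + D * D) (rank-bound e small)) ⟩
      n ^ ρ * 4 + n ^ ρ * (D * D + D * D)  ≡⟨ sym (*-distribˡ-+ (n ^ ρ) 4 _) ⟩
      n ^ ρ * (4 + (D * D + D * D))        ≤⟨ *-monoʳ-≤ (n ^ ρ) fits ⟩
      n ^ ρ * n                            ≡⟨ *-comm (n ^ ρ) n ⟩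
      L                                    ∎
      where
      open ≤-Reasoning
      D≤ : D ≤ x * 2
      D≤ = ≤-trans (+-mono-≤ x≥1 d≤x) (≤-reflexive (solve 1 (λ x → x :+ x := x :* con 2) refl x))
      fits : 4 + (D * D + D * D) ≤ n
      fits = begin
        4 + (D * D + D * D)                          ≤⟨ +-mono-≤ (≤-trans (const≤ 4) (*-monoˡ-≤ 4 (m≤m*n x x {{>-nonZero x≥1}}))) (+-mono-≤ (*-mono-≤ D≤ D≤) (*-mono-≤ D≤ D≤)) ⟩
        x * x * 4 + (x * 2 * (x * 2) + x * 2 * (x * 2)) ≡⟨ solve 1 (λ x → x :* x :* con 4 :+ (x :* con 2 :* (x :* con 2) :+ x :* con 2 :* (x :* con 2)) := x :* x :* con 12) refl x ⟩
        x * x * 12                                   ≤⟨ quadratic 12 (≤ᵇ⇒≤ 12 9216 tt) ⟩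
        n                                            ∎

    H≥1 : 1 ≤ H
    H≥1 = *-mono-≤ n≥1 n≥1

    columns′ : ∀ {l} → 1 ≤ l → Columns l
    columns′ (s≤s {n = l} _) = columns l

    suc-pred-L : suc (ℕ.pred L) ≡ L
    suc-pred-L = suc-pred L {{>-nonZero L≥1}}

    -- The number of blocks has to be a successor for a last block to exist, which holds for `L`
    -- only propositionally; hence L′ and H are variables tied to the intended values by equations.
    build : ∀ L′ H → suc L′ ≡ L → 1 ≤ H → H ≡ n * n → Separated d k (N + (N + r)) 99
    build L′ H eT H≥1 eH = separate 𝒮 d k r 99 ≤-refl (s≤s (≤-trans (≤ᵇ⇒≤ 2 87 tt) (≤-trans k≥87 k≤d))) 3Δ≤k N≥1
        (λ e small → ≤-trans (≤-pred (≤-trans (enough e (≤-trans small (≤-reflexive (cong (_^ (1 * k)) n≡)))) (≤-reflexive (sym eT))))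
          (≤-reflexive (sym (top-system N D δ B L′ H (columns′ H≥1) B≥1 N≥1 m≥1 room sparse′ large′))))
      where
      m≥1 : 1 ≤ suc L′ * (H * H)
      m≥1 = *-mono-≤ {1} {suc L′} (s≤s z≤n) (*-mono-≤ H≥1 H≥1)
      nodes≡ : suc L′ * (H * H) ≡ L * (n * n * (n * n))
      nodes≡ = cong₂ (λ t h → t * (h * h)) eT eH
      sparse′ : suc (D + D) * (suc L′ * (H * H) * 2 ^ Δ) ≤ B ^ δ
      sparse′ = subst (λ z → suc (D + D) * (z * 2 ^ Δ) ≤ B ^ δ) (sym nodes≡) sparse
      large′ : suc (suc L′ * suc (suc D)) * (suc L′ * (H * H)) ^ suc D ≤ 2 ^ H
      large′ = subst (λ h → suc (suc L′ * suc (suc D)) * (suc L′ * (h * h)) ^ suc D ≤ 2 ^ h) (sym eH)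
        (subst (λ t → suc (t * suc (suc D)) * (t * (n * n * (n * n))) ^ suc D ≤ 2 ^ (n * n)) (sym eT) large)
      𝒮 : System D
      𝒮 = system N D δ B L′ H (columns′ H≥1) B≥1 N≥1 m≥1 room sparse′ large′

  separated : Separated d k n 99
  separated = subst (λ n′ → Separated d k n′ 99) n≡ (build (ℕ.pred L) H suc-pred-L H≥1 refl)

hypothesis : ∀ d k n → 1 ≤ d → 1 ≤ k → 9216 * d ^ 8 * k ^ 6 ≤ n → d * k * (d * k) * 9216 ≤ n
hypothesis d k n d≥1 k≥1 big = begin
  d * k * (d * k) * 9216       ≡⟨ solve 3 (λ a d k → d :* k :* (d :* k) :* a := a :* (d :* (d :* con 1)) :* (k :* (k :* con 1))) refl 9216 d k ⟩
  9216 * d ^ 2 * k ^ 2         ≤⟨ *-mono-≤ (*-monoʳ-≤ 9216 (^-monoʳ-≤ d {{>-nonZero d≥1}} (≤ᵇ⇒≤ 2 8 tt))) (^-monoʳ-≤ k {{>-nonZero k≥1}} (≤ᵇ⇒≤ 2 6 tt)) ⟩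
  9216 * d ^ 8 * k ^ 6         ≤⟨ big ⟩
  n                            ∎
  where open ≤-Reasoning

theorem1p5 : Σ ℕ λ k₀ → Σ ℕ λ a → Σ ℕ λ b → Σ ℕ λ p → Σ ℕ λ q →
    (1 ≤ a) × (1 ≤ b) × (1 ≤ p) × (1 ≤ q) ×
    ((d k n : ℕ) → k₀ ≤ k → k ≤ d → a * (d ^ 8) * (k ^ 6) ≤ b * n →
    Σ Vocab λ σ → Σ (Structure σ n) λ A → Σ (Structure σ n) λ B →
    KAry k σ ×
    (Σ (Formula σ k) λ φ → IsFO φ × Sentence φ × (A ⊨ φ) × ¬ (B ⊨ φ)) ×
    ((ψ : Formula σ d) → Sentence ψ → qr ψ ^ q ≤ n ^ (p * k) →
    (A ⊨ ψ) ⇔ (B ⊨ ψ)))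
theorem1p5 = 87 , 9216 , 1 , 1 , 99 , s≤s z≤n , s≤s z≤n , s≤s z≤n , s≤s z≤n ,
  λ d k n k≥87 k≤d big → separated d k n k≥87 k≤d
    (hypothesis d k n (≤-trans (s≤s z≤n) (≤-trans k≥87 k≤d)) (≤-trans (s≤s z≤n) k≥87) (≤-trans big (≤-reflexive (*-identityˡ n))))
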